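{- Let $\Gamma$ be a loopless metric graph. Then the set $B(\Gamma)$ of branching points of $\Gamma$ is rank-determining; that is, for every divisor $D\in\mathrm{Div}(\Gamma)$ one has $r_\Gamma(D)=r_{B(\Gamma)}(D)$.
   Context: A metric graph $\Gamma$ is a finite connected multigraph in which each edge is assigned a positive (finite) real length; each edge is identified with a closed interval of that length, with the end points of the interval identified with the end vertices of the edge. It is loopless if no edge has coinciding end vertices (parallel edges are allowed). The points of $\Gamma$ are all points of these intervals. The vertices of the underlying multigraph are called branching points (vertices of degree two are allowed) and their set is denoted $B(\Gamma)$. $\mathrm{Div}(\Gamma)$ is the free abelian group on the set of points of $\Gamma$; a divisor $D=\sum_v D(v)(v)$ is effective ($D\ge0$) if $D(v)\ge 0$ for all $v$, and $\deg(D)=\sum_v D(v)$. For a set $A$ of points of $\Gamma$, $\mathrm{Div}(A)$ denotes the free abelian group on $A$, viewed as a subgroup of $\mathrm{Div}(\Gamma)$. A rational function on $\Gamma$ is a continuous function $f:\Gamma\to\mathbb R$ which is piecewise linear with finitely many pieces and integer slopes on every edge. For a point $v$, $\mathrm{ord}_v(f)$ is the sum of the outgoing slopes of $f$ over all segments emanating from $v$, and $\mathrm{div}(f)=\sum_v\mathrm{ord}_v(f)(v)$. Divisors $D,D'$ are equivalent, $D\sim D'$, if $D=D'+\mathrm{div}(f)$ for some rational function $f$. Put $|D|=\{E\in\mathrm{Div}(\Gamma):E\ge0,\ E\sim D\}$. The rank of $D$ is $$r_\Gamma(D)=\min\{\deg(E):E\in\mathrm{Div}(\Gamma),\ E\ge0,\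 |D-E|=\emptyset\}-1,$$ and, for a non-empty set $A$ of points of $\Gamma$, the $A$-restricted rank of $D$ is $$r_A(D)=\min\{\deg(E):E\in\mathrm{Div}(A),\ E\ge0,\ |D-E|=\emptyset\}-1.$$ The set $A$ is rank-determining if $r_\Gamma(D)=r_A(D)$ for every $D\in\mathrm{Div}(\Gamma)$. -}

module Defs where

open import Algebra.Bundles using (CommutativeMonoid)
open import Algebra.Bundles.Raw using (RawMonoid)
import Algebra.Definitions.RawMonoid as Multiples
import Algebra.Properties.CommutativeMonoid.Sum as Sum
import Algebra.Properties.CommutativeSemigroup as Semigroup
open import Axiom.ExcludedMiddle using (ExcludedMiddle)
open import Data.Fin.Base using (Fin)
open import Data.Integer.Base as ℤ using (ℤ; +_; -[1+_]; 0ℤ; 1ℤ)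
import Data.Integer.Properties as ℤ
open import Data.List.Base using (List; []; _∷_; _++_; map)
open import Data.Nat.Base as ℕ using (ℕ; suc; NonZero)
import Data.Nat.Properties as ℕ
open import Data.Product.Base using (Σ; Σ-syntax; ∃; ∃-syntax; _×_; _,_; map₁)
open import Data.Rational.Base as ℚ using (ℚ; 0ℚ; ½)
import Data.Rational.Properties as ℚ
open import Data.Sum.Base using (_⊎_)
open import Level using (0ℓ)
open import Relation.Binary.Construct.Closure.Equivalence using (EqClosure)
open import Relation.Binary.PropositionalEquality
  using (_≡_; _≢_; refl; sym; trans; cong; subst)
open import Relation.Nullary using (¬_; yes; no)
open import Relation.Unary using (Pred; _∈_; U)

------------------------------------------------------------------------
-- Real numbers: Cauchy sequences of rationals modulo null sequences.
-- Only the ordered additive group of ℝ is needed.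

record ℝ : Set where
  constructor mkℝ
  field
    seq    : ℕ → ℚ
    cauchy : ∀ ε → 0ℚ ℚ.< ε →
             ∃[ N ] (∀ m n → N ℕ.≤ m → N ℕ.≤ n → ℚ.∣ seq m ℚ.- seq n ∣ ℚ.< ε)

open ℝ public

infix  4 _≃_ _≤_ _<_
infixl 6 _+_ _-_
infix  8 -_
infixr 7 _·_

_≃_ : ℝ → ℝ → Set
x ≃ y = ∀ ε → 0ℚ ℚ.< ε →
        ∃[ N ] (∀ n → N ℕ.≤ n → ℚ.∣ seq x n ℚ.- seq y n ∣ ℚ.< ε)

_≤_ : ℝ → ℝ → Set
x ≤ y = ∀ ε → 0ℚ ℚ.< ε →
        ∃[ N ] (∀ n → N ℕ.≤ n → seq x n ℚ.< seq y n ℚ.+ ε)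

_<_ : ℝ → ℝ → Set
x < y = ∃[ ε ] (0ℚ ℚ.< ε ×
        ∃[ N ] (∀ n → N ℕ.≤ n → seq x n ℚ.+ ε ℚ.< seq y n))

0ℝ : ℝ
0ℝ = mkℝ (λ _ → 0ℚ) (λ _ 0<ε → 0 , λ _ _ _ _ → 0<ε)

-_ : ℝ → ℝ
- x = mkℝ (λ n → ℚ.- seq x n) λ ε 0<ε →
  let (N , close) = cauchy x ε 0<ε in
  N , λ m n N≤m N≤n →
    subst (ℚ._< ε) (flip-sign (seq x m) (seq x n)) (close m n N≤m N≤n)
  where
  flip-sign : ∀ p q → ℚ.∣ p ℚ.- q ∣ ≡ ℚ.∣ ℚ.- p ℚ.- ℚ.- q ∣
  flip-sign p q = trans (sym (ℚ.∣-p∣≡∣p∣ (p ℚ.- q)))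
                        (cong ℚ.∣_∣ (ℚ.neg-distrib-+ p (ℚ.- q)))

_+_ : ℝ → ℝ → ℝ
x + y = mkℝ (λ n → seq x n ℚ.+ seq y n) λ ε 0<ε →
  let (M , closeˣ) = cauchy x (½ ℚ.* ε) (half-pos ε 0<ε)
      (N , closeʸ) = cauchy y (½ ℚ.* ε) (half-pos ε 0<ε)
  in M ℕ.⊔ N , λ m n le le′ →
    bound (seq x m) (seq x n) (seq y m) (seq y n) ε
      (closeˣ m n (ℕ.m⊔n≤o⇒m≤o M N le) (ℕ.m⊔n≤o⇒m≤o M N le′))
      (closeʸ m n (ℕ.m⊔n≤o⇒n≤o M N le) (ℕ.m⊔n≤o⇒n≤o M N le′))
  where
  open Semigroup (CommutativeMonoid.commutativeSemigroup ℚ.+-0-commutativeMonoid)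
    using (interchange)

  half-pos : ∀ ε → 0ℚ ℚ.< ε → 0ℚ ℚ.< ½ ℚ.* ε
  half-pos ε 0<ε =
    subst (ℚ._< ½ ℚ.* ε) (ℚ.*-zeroʳ ½) (ℚ.*-monoʳ-<-pos ½ 0<ε)

  halves : ∀ ε → ½ ℚ.* ε ℚ.+ ½ ℚ.* ε ≡ ε
  halves ε = trans (sym (ℚ.*-distribʳ-+ ε ½ ½)) (ℚ.*-identityˡ ε)

  regroup : ∀ a b c d → (a ℚ.- b) ℚ.+ (c ℚ.- d) ≡ (a ℚ.+ c) ℚ.- (b ℚ.+ d)
  regroup a b c d = trans
    (interchange a (ℚ.- b) c (ℚ.- d))
    (cong ((a ℚ.+ c) ℚ.+_) (sym (ℚ.neg-distrib-+ b d)))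

  bound : ∀ a b c d ε →
          ℚ.∣ a ℚ.- b ∣ ℚ.< ½ ℚ.* ε → ℚ.∣ c ℚ.- d ∣ ℚ.< ½ ℚ.* ε →
          ℚ.∣ (a ℚ.+ c) ℚ.- (b ℚ.+ d) ∣ ℚ.< ε
  bound a b c d ε p q = begin-strict
    ℚ.∣ (a ℚ.+ c) ℚ.- (b ℚ.+ d) ∣       ≡⟨ cong ℚ.∣_∣ (sym (regroup a b c d)) ⟩
    ℚ.∣ (a ℚ.- b) ℚ.+ (c ℚ.- d) ∣       ≤⟨ ℚ.∣p+q∣≤∣p∣+∣q∣ (a ℚ.- b) (c ℚ.- d) ⟩
    ℚ.∣ a ℚ.- b ∣ ℚ.+ ℚ.∣ c ℚ.- d ∣     <⟨ ℚ.+-mono-< p q ⟩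
    ½ ℚ.* ε ℚ.+ ½ ℚ.* ε                 ≡⟨ halves ε ⟩
    ε                                   ∎
    where open ℚ.≤-Reasoning

_-_ : ℝ → ℝ → ℝ
x - y = x + - y

+-rawMonoid : RawMonoid 0ℓ 0ℓ
+-rawMonoid = record { Carrier = ℝ ; _≈_ = _≃_ ; _∙_ = _+_ ; ε = 0ℝ }

_·_ : ℤ → ℝ → ℝ
(+ n)    · x = Multiples._×_ +-rawMonoid n x
-[1+ n ] · x = - Multiples._×_ +-rawMonoid (suc n) x

------------------------------------------------------------------------
-- Metric graphs

-- The choice of a source and a target only fixes a parametrisation of
-- each edge by [0, length]; nothing below depends on it.

record MetricGraph : Set where
  field
    order size : ℕ
    src tgt    : Fin size → Fin order
    length     : Fin size → ℝ
    length-pos : ∀ e → 0ℝ < length e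
    nonEmpty   : NonZero order
    connected  : ∀ v w →
      EqClosure (λ a b → ∃[ e ] (src e ≡ a × tgt e ≡ b)) v w

Loopless : MetricGraph → Set
Loopless Γ = ∀ e → src e ≢ tgt e
  where open MetricGraph Γ

record Interval (ℓ : ℝ) : Set where
  constructor interval
  field
    pos : ℝ
    0≤pos : 0ℝ ≤ pos
    pos≤ℓ : pos ≤ ℓ

open Interval public using (pos)

module _ (Γ : MetricGraph) where
  open MetricGraph Γ

  -- The set of points is this type modulo _≈_, which glues the ends of
  -- each closed interval to the end vertices of its edge.

  data Point : Set where
    vertex : Fin order → Point
    on     : (e : Fin size) → Interval (length e) → Point

module _ {Γ : MetricGraph} where
  open MetricGraph Γ

  data IsVertex : Point Γ → Fin order → Set where
    at-vertex : ∀ {v} → IsVertex (vertex v) v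
    at-src    : ∀ {e t} → pos t ≃ 0ℝ → IsVertex (on e t) (src e)
    at-tgt    : ∀ {e t} → pos t ≃ length e → IsVertex (on e t) (tgt e)

  infix 4 _≈_

  data _≈_ : Point Γ → Point Γ → Set where
    same-vertex   : ∀ {x y v} → IsVertex x v → IsVertex y v → x ≈ y
    same-position : ∀ {e t u} → pos t ≃ pos u → on e t ≈ on e u

  -- A set of points of Γ is a predicate on representatives; this one is
  -- closed under _≈_.

  BranchingPoint : Pred (Point Γ) 0ℓ
  BranchingPoint x = ∃[ v ] x ≈ vertex v

------------------------------------------------------------------------
-- Rational functions

module _ (Γ : MetricGraph) where
  open MetricGraph Γ

  HasSlope : (Point Γ → ℝ) → Fin size → ℝ → ℝ → ℤ → Set
  HasSlope f e a b s =
    ∀ (t u : Interval (length e)) →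
    a ≤ pos t → pos t ≤ b → a ≤ pos u → pos u ≤ b →
    f (on e u) ≃ f (on e t) + s · (pos u - pos t)

  -- A subdivision of [a, length e] into finitely many closed pieces, on
  -- each of which f has constant integer slope.

  data Pieces (f : Point Γ → ℝ) (e : Fin size) (a : ℝ) : Set where
    last : ∀ s → HasSlope f e a (length e) s → Pieces f e a
    step : ∀ b s → a < b → b < length e →
           HasSlope f e a b s → Pieces f e b → Pieces f e a

  -- Continuity on Γ is automatic: the pieces are closed, and value-cong
  -- makes the values at the ends of the edges match up at each vertex.

  record RationalFunction : Set where
    field
      value      : Point Γ → ℝ
      value-cong : ∀ {x y} → x ≈ y → value x ≃ value y
      pieces     : ∀ e → Pieces value e 0ℝ

open RationalFunction public using (value; value-cong; pieces)

------------------------------------------------------------------------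
-- Divisors

-- Excluded middle decides equality of points and existence of a segment;
-- neither is decidable constructively over ℝ.

module Divisors (em : ExcludedMiddle 0ℓ) (Γ : MetricGraph) where
  open MetricGraph Γ
  open Sum ℤ.+-0-commutativeMonoid using (sum)

  -- Formal ℤ-linear combinations of points; two of them are the same
  -- divisor when they have the same coefficient at every point.

  Divisor : Set
  Divisor = List (ℤ × Point Γ)

  coeff : Divisor → Point Γ → ℤ
  coeff []            v = 0ℤ
  coeff ((n , w) ∷ D) v with em {w ≈ v}
  ... | yes _ = n ℤ.+ coeff D v
  ... | no  _ = coeff D v

  deg : Divisor → ℤ
  deg []            = 0ℤ
  deg ((n , _) ∷ D) = n ℤ.+ deg D

  infixl 6 _⊖_

  _⊖_ : Divisor → Divisor → Divisor
  D ⊖ E = D ++ map (map₁ (λ n → ℤ.- n)) E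

  Effective : Divisor → Set
  Effective D = ∀ v → 0ℤ ℤ.≤ coeff D v

  Div : Pred (Point Γ) 0ℓ → Pred Divisor 0ℓ
  Div A D = ∀ v → coeff D v ≢ 0ℤ → v ∈ A

  data Direction : Set where
    forward backward : Direction

  -- s is the outgoing slope of f along a non-degenerate segment of the
  -- edge e emanating from v in the given direction.  In a direction in
  -- which no segment of e emanates from v, there is no such s.

  OutgoingSlope : RationalFunction Γ → Point Γ → Fin size → Direction → ℤ → Set
  OutgoingSlope f v e forward s =
    Σ[ t ∈ Interval (length e) ] Σ[ u ∈ Interval (length e) ]
      (on e t ≈ v × pos t < pos u × HasSlope Γ (value f) e (pos t) (pos u) s)
  OutgoingSlope f v e backward s =
    Σ[ t ∈ Interval (length e) ] Σ[ u ∈ Interval (length e) ]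
      (on e t ≈ v × pos u < pos t × HasSlope Γ (value f) e (pos u) (pos t) (ℤ.- s))

  slope : RationalFunction Γ → Point Γ → Fin size → Direction → ℤ
  slope f v e d with em {∃[ s ] OutgoingSlope f v e d s}
  ... | yes (s , _) = s
  ... | no  _       = 0ℤ

  ord : Point Γ → RationalFunction Γ → ℤ
  ord v f = sum (λ e → slope f v e forward ℤ.+ slope f v e backward)

  infix 4 _∼_

  _∼_ : Divisor → Divisor → Set
  D ∼ D′ = Σ (RationalFunction Γ) λ f → ∀ v → coeff D v ≡ coeff D′ v ℤ.+ ord v f

  ∣_∣ : Divisor → Pred Divisor 0ℓ
  ∣ D ∣ E = Effective E × E ∼ D

  IsMinimum : Pred ℤ 0ℓ → ℤ → Set
  IsMinimum P m = m ∈ P × (∀ k → k ∈ P → m ℤ.≤ k)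

  ObstructedDegree : Pred (Point Γ) 0ℓ → Divisor → Pred ℤ 0ℓ
  ObstructedDegree A D k =
    ∃[ E ] (E ∈ Div A × Effective E × ¬ (∃[ F ] F ∈ ∣ D ⊖ E ∣) × deg E ≡ k)

  -- r = r_A(D); the rank r_Γ(D) is the case A = U of all points.

  HasRank : Pred (Point Γ) 0ℓ → Divisor → ℤ → Set
  HasRank A D r = ∃[ m ] (IsMinimum (ObstructedDegree A D) m × r ≡ m ℤ.- 1ℤ)

  -- The equality r_Γ(D) = r_A(D), including that both sides exist.

  RankDetermining : Pred (Point Γ) 0ℓ → Set
  RankDetermining A = ∀ D → ∃[ r ] (HasRank U D r × HasRank A D r)

{-# OPTIONS --safe #-}

-- Let D + div f ≥ (v) and D + div g ≥ (w) for the ends v ≠ w of an edge e, and let x lie on e.  Shift g so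
-- that f(x) = g(x), and let h = max(f, g).  At every point h touches f or g from above, so its slopes there
-- are at least those of f or of g, whence D + div h ≥ 0; and D + div h > 0 wherever f and g meet with
-- different slopes.  Moving from x along e in either direction, one reaches such a point or else the end of
-- e, at which there is a chip by the choice of f and g.  So D + div h has chips at points a and b of e with
-- x between them; if neither is x itself, then they are distinct because e is not a loop, and moving both
-- of them inwards at the same speed brings one to x.  Thus if |D − (v)| is non-empty for every vertex v, so
-- is |D − (x)| for every point x, and the points of an effective divisor E with |D − E| = ∅ can be replaced
-- one at a time by vertices.

module Submission where

open import Algebra.Bundles using (AbelianGroup; CommutativeMonoid)
import Algebra.Properties.AbelianGroup as AbelianGroupProperties
import Algebra.Properties.CommutativeMonoid.Sum as Sum
import Algebra.Properties.CommutativeSemigroup as Semigroup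
import Algebra.Properties.Monoid.Mult as Mult
open import Algebra.Structures using (IsAbelianGroup)
open import Axiom.ExcludedMiddle using (ExcludedMiddle)
open import Data.Fin.Base using (Fin; zero; suc)
import Data.Fin.Properties as Fin
open import Data.Integer.Base as ℤ using (ℤ; +_; -[1+_]; 0ℤ; 1ℤ; -1ℤ)
import Data.Integer.Properties as ℤ
open import Data.Integer.Solver using (module +-*-Solver)
open import Data.List.Base as List using (List; []; _∷_; _++_)
import Data.List.Properties as List
open import Data.Nat.Base as ℕ using (ℕ; zero; suc)
import Data.Nat.Properties as ℕ
open import Data.Product.Base using (∃-syntax; _×_; _,_; proj₁; proj₂; map₁)
open import Data.Rational.Base as ℚ using (ℚ; 0ℚ; 1ℚ; ½)
import Data.Rational.Properties as ℚ
import Data.Rational.Solver as ℚ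
open import Data.Sum.Base using (_⊎_; inj₁; inj₂)
open import Data.Unit.Base using (tt)
open import Data.Vec.Base as Vec using (Vec; []; _∷_)
open import Level using (0ℓ)
open import Relation.Binary.PropositionalEquality as ≡ using (_≡_; _≢_)
import Relation.Binary.Reasoning.Setoid as SetoidReasoning
import Relation.Binary.Reflection as Reflection
open import Relation.Nullary using (¬_; Dec; yes; no; contradiction)
open import Relation.Nullary.Decidable using (decidable-stable)
open import Relation.Unary using (Pred; U)

-- What is used of ℝ: it is a totally ordered divisible abelian group.

-- Outgoing slopes count positively, so passing to a maximum can only add chips at a point where two
-- functions meet; a minimum would lose them. Shifting g is free, since constants have divisor 0,
-- and it makes x a point of agreement from which the search along e can start. The two chips must
-- move at equal speed because the function that moves them has to return to the same value at both
-- ends of e: only then does it extend by zero over the rest of the graph. A point of E is replaced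
-- with the remaining points already subtracted from D: if it cannot be afforded, then neither can
-- some vertex, and the degree of E does not change. So the two ranks are minima of the same set of
-- degrees, and what is left is that this set is non-empty. For this one needs that div f has degree
-- 0: an E of degree above deg D always obstructs. Two features of the definitions shape the rest. A
-- point has several representatives, so slopes are compared at different points of equal position;
-- and slopes are picked by excluded middle, so uniqueness has to tie them to explicit subdivisions
-- of the edges.

record OrderedGroup : Set₁ where
  infix  4 _≈_ _≤_ _<_
  infixl 6 _+_
  infix  8 -_
  infixr 7 _·_
  field
    Carrier  : Set
    _≈_ _≤_ _<_ : Carrier → Carrier → Set
    _+_      : Carrier → Carrier → Carrier
    0#       : Carrier
    -_       : Carrier → Carrier
    _·_      : ℤ → Carrier → Carrier
    isAbelianGroup : IsAbelianGroup _≈_ _+_ 0# -_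
    0·       : ∀ x → 0ℤ · x ≈ 0#
    suc·     : ∀ n x → (+ suc n) · x ≈ x + (+ n) · x
    neg·     : ∀ n x → -[1+ n ] · x ≈ - ((+ suc n) · x)
    ≤-reflexive : ∀ {x y} → x ≈ y → x ≤ y
    ≤-trans  : ∀ {x y z} → x ≤ y → y ≤ z → x ≤ z
    ≤-antisym : ∀ {x y} → x ≤ y → y ≤ x → x ≈ y
    +-mono-≤ : ∀ {x y u v} → x ≤ y → u ≤ v → x + u ≤ y + v
    _≤?_     : ∀ x y → Dec (x ≤ y)
    ≰⇒>      : ∀ {x y} → ¬ (x ≤ y) → y < x
    <⇒≤      : ∀ {x y} → x < y → x ≤ y
    <⇒≱      : ∀ {x y} → x < y → ¬ (y ≤ x)
    divisible : ∀ n x → ∃[ y ] ((+ suc n) · y ≈ x)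

-- Arithmetic in a totally ordered abelian group

module OrderedGroupProperties (R : OrderedGroup) where
  open OrderedGroup R public

  abelianGroup : AbelianGroup _ _
  abelianGroup = record { isAbelianGroup = isAbelianGroup }

  open AbelianGroup abelianGroup public
    using (setoid; monoid; refl; sym; trans; reflexive)
    renaming ( ∙-cong to +-cong; ∙-congˡ to +-congˡ; ∙-congʳ to +-congʳ
             ; ⁻¹-cong to neg-cong; assoc to +-assoc; comm to +-comm
             ; identityˡ to +-identityˡ; identityʳ to +-identityʳ
             ; inverseˡ to +-inverseˡ; inverseʳ to +-inverseʳ)
  open AbelianGroupProperties abelianGroup
    using () renaming (⁻¹-involutive to neg-involutive; ⁻¹-∙-comm to neg-+-comm; ε⁻¹≈ε to neg-0)
  open Mult monoid using () renaming (_×_ to _×′_; ×-homo-+ to ×′-homo-+; ×-congʳ to ×′-congʳ)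
  module ≈R = SetoidReasoning setoid

  infixl 6 _-_
  _-_ : Carrier → Carrier → Carrier
  x - y = x + - y

  +· : ∀ n x → (+ n) · x ≈ n ×′ x
  +· zero    x = 0· x
  +· (suc n) x = trans (suc· n x) (+-congˡ (+· n x))

  -· : ∀ n x → (ℤ.- (+ n)) · x ≈ - (n ×′ x)
  -· zero    x = trans (0· x) (sym neg-0)
  -· (suc n) x = trans (neg· n x) (neg-cong (+· (suc n) x))

  ·-cong : ∀ s {x y} → x ≈ y → s · x ≈ s · y
  ·-cong (+ n)    {x} {y} x≈y = trans (+· n x) (trans (×′-congʳ n x≈y) (sym (+· n y)))
  ·-cong -[1+ n ] {x} {y} x≈y =
    trans (-· (suc n) x) (trans (neg-cong (×′-congʳ (suc n) x≈y)) (sym (-· (suc n) y)))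

  ·-neg : ∀ s x → (ℤ.- s) · x ≈ - (s · x)
  ·-neg (+ n)    x = trans (-· n x) (neg-cong (sym (+· n x)))
  ·-neg -[1+ n ] x = trans (+· (suc n) x)
    (trans (sym (neg-involutive _)) (neg-cong (sym (-· (suc n) x))))

  -- Addition of integers of opposite signs computes to `ℤ._⊖_`, so this is the mixed case of
  -- `·-distribʳ`.
  ⊖· : ∀ m n x → (m ℤ.⊖ n) · x ≈ m ×′ x - n ×′ x
  ⊖· m zero x = begin
    (m ℤ.⊖ 0) · x    ≡⟨ ≡.cong (_· x) (ℤ.⊖-≥ {m} ℕ.z≤n) ⟩
    (+ m) · x        ≈⟨ +· m x ⟩
    m ×′ x           ≈⟨ +-identityʳ _ ⟨
    m ×′ x + 0#      ≈⟨ +-congˡ neg-0 ⟨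
    m ×′ x - 0 ×′ x  ∎
    where open ≈R
  ⊖· zero (suc n) x = trans (-· (suc n) x) (sym (+-identityˡ _))
  ⊖· (suc m) (suc n) x = begin
    (suc m ℤ.⊖ suc n) · x              ≡⟨ ≡.cong (_· x) (ℤ.[1+m]⊖[1+n]≡m⊖n m n) ⟩
    (m ℤ.⊖ n) · x                      ≈⟨ ⊖· m n x ⟩
    m ×′ x - n ×′ x                    ≈⟨ +-congʳ (+-identityˡ _) ⟨
    (0# + m ×′ x) - n ×′ x             ≈⟨ +-congʳ (+-congʳ (+-inverseʳ x)) ⟨
    (x - x + m ×′ x) - n ×′ x          ≈⟨ +-congʳ (+-assoc x (- x) _) ⟩
    x + (- x + m ×′ x) - n ×′ x        ≈⟨ +-congʳ (+-congˡ (+-comm (- x) _)) ⟩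
    x + (m ×′ x - x) - n ×′ x          ≈⟨ +-congʳ (+-assoc x _ _) ⟨
    x + m ×′ x - x - n ×′ x            ≈⟨ +-assoc _ _ _ ⟩
    x + m ×′ x + (- x - n ×′ x)        ≈⟨ +-congˡ (neg-+-comm x (n ×′ x)) ⟩
    x + m ×′ x - (x + n ×′ x)          ∎
    where open ≈R

  ·-distribʳ : ∀ s t x → (s ℤ.+ t) · x ≈ s · x + t · x
  ·-distribʳ (+ m)    (+ n)    x = trans (+· (m ℕ.+ n) x)
    (trans (×′-homo-+ x m n) (sym (+-cong (+· m x) (+· n x))))
  ·-distribʳ (+ m)    -[1+ n ] x = trans (⊖· m (suc n) x) (sym (+-cong (+· m x) (-· (suc n) x)))
  ·-distribʳ -[1+ m ] (+ n)    x = trans (⊖· n (suc m) x)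
    (trans (sym (+-cong (+· n x) (-· (suc m) x))) (+-comm _ _))
  ·-distribʳ -[1+ m ] -[1+ n ] x = begin
    -[1+ suc (m ℕ.+ n) ] · x             ≡⟨ ≡.cong (λ k → -[1+ k ] · x) (≡.sym (ℕ.+-suc m n)) ⟩
    -[1+ m ℕ.+ suc n ] · x               ≈⟨ -· (suc m ℕ.+ suc n) x ⟩
    - ((suc m ℕ.+ suc n) ×′ x)           ≈⟨ neg-cong (×′-homo-+ x (suc m) (suc n)) ⟩
    - (suc m ×′ x + suc n ×′ x)          ≈⟨ neg-+-comm _ _ ⟨
    - (suc m ×′ x) - suc n ×′ x          ≈⟨ +-cong (-· (suc m) x) (-· (suc n) x) ⟨
    -[1+ m ] · x + -[1+ n ] · x          ∎
    where open ≈R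

  1· : ∀ x → 1ℤ · x ≈ x
  1· x = trans (+· 1 x) (+-identityʳ x)

  -- An expression is normalised to its vector of integer coefficients, so an identity between two
  -- expressions is proved by `refl` as soon as their coefficients agree.
  module Solver where

    infixl 6 _⊕_
    infix  8 ⊝_

    data Expr (n : ℕ) : Set where
      var : Fin n → Expr n
      nil : Expr n
      _⊕_ : Expr n → Expr n → Expr n
      ⊝_  : Expr n → Expr n

    unit : ∀ {n} → Fin n → Vec ℤ n
    unit {suc n} zero    = 1ℤ ∷ Vec.replicate n 0ℤ
    unit {suc n} (suc i) = 0ℤ ∷ unit i

    normalise : ∀ {n} → Expr n → Vec ℤ n
    normalise (var i) = unit i
    normalise {n} nil = Vec.replicate n 0ℤ
    normalise (a ⊕ b) = Vec.zipWith ℤ._+_ (normalise a) (normalise b)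
    normalise (⊝ a)   = Vec.map (λ s → ℤ.- s) (normalise a)

    combine : ∀ {n} → Vec ℤ n → Vec Carrier n → Carrier
    combine []       []      = 0#
    combine (s ∷ ss) (x ∷ ρ) = s · x + combine ss ρ

    ⟦_⟧ ⟦_⇓⟧ : ∀ {n} → Expr n → Vec Carrier n → Carrier
    ⟦ var i ⟧ ρ = Vec.lookup ρ i
    ⟦ nil   ⟧ ρ = 0#
    ⟦ a ⊕ b ⟧ ρ = ⟦ a ⟧ ρ + ⟦ b ⟧ ρ
    ⟦ ⊝ a   ⟧ ρ = - ⟦ a ⟧ ρ
    ⟦ a ⇓⟧  ρ = combine (normalise a) ρ

    combine-0 : ∀ {n} (ρ : Vec Carrier n) → combine (Vec.replicate n 0ℤ) ρ ≈ 0#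
    combine-0 []      = refl
    combine-0 (x ∷ ρ) = trans (+-cong (0· x) (combine-0 ρ)) (+-identityˡ 0#)

    combine-unit : ∀ {n} i (ρ : Vec Carrier n) → combine (unit i) ρ ≈ Vec.lookup ρ i
    combine-unit zero    (x ∷ ρ) = trans (+-cong (1· x) (combine-0 ρ)) (+-identityʳ x)
    combine-unit (suc i) (x ∷ ρ) = trans (+-cong (0· x) (combine-unit i ρ)) (+-identityˡ _)

    interchange : ∀ a b c d → (a + b) + (c + d) ≈ (a + c) + (b + d)
    interchange a b c d = begin
      (a + b) + (c + d)  ≈⟨ +-assoc a b _ ⟩
      a + (b + (c + d))  ≈⟨ +-congˡ (+-assoc b c d) ⟨
      a + (b + c + d)    ≈⟨ +-congˡ (+-congʳ (+-comm b c)) ⟩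
      a + (c + b + d)    ≈⟨ +-congˡ (+-assoc c b d) ⟩
      a + (c + (b + d))  ≈⟨ +-assoc a c _ ⟨
      (a + c) + (b + d)  ∎
      where open ≈R

    combine-+ : ∀ {n} (ss ts : Vec ℤ n) ρ →
                combine (Vec.zipWith ℤ._+_ ss ts) ρ ≈ combine ss ρ + combine ts ρ
    combine-+ []       []       []      = sym (+-identityˡ 0#)
    combine-+ (s ∷ ss) (t ∷ ts) (x ∷ ρ) =
      trans (+-cong (·-distribʳ s t x) (combine-+ ss ts ρ)) (interchange _ _ _ _)

    combine-neg : ∀ {n} (ss : Vec ℤ n) ρ → combine (Vec.map (λ s → ℤ.- s) ss) ρ ≈ - combine ss ρ
    combine-neg []       []      = sym neg-0
    combine-neg (s ∷ ss) (x ∷ ρ) = trans (+-cong (·-neg s x) (combine-neg ss ρ)) (neg-+-comm _ _)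

    correct : ∀ {n} (a : Expr n) ρ → ⟦ a ⇓⟧ ρ ≈ ⟦ a ⟧ ρ
    correct (var i) ρ = combine-unit i ρ
    correct nil     ρ = combine-0 ρ
    correct (a ⊕ b) ρ = trans (combine-+ (normalise a) (normalise b) ρ) (+-cong (correct a ρ) (correct b ρ))
    correct (⊝ a)   ρ = trans (combine-neg (normalise a) ρ) (neg-cong (correct a ρ))

    open Reflection setoid var ⟦_⟧ ⟦_⇓⟧ correct public using (solve; _⊜_)

  open Solver using (solve; _⊕_; ⊝_; nil; _⊜_)

  ·-distribˡ : ∀ s x y → s · (x + y) ≈ s · x + s · y
  ·-distribˡ (+ n) x y = trans (+· n _) (trans (go n) (sym (+-cong (+· n x) (+· n y))))
    where
    go : ∀ n → n ×′ (x + y) ≈ n ×′ x + n ×′ y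
    go zero    = sym (+-identityˡ 0#)
    go (suc n) = trans (+-congˡ (go n)) (Solver.interchange x y _ _)
  ·-distribˡ -[1+ n ] x y = begin
    -[1+ n ] · (x + y)            ≈⟨ neg· n _ ⟩
    - ((+ suc n) · (x + y))       ≈⟨ neg-cong (·-distribˡ (+ suc n) x y) ⟩
    - ((+ suc n) · x + (+ suc n) · y) ≈⟨ neg-+-comm _ _ ⟨
    - ((+ suc n) · x) - (+ suc n) · y ≈⟨ +-cong (neg· n x) (neg· n y) ⟨
    -[1+ n ] · x + -[1+ n ] · y   ∎
    where open ≈R

  ·-0 : ∀ s → s · 0# ≈ 0#
  ·-0 s = begin
    s · 0#                     ≈⟨ solve 1 (λ a → a ⊜ a ⊕ a ⊕ ⊝ a) refl (s · 0#) ⟩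
    s · 0# + s · 0# - s · 0#   ≈⟨ +-congʳ (·-distribˡ s 0# 0#) ⟨
    s · (0# + 0#) - s · 0#     ≈⟨ +-congʳ (·-cong s (+-identityˡ 0#)) ⟩
    s · 0# - s · 0#            ≈⟨ +-inverseʳ _ ⟩
    0#                         ∎
    where open ≈R

  ·-negʳ : ∀ s x → s · (- x) ≈ - (s · x)
  ·-negʳ s x = begin
    s · (- x)                   ≈⟨ solve 2 (λ a b → a ⊜ b ⊕ a ⊕ ⊝ b) refl _ (s · x) ⟩
    s · x + s · (- x) - s · x   ≈⟨ +-congʳ (·-distribˡ s x (- x)) ⟨
    s · (x - x) - s · x         ≈⟨ +-congʳ (trans (·-cong s (+-inverseʳ x)) (·-0 s)) ⟩
    0# - s · x                  ≈⟨ +-identityˡ _ ⟩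
    - (s · x)                   ∎
    where open ≈R

  ·-distribˡ-sub : ∀ s x y → s · (x - y) ≈ s · x - s · y
  ·-distribˡ-sub s x y = trans (·-distribˡ s x (- y)) (+-congˡ (·-negʳ s y))

  ≤-refl : ∀ {x} → x ≤ x
  ≤-refl = ≤-reflexive refl

  ≈⇒≥ : ∀ {x y} → x ≈ y → y ≤ x
  ≈⇒≥ x≈y = ≤-reflexive (sym x≈y)

  ≤-resp : ∀ {x y u v} → x ≈ u → y ≈ v → x ≤ y → u ≤ v
  ≤-resp x≈u y≈v x≤y = ≤-trans (≈⇒≥ x≈u) (≤-trans x≤y (≤-reflexive y≈v))

  ≰⇒≥ : ∀ {x y} → ¬ (x ≤ y) → y ≤ x
  ≰⇒≥ x≰y = <⇒≤ (≰⇒> x≰y)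

  ≤-<-trans : ∀ {x y z} → x ≤ y → y < z → x < z
  ≤-<-trans x≤y y<z = ≰⇒> λ z≤x → <⇒≱ y<z (≤-trans z≤x x≤y)

  <-≤-trans : ∀ {x y z} → x < y → y ≤ z → x < z
  <-≤-trans x<y y≤z = ≰⇒> λ z≤x → <⇒≱ x<y (≤-trans y≤z z≤x)

  <-irrefl : ∀ {x y} → x ≈ y → ¬ (x < y)
  <-irrefl x≈y x<y = <⇒≱ x<y (≈⇒≥ x≈y)

  ≤⇒<⊎≈ : ∀ {x y} → x ≤ y → x < y ⊎ x ≈ y
  ≤⇒<⊎≈ {x} {y} x≤y with y ≤? x
  ... | yes y≤x = inj₂ (≤-antisym x≤y y≤x)
  ... | no  y≰x = inj₁ (≰⇒> y≰x)

  <-cmp : ∀ x y → x < y ⊎ x ≈ y ⊎ y < x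
  <-cmp x y with y ≤? x
  ... | no  y≰x = inj₁ (≰⇒> y≰x)
  ... | yes y≤x with x ≤? y
  ...   | yes x≤y = inj₂ (inj₁ (≤-antisym x≤y y≤x))
  ...   | no  x≰y = inj₂ (inj₂ (≰⇒> x≰y))

  _≈?_ : ∀ x y → Dec (x ≈ y)
  x ≈? y with <-cmp x y
  ... | inj₁ x<y        = no λ x≈y → <-irrefl x≈y x<y
  ... | inj₂ (inj₁ x≈y) = yes x≈y
  ... | inj₂ (inj₂ y<x) = no λ x≈y → <-irrefl (sym x≈y) y<x

  -- Reduces an inequality to a known one with the same difference; what remains is an identity in
  -- abelian groups, which is left to the solver.
  ≤-by : ∀ {a b x y} → a ≤ b → y - x ≈ b - a → x ≤ y
  ≤-by {a} {b} {x} {y} a≤b eq = ≤-resp (+-identityˡ x) step (+-mono-≤ 0≤b-a ≤-refl)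
    where
    0≤b-a : 0# ≤ b - a
    0≤b-a = ≤-trans (≈⇒≥ (+-inverseʳ a)) (+-mono-≤ a≤b ≤-refl)
    step : b - a + x ≈ y
    step = trans (+-congʳ (sym eq)) (solve 2 (λ x y → y ⊕ ⊝ x ⊕ x ⊜ y) refl x y)

  <-by : ∀ {a b x y} → a < b → y - x ≈ b - a → x < y
  <-by {a} {b} {x} {y} a<b eq = ≰⇒> λ y≤x → <⇒≱ a<b (≤-by y≤x (begin
    a - b      ≈⟨ solve 2 (λ a b → a ⊕ ⊝ b ⊜ ⊝ (b ⊕ ⊝ a)) refl a b ⟩
    - (b - a)  ≈⟨ neg-cong eq ⟨
    - (y - x)  ≈⟨ solve 2 (λ x y → ⊝ (y ⊕ ⊝ x) ⊜ x ⊕ ⊝ y) refl x y ⟩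
    x - y      ∎))
    where open ≈R

  x≤y⇒0≤y-x : ∀ {x y} → x ≤ y → 0# ≤ y - x
  x≤y⇒0≤y-x {x} {y} x≤y = ≤-by x≤y (solve 2 (λ x y → y ⊕ ⊝ x ⊕ ⊝ nil ⊜ y ⊕ ⊝ x) refl x y)

  x<y⇒0<y-x : ∀ {x y} → x < y → 0# < y - x
  x<y⇒0<y-x {x} {y} x<y = <-by x<y (solve 2 (λ x y → y ⊕ ⊝ x ⊕ ⊝ nil ⊜ y ⊕ ⊝ x) refl x y)

  0≤y-x⇒x≤y : ∀ {x y} → 0# ≤ y - x → x ≤ y
  0≤y-x⇒x≤y {x} {y} 0≤d = ≤-by 0≤d (solve 2 (λ x y → y ⊕ ⊝ x ⊜ y ⊕ ⊝ x ⊕ ⊝ nil) refl x y)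

  neg-antimono-≤ : ∀ {x y} → x ≤ y → - y ≤ - x
  neg-antimono-≤ {x} {y} x≤y = ≤-by x≤y (solve 2 (λ x y → ⊝ x ⊕ ⊝ ⊝ y ⊜ y ⊕ ⊝ x) refl x y)

  0≤-x : ∀ {x} → x ≤ 0# → 0# ≤ - x
  0≤-x x≤0 = ≤-trans (≈⇒≥ neg-0) (neg-antimono-≤ x≤0)

  ≤-+ˡ : ∀ {x} y → 0# ≤ x → y ≤ x + y
  ≤-+ˡ {x} y 0≤x = ≤-by 0≤x (solve 2 (λ x y → x ⊕ y ⊕ ⊝ y ⊜ x ⊕ ⊝ nil) refl x y)

  ·-nonneg : ∀ n {d} → 0# ≤ d → 0# ≤ (+ n) · d
  ·-nonneg zero    {d} 0≤d = ≈⇒≥ (0· d)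
  ·-nonneg (suc n) {d} 0≤d = ≤-trans (≤-trans (·-nonneg n 0≤d) (≤-+ˡ _ 0≤d)) (≈⇒≥ (suc· n d))

  ·-pos : ∀ n {d} → 0# < d → 0# < (+ suc n) · d
  ·-pos n {d} 0<d = <-≤-trans 0<d (≤-trans (≤-trans (≤-+ˡ d (·-nonneg n (<⇒≤ 0<d))) (≤-reflexive (+-comm _ d))) (≈⇒≥ (suc· n d)))

  ·-cancel-nonneg : ∀ n {d} → 0# ≤ (+ suc n) · d → 0# ≤ d
  ·-cancel-nonneg n {d} 0≤nd with 0# ≤? d
  ... | yes 0≤d = 0≤d
  ... | no  0≰d = contradiction
    (≤-resp (sym (·-negʳ (+ suc n) d)) neg-0 (neg-antimono-≤ 0≤nd)) (<⇒≱ 0<-nd)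
    where
    0<-d : 0# < - d
    0<-d = <-by (≰⇒> 0≰d) (solve 1 (λ d → ⊝ d ⊕ ⊝ nil ⊜ nil ⊕ ⊝ d) refl d)
    0<-nd : 0# < (+ suc n) · (- d)
    0<-nd = ·-pos n 0<-d

  ·-difference : ∀ s t d → t · d - s · d ≈ (t ℤ.- s) · d
  ·-difference s t d = trans (+-congˡ (sym (·-neg s d))) (sym (·-distribʳ t (ℤ.- s) d))

  ·-mono-≤ : ∀ {s t d} → 0# ≤ d → s ℤ.≤ t → s · d ≤ t · d
  ·-mono-≤ {s} {t} {d} 0≤d s≤t with t ℤ.- s in eq | ℤ.i≤j⇒0≤j-i s≤t
  ... | + n | _ = 0≤y-x⇒x≤y (≤-resp refl
    (sym (trans (·-difference s t d) (reflexive (≡.cong (_· d) eq)))) (·-nonneg n 0≤d))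

  ·-mono-< : ∀ {s t d} → 0# < d → s ℤ.< t → s · d < t · d
  ·-mono-< {s} {t} {d} 0<d s<t = <-≤-trans
    (<-by 0<d (solve 2 (λ x d → d ⊕ x ⊕ ⊝ x ⊜ d ⊕ ⊝ nil) refl (s · d) d))
    (≤-trans (≤-reflexive (+-congʳ (sym (1· d))))
      (≤-trans (≈⇒≥ (·-distribʳ 1ℤ s d)) (·-mono-≤ (<⇒≤ 0<d) (ℤ.i<j⇒suc[i]≤j s<t))))

  ·-cancel-≤ : ∀ {s t d} → 0# < d → s · d ≤ t · d → s ℤ.≤ t
  ·-cancel-≤ {s} {t} 0<d le with s ℤ.≤? t
  ... | yes s≤t = s≤t
  ... | no  s≰t = contradiction le (<⇒≱ (·-mono-< 0<d (ℤ.≰⇒> s≰t)))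

  infixl 6 _⊔_
  _⊔_ : Carrier → Carrier → Carrier
  x ⊔ y with x ≤? y
  ... | yes _ = y
  ... | no  _ = x

  x≤y⇒x⊔y≈y : ∀ {x y} → x ≤ y → x ⊔ y ≈ y
  x≤y⇒x⊔y≈y {x} {y} x≤y with x ≤? y
  ... | yes _   = refl
  ... | no  x≰y = contradiction x≤y x≰y

  y≤x⇒x⊔y≈x : ∀ {x y} → y ≤ x → x ⊔ y ≈ x
  y≤x⇒x⊔y≈x {x} {y} y≤x with x ≤? y
  ... | yes x≤y = ≤-antisym y≤x x≤y
  ... | no  _   = refl

  x≤x⊔y : ∀ x y → x ≤ x ⊔ y
  x≤x⊔y x y with x ≤? y
  ... | yes x≤y = x≤y
  ... | no  _   = ≤-refl

  y≤x⊔y : ∀ x y → y ≤ x ⊔ y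
  y≤x⊔y x y with x ≤? y
  ... | yes _   = ≤-refl
  ... | no  x≰y = ≰⇒≥ x≰y

  ⊔-sel : ∀ x y → x ⊔ y ≈ x ⊎ x ⊔ y ≈ y
  ⊔-sel x y with x ≤? y
  ... | yes _ = inj₂ refl
  ... | no  _ = inj₁ refl

  ⊔-mono-≤ : ∀ {x y u v} → x ≤ u → y ≤ v → x ⊔ y ≤ u ⊔ v
  ⊔-mono-≤ {x} {y} {u} {v} x≤u y≤v with ⊔-sel x y
  ... | inj₁ eq = ≤-trans (≤-reflexive eq) (≤-trans x≤u (x≤x⊔y u v))
  ... | inj₂ eq = ≤-trans (≤-reflexive eq) (≤-trans y≤v (y≤x⊔y u v))

  ⊔-cong : ∀ {x y u v} → x ≈ u → y ≈ v → x ⊔ y ≈ u ⊔ v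
  ⊔-cong x≈u y≈v = ≤-antisym (⊔-mono-≤ (≤-reflexive x≈u) (≤-reflexive y≈v))
                             (⊔-mono-≤ (≈⇒≥ x≈u) (≈⇒≥ y≈v))

  ⊔-comm : ∀ x y → x ⊔ y ≈ y ⊔ x
  ⊔-comm x y with x ≤? y
  ... | yes x≤y = sym (y≤x⇒x⊔y≈x x≤y)
  ... | no  x≰y = sym (x≤y⇒x⊔y≈y (≰⇒≥ x≰y))

-- T is an interval, whose points are only determined up to equality of their positions.

module PiecewiseLinear
  (R : OrderedGroup) (T : Set) (pos : T → OrderedGroup.Carrier R)
  (between : ∀ a b r → OrderedGroup._≤_ R (pos a) r → OrderedGroup._≤_ R r (pos b) →
             ∃[ t ] OrderedGroup._≈_ R (pos t) r)
  where

  open OrderedGroupProperties R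
  open Solver using (solve; _⊕_; ⊝_; nil; _⊜_)

  -- Linear functions on an interval and comparison of slopes

  Congruent : (T → Carrier) → Set
  Congruent φ = ∀ {t u} → pos t ≈ pos u → φ t ≈ φ u

  -- Any two points are compared, in either order, instead of each with `a`: restriction to a
  -- subinterval is then immediate, and values can be computed from either end.
  Linear : (T → Carrier) → T → T → ℤ → Set
  Linear φ a b s = ∀ t u → pos a ≤ pos t → pos t ≤ pos b → pos a ≤ pos u → pos u ≤ pos b →
                   φ u ≈ φ t + s · (pos u - pos t)

  Linear-restrict : ∀ {φ a b c d s} → pos a ≤ pos c → pos d ≤ pos b → Linear φ a b s → Linear φ c d s
  Linear-restrict a≤c d≤b lin t u c≤t t≤d c≤u u≤d =
    lin t u (≤-trans a≤c c≤t) (≤-trans t≤d d≤b) (≤-trans a≤c c≤u) (≤-trans u≤d d≤b)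

  Linear-+ : ∀ {φ ψ a b r s} → Linear φ a b r → Linear ψ a b s →
             Linear (λ t → φ t + ψ t) a b (r ℤ.+ s)
  Linear-+ {φ} {ψ} {r = r} {s} linφ linψ t u p q p′ q′ = begin
    φ u + ψ u                                ≈⟨ +-cong (linφ t u p q p′ q′) (linψ t u p q p′ q′) ⟩
    (φ t + r · d) + (ψ t + s · d)            ≈⟨ Solver.interchange _ _ _ _ ⟩
    (φ t + ψ t) + (r · d + s · d)            ≈⟨ +-congˡ (·-distribʳ r s d) ⟨
    (φ t + ψ t) + (r ℤ.+ s) · d              ∎
    where
    open ≈R
    d = pos u - pos t

  Linear-neg : ∀ {φ a b s} → Linear φ a b s → Linear (λ t → - φ t) a b (ℤ.- s)
  Linear-neg {φ} {s = s} lin t u p q p′ q′ = begin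
    - φ u                  ≈⟨ neg-cong (lin t u p q p′ q′) ⟩
    - (φ t + s · d)        ≈⟨ solve 2 (λ x y → ⊝ (x ⊕ y) ⊜ ⊝ x ⊕ ⊝ y) refl _ _ ⟩
    - φ t - s · d          ≈⟨ +-congˡ (·-neg s d) ⟨
    - φ t + (ℤ.- s) · d    ∎
    where
    open ≈R
    d = pos u - pos t

  Linear-resp : ∀ {φ ψ a b s} → (∀ t → pos a ≤ pos t → pos t ≤ pos b → φ t ≈ ψ t) →
                Linear φ a b s → Linear ψ a b s
  Linear-resp eq lin t u p q p′ q′ =
    trans (sym (eq u p′ q′)) (trans (lin t u p q p′ q′) (+-congʳ (eq t p q)))

  Linear-const : ∀ {φ a b} c → (∀ t → pos a ≤ pos t → pos t ≤ pos b → φ t ≈ c) → Linear φ a b 0ℤ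
  Linear-const c eq t u p q p′ q′ =
    trans (eq u p′ q′) (trans (sym (+-identityʳ c)) (+-cong (sym (eq t p q)) (sym (0· _))))

  Linear-pos : ∀ {φ a b} c → (∀ t → pos a ≤ pos t → pos t ≤ pos b → φ t ≈ pos t - c) → Linear φ a b 1ℤ
  Linear-pos {φ} c eq t u p q p′ q′ = begin
    φ u                              ≈⟨ eq u p′ q′ ⟩
    pos u - c                        ≈⟨ solve 3 (λ u t c → u ⊕ ⊝ c ⊜ t ⊕ ⊝ c ⊕ (u ⊕ ⊝ t)) refl (pos u) (pos t) c ⟩
    pos t - c + (pos u - pos t)      ≈⟨ +-cong (eq t p q) (1· _) ⟨
    φ t + 1ℤ · (pos u - pos t)       ∎
    where open ≈R

  -- A linear function is smallest at an end that the sign of its slope singles out: values are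
  -- computed from `a` if the slope is non-negative and from `b` otherwise.
  Linear-nonneg : ∀ {φ a b s} → Linear φ a b s → pos a ≤ pos b → 0# ≤ φ a → 0# ≤ φ b →
                  ∀ t → pos a ≤ pos t → pos t ≤ pos b → 0# ≤ φ t
  Linear-nonneg {φ} {a} {b} {+ n} lin a≤b 0≤φa 0≤φb t a≤t t≤b =
    ≤-trans (≤-resp (+-identityˡ 0#) refl (+-mono-≤ 0≤φa (·-nonneg n (x≤y⇒0≤y-x a≤t))))
            (≈⇒≥ (lin a t ≤-refl a≤b a≤t t≤b))
  Linear-nonneg {φ} {a} {b} { s@(-[1+ n ]) } lin a≤b 0≤φa 0≤φb t a≤t t≤b =
    ≤-trans (≤-resp (+-identityˡ 0#) refl (+-mono-≤ 0≤φb (·-nonneg (suc n) (x≤y⇒0≤y-x t≤b))))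
            (≈⇒≥ (begin
      φ t                              ≈⟨ lin b t a≤b ≤-refl a≤t t≤b ⟩
      φ b + s · (pos t - pos b)        ≈⟨ +-congˡ (·-neg (+ suc n) _) ⟩
      φ b - (+ suc n) · (pos t - pos b) ≈⟨ +-congˡ (·-negʳ (+ suc n) _) ⟨
      φ b + (+ suc n) · (- (pos t - pos b)) ≈⟨ +-congˡ (·-cong (+ suc n) (solve 2 (λ t b → ⊝ (t ⊕ ⊝ b) ⊜ b ⊕ ⊝ t) refl (pos t) (pos b))) ⟩
      φ b + (+ suc n) · (pos b - pos t) ∎))
    where open ≈R

  -- If `φ a` is negative, the slope must be positive, and the zero lies at distance `− φ a` divided
  -- by the slope to the right of `a`. This is what divisibility of the group is for.
  Linear-zero : ∀ {φ a b s} → Linear φ a b s → pos a ≤ pos b → φ a ≤ 0# → 0# ≤ φ b →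
                ∃[ z ] (pos a ≤ pos z × pos z ≤ pos b × φ z ≈ 0#)
  Linear-zero {φ} {a} {b} {s} lin a≤b φa≤0 0≤φb with 0# ≤? φ a | s
  ... | yes 0≤φa | _ = a , ≤-refl , a≤b , ≤-antisym φa≤0 0≤φa
  ... | no  0≰φa | + zero = contradiction (≤-trans 0≤φb (≤-reflexive
    (trans (lin a b ≤-refl a≤b a≤b ≤-refl) (trans (+-congˡ (0· _)) (+-identityʳ _))))) 0≰φa
  ... | no  0≰φa | -[1+ n ] = contradiction (≤-trans 0≤φb (≤-by (·-nonneg (suc n) (x≤y⇒0≤y-x a≤b)) (begin
    φ a - φ b                              ≈⟨ +-congˡ (neg-cong (lin a b ≤-refl a≤b a≤b ≤-refl)) ⟩
    φ a - (φ a + -[1+ n ] · (pos b - pos a)) ≈⟨ +-congˡ (neg-cong (+-congˡ (·-neg (+ suc n) _))) ⟩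
    φ a - (φ a - (+ suc n) · (pos b - pos a)) ≈⟨ solve 2 (λ x y → x ⊕ ⊝ (x ⊕ ⊝ y) ⊜ y ⊕ ⊝ nil) refl (φ a) _ ⟩
    (+ suc n) · (pos b - pos a) - 0#       ∎))) 0≰φa
    where open ≈R
  ... | no  0≰φa | + suc n =
    let (y , ny≈-φa) = divisible n (- φ a)
        k = + suc n
        0≤y : 0# ≤ y
        0≤y = ·-cancel-nonneg n (≤-trans (0≤-x φa≤0) (≈⇒≥ ny≈-φa))
        gap : k · (pos b - (pos a + y)) ≈ φ b
        gap = begin
          k · (pos b - (pos a + y))       ≈⟨ ·-cong k (solve 3 (λ a b y → b ⊕ ⊝ (a ⊕ y) ⊜ b ⊕ ⊝ a ⊕ ⊝ y) refl (pos a) (pos b) y) ⟩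
          k · (pos b - pos a - y)         ≈⟨ ·-distribˡ-sub k _ y ⟩
          k · (pos b - pos a) - k · y     ≈⟨ +-congˡ (neg-cong ny≈-φa) ⟩
          k · (pos b - pos a) - (- φ a)   ≈⟨ solve 2 (λ x y → x ⊕ ⊝ ⊝ y ⊜ y ⊕ x) refl _ (φ a) ⟩
          φ a + k · (pos b - pos a)       ≈⟨ lin a b ≤-refl a≤b a≤b ≤-refl ⟨
          φ b                             ∎
        a≤a+y : pos a ≤ pos a + y
        a≤a+y = ≤-by 0≤y (solve 2 (λ a y → a ⊕ y ⊕ ⊝ a ⊜ y ⊕ ⊝ nil) refl (pos a) y)
        a+y≤b : pos a + y ≤ pos b
        a+y≤b = 0≤y-x⇒x≤y (·-cancel-nonneg n (≤-trans 0≤φb (≈⇒≥ gap)))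
        (z , z≈) = between a b (pos a + y) a≤a+y a+y≤b
        a≤z = ≤-trans a≤a+y (≈⇒≥ z≈)
        z≤b = ≤-trans (≤-reflexive z≈) a+y≤b
    in z , a≤z , z≤b , (begin
      φ z                             ≈⟨ lin a z ≤-refl a≤b a≤z z≤b ⟩
      φ a + k · (pos z - pos a)       ≈⟨ +-congˡ (·-cong k (+-congʳ z≈)) ⟩
      φ a + k · (pos a + y - pos a)   ≈⟨ +-congˡ (·-cong k (solve 2 (λ a y → a ⊕ y ⊕ ⊝ a ⊜ y) refl (pos a) y)) ⟩
      φ a + k · y                     ≈⟨ +-congˡ ny≈-φa ⟩
      φ a - φ a                       ≈⟨ +-inverseʳ _ ⟩
      0#                              ∎)
    where open ≈R

  slope-≤ : ∀ {r s d x y u v} → 0# < d → x ≈ y → u ≈ x + r · d → v ≈ y + s · d → u ≤ v → r ℤ.≤ s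
  slope-≤ {r} {s} {d} {x} {y} {u} {v} 0<d x≈y u≈ v≈ u≤v = ·-cancel-≤ 0<d (≤-by u≤v (begin
    s · d - r · d                    ≈⟨ solve 3 (λ x a b → b ⊕ ⊝ a ⊜ x ⊕ b ⊕ ⊝ (x ⊕ a)) refl x _ _ ⟩
    x + s · d - (x + r · d)          ≈⟨ +-cong (trans (+-congʳ x≈y) (sym v≈)) (neg-cong (sym u≈)) ⟩
    v - u                            ∎))
    where open ≈R

  -- Turns a slope along the interval into the slope outwards to the left, measured over the
  -- non-negative distance from `w` to `z`, so that `slope-≤` serves both directions.
  reverse-slope : ∀ {w z z″ χw χz} s → χw ≈ χz + (ℤ.- s) · (pos w - pos z″) → pos z ≈ pos z″ →
                  χw ≈ χz + s · (pos z - pos w)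
  reverse-slope {w} {z″ = z″} s eq z≈z″ = trans eq (+-congˡ (trans (·-neg s _)
    (trans (sym (·-negʳ s _)) (·-cong s (trans
      (solve 2 (λ w z → ⊝ (w ⊕ ⊝ z) ⊜ z ⊕ ⊝ w) refl (pos w) (pos z″)) (+-congʳ (sym z≈z″)))))))

  module _ {φ ψ : T → Carrier} (φ≤ψ : ∀ t → φ t ≤ ψ t) {z z′ : T} (z≈z′ : pos z ≈ pos z′) (φz≈ψz′ : φ z ≈ ψ z′) where

    -- Both functions are evaluated at the nearer of `u` and `v`, which lies in both segments: `φ`
    -- starts level with `ψ` and is still below it there. The base points `z` and `z′` are kept
    -- apart because the two segments may start at different representatives of one position.
    slope-≤-right : ∀ {u v r s} → pos z < pos u → pos z′ < pos v →
                    Linear φ z u r → Linear ψ z′ v s → r ℤ.≤ s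
    slope-≤-right {u} {v} {r} {s} z<u z′<v linφ linψ with pos u ≤? pos v
    ... | yes u≤v = slope-≤ (x<y⇒0<y-x z<u) φz≈ψz′ (linφ z u ≤-refl (<⇒≤ z<u) (<⇒≤ z<u) ≤-refl)
      (trans (linψ z′ u ≤-refl (<⇒≤ z′<v) (≤-trans (≈⇒≥ z≈z′) (<⇒≤ z<u)) u≤v)
             (+-congˡ (·-cong s (+-congˡ (neg-cong (sym z≈z′)))))) (φ≤ψ u)
    ... | no  u≰v = slope-≤ (x<y⇒0<y-x z<v) φz≈ψz′
      (linφ z v ≤-refl (<⇒≤ z<u) (<⇒≤ z<v) (≰⇒≥ u≰v))
      (trans (linψ z′ v ≤-refl (<⇒≤ z′<v) (<⇒≤ z′<v) ≤-refl)
             (+-congˡ (·-cong s (+-congˡ (neg-cong (sym z≈z′)))))) (φ≤ψ v)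
      where z<v = ≤-<-trans (≤-reflexive z≈z′) z′<v

    slope-≤-left : ∀ {u v r s} → pos u < pos z → pos v < pos z′ →
                   Linear φ u z (ℤ.- r) → Linear ψ v z′ (ℤ.- s) → r ℤ.≤ s
    slope-≤-left {u} {v} {r} {s} u<z v<z′ linφ linψ with pos v ≤? pos u
    ... | yes v≤u = slope-≤ (x<y⇒0<y-x u<z) φz≈ψz′
      (reverse-slope r (linφ z u (<⇒≤ u<z) ≤-refl ≤-refl (<⇒≤ u<z)) refl)
      (reverse-slope s (linψ z′ u (<⇒≤ v<z′) ≤-refl v≤u (≤-trans (<⇒≤ u<z) (≤-reflexive z≈z′))) z≈z′) (φ≤ψ u)
    ... | no  v≰u = slope-≤ (x<y⇒0<y-x v<z) φz≈ψz′
      (reverse-slope r (linφ z v (<⇒≤ u<z) ≤-refl (≰⇒≥ v≰u) (<⇒≤ v<z)) refl)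
      (reverse-slope s (linψ z′ v (<⇒≤ v<z′) ≤-refl ≤-refl (<⇒≤ v<z′)) z≈z′) (φ≤ψ v)
      where v<z = <-≤-trans v<z′ (≈⇒≥ z≈z′)

  slope-unique-right : ∀ {φ z z′ u v r s} → pos z ≈ pos z′ → φ z ≈ φ z′ → pos z < pos u → pos z′ < pos v →
                       Linear φ z u r → Linear φ z′ v s → r ≡ s
  slope-unique-right z≈ φ≈ z<u z<v p q = ℤ.≤-antisym
    (slope-≤-right (λ _ → ≤-refl) z≈ φ≈ z<u z<v p q)
    (slope-≤-right (λ _ → ≤-refl) (sym z≈) (sym φ≈) z<v z<u q p)

  slope-unique-left : ∀ {φ z z′ u v r s} → pos z ≈ pos z′ → φ z ≈ φ z′ → pos u < pos z → pos v < pos z′ →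
                      Linear φ u z (ℤ.- r) → Linear φ v z′ (ℤ.- s) → r ≡ s
  slope-unique-left z≈ φ≈ u<z v<z p q = ℤ.≤-antisym
    (slope-≤-left (λ _ → ≤-refl) z≈ φ≈ u<z v<z p q)
    (slope-≤-left (λ _ → ≤-refl) (sym z≈) (sym φ≈) v<z u<z q p)

  -- Subdivisions of [a, b] into pieces with the property P; a piece may be a single point.
  data Subdivision (P : T → T → Set) : T → T → Set where
    nil  : ∀ {a b} → pos a ≈ pos b → Subdivision P a b
    cons : ∀ {a b} m → pos a ≤ pos m → P a m → Subdivision P m b → Subdivision P a b

  Hereditary : (T → T → Set) → Set
  Hereditary P = ∀ {a b c d} → pos a ≤ pos c → pos d ≤ pos b → P a b → P c d

  subdivision-≤ : ∀ {P a b} → Subdivision P a b → pos a ≤ pos b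
  subdivision-≤ (nil a≈b)        = ≤-reflexive a≈b
  subdivision-≤ (cons m a≤m _ r) = ≤-trans a≤m (subdivision-≤ r)

  single : ∀ {P a b} → pos a ≤ pos b → P a b → Subdivision P a b
  single a≤b p = cons _ a≤b p (nil refl)

  append : ∀ {P a b c} → Hereditary P → Subdivision P a b → Subdivision P b c → Subdivision P a c
  append h (cons m a≤m p r) r′ = cons m a≤m p (append h r r′)
  append h (nil a≈b) (nil b≈c) = nil (trans a≈b b≈c)
  append h (nil a≈b) (cons m b≤m p r) =
    cons m (≤-trans (≤-reflexive a≈b) b≤m) (h (≈⇒≥ a≈b) ≤-refl p) r

  restrict : ∀ {P a b c d} → Hereditary P → Subdivision P a b →
             pos a ≤ pos c → pos c ≤ pos d → pos d ≤ pos b → Subdivision P c d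
  restrict h (nil a≈b) a≤c c≤d d≤b =
    nil (≤-antisym c≤d (≤-trans d≤b (≤-trans (≈⇒≥ a≈b) a≤c)))
  restrict {c = c} {d} h (cons m a≤m p r) a≤c c≤d d≤b with pos d ≤? pos m | pos c ≤? pos m
  ... | yes d≤m | _       = single c≤d (h a≤c d≤m p)
  ... | no  d≰m | yes c≤m = cons m c≤m (h a≤c ≤-refl p) (restrict h r ≤-refl (≰⇒≥ d≰m) d≤b)
  ... | no  d≰m | no  c≰m = restrict h r (≰⇒≥ c≰m) c≤d d≤b

  -- Sums and maxima of piecewise linear functions reduce through this to a single piece on which
  -- both functions are linear. The bounds handed to the argument locate the piece within [a, b];
  -- `common` needs them to cut the other subdivision to it.
  refine : ∀ {P Q a b} → Hereditary Q → Subdivision P a b →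
           (∀ {c d} → pos a ≤ pos c → pos c ≤ pos d → pos d ≤ pos b → P c d → Subdivision Q c d) →
           Subdivision Q a b
  refine h (nil a≈b)        f = nil a≈b
  refine h (cons m a≤m p r) f = append h (f ≤-refl a≤m (subdivision-≤ r) p)
    (refine h r (λ m≤c → f (≤-trans a≤m m≤c)))

  common : ∀ {P Q a b} → Hereditary P → Hereditary Q → Subdivision P a b → Subdivision Q a b →
           Subdivision (λ c d → P c d × Q c d) a b
  common hP hQ p q = refine (λ le ge (x , y) → hP le ge x , hQ le ge y) p λ a≤c c≤d d≤b x →
    refine (λ le ge (x , y) → hP le ge x , hQ le ge y) (restrict hQ q a≤c c≤d d≤b)
      λ c≤c′ c′≤d′ d′≤d y → single c′≤d′ (hP c≤c′ d′≤d x , y)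

  -- Piecewise linear functions, their sums and maxima

  Sloped : (T → Carrier) → T → T → Set
  Sloped φ a b = ∃[ s ] Linear φ a b s

  Sloped-hereditary : ∀ {φ} → Hereditary (Sloped φ)
  Sloped-hereditary le ge (s , lin) = s , Linear-restrict le ge lin

  PL : (T → Carrier) → T → T → Set
  PL φ = Subdivision (Sloped φ)

  BothSloped : (φ ψ : T → Carrier) → T → T → Set
  BothSloped φ ψ a b = Sloped φ a b × Sloped ψ a b

  BothSloped-hereditary : ∀ {φ ψ} → Hereditary (BothSloped φ ψ)
  BothSloped-hereditary le ge (p , q) = Sloped-hereditary le ge p , Sloped-hereditary le ge q

  PL-both : ∀ {φ ψ a b} → PL φ a b → PL ψ a b → Subdivision (BothSloped φ ψ) a b
  PL-both = common Sloped-hereditary Sloped-hereditary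

  PL-+ : ∀ {φ ψ a b} → PL φ a b → PL ψ a b → PL (λ t → φ t + ψ t) a b
  PL-+ p q = refine Sloped-hereditary (PL-both p q) λ { _ c≤d _ ((r , lin) , (s , lin′)) →
    single c≤d (r ℤ.+ s , Linear-+ lin lin′) }

  Linear-sub : ∀ {φ ψ a b r s} → Linear φ a b r → Linear ψ a b s → Linear (λ t → ψ t - φ t) a b (s ℤ.- r)
  Linear-sub p q = Linear-+ q (Linear-neg p)

  -- The difference `ψ − φ` is linear and non-negative at both ends, hence on the whole segment,
  -- where the maximum is therefore `ψ`.
  ⊔-linear : ∀ {φ ψ a b r s} → Linear φ a b r → Linear ψ a b s → pos a ≤ pos b →
             φ a ≤ ψ a → φ b ≤ ψ b → Linear (λ t → φ t ⊔ ψ t) a b s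
  ⊔-linear {φ} {ψ} linφ linψ a≤b φa≤ψa φb≤ψb = Linear-resp (λ t a≤t t≤b → sym (x≤y⇒x⊔y≈y (0≤y-x⇒x≤y
    (Linear-nonneg (Linear-sub {φ} {ψ} linφ linψ) a≤b (x≤y⇒0≤y-x φa≤ψa) (x≤y⇒0≤y-x φb≤ψb) t a≤t t≤b)))) linψ

  -- One cut suffices, at a zero of the linear function `φ − ψ`: the maximum is `ψ` before it and
  -- `φ` after it.
  ⊔-crossing : ∀ {φ ψ a b} → pos a ≤ pos b → BothSloped φ ψ a b → φ a ≤ ψ a → ψ b ≤ φ b →
               PL (λ t → φ t ⊔ ψ t) a b
  ⊔-crossing {φ} {ψ} a≤b ((r , linφ) , (s , linψ)) φa≤ψa ψb≤φb =
    let (z , a≤z , z≤b , z≈0) = Linear-zero (Linear-sub {ψ} {φ} linψ linφ) a≤b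
          (≤-resp refl (+-inverseʳ _) (+-mono-≤ φa≤ψa ≤-refl)) (x≤y⇒0≤y-x ψb≤φb)
        φz≈ψz = begin
          φ z               ≈⟨ solve 2 (λ x y → x ⊜ x ⊕ ⊝ y ⊕ y) refl (φ z) (ψ z) ⟩
          φ z - ψ z + ψ z   ≈⟨ +-congʳ z≈0 ⟩
          0# + ψ z          ≈⟨ +-identityˡ _ ⟩
          ψ z               ∎
    in cons z a≤z (s , ⊔-linear {φ} {ψ} (Linear-restrict ≤-refl z≤b linφ) (Linear-restrict ≤-refl z≤b linψ)
                         a≤z φa≤ψa (≤-reflexive φz≈ψz))
      (single z≤b (r , Linear-resp (λ t _ _ → ⊔-comm (ψ t) (φ t))
        (⊔-linear {ψ} {φ} (Linear-restrict a≤z ≤-refl linψ) (Linear-restrict a≤z ≤-refl linφ)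
                  z≤b (≈⇒≥ φz≈ψz) ψb≤φb)))
    where open ≈R

  PL-comm-⊔ : ∀ {φ ψ : T → Carrier} {a b} → PL (λ t → ψ t ⊔ φ t) a b → PL (λ t → φ t ⊔ ψ t) a b
  PL-comm-⊔ {φ} {ψ} p = refine Sloped-hereditary p λ { _ c≤d _ (s , lin) →
    single c≤d (s , Linear-resp (λ t _ _ → ⊔-comm (ψ t) (φ t)) lin) }

  Sloped-⊔ : ∀ {φ ψ a b} → pos a ≤ pos b → BothSloped φ ψ a b → PL (λ t → φ t ⊔ ψ t) a b
  Sloped-⊔ {φ} {ψ} {a} {b} a≤b p@((r , linφ) , (s , linψ)) with φ a ≤? ψ a | φ b ≤? ψ b
  ... | yes a≤ | yes b≤ = single a≤b (s , ⊔-linear {φ} {ψ} linφ linψ a≤b a≤ b≤)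
  ... | yes a≤ | no  b≰ = ⊔-crossing {φ} {ψ} a≤b p a≤ (≰⇒≥ b≰)
  ... | no  a≰ | yes b≤ = PL-comm-⊔ {φ} {ψ} (⊔-crossing {ψ} {φ} a≤b (proj₂ p , proj₁ p) (≰⇒≥ a≰) b≤)
  ... | no  a≰ | no  b≰ = PL-comm-⊔ {φ} {ψ} (single a≤b (r , ⊔-linear {ψ} {φ} linψ linφ a≤b (≰⇒≥ a≰) (≰⇒≥ b≰)))

  PL-⊔ : ∀ {φ ψ a b} → PL φ a b → PL ψ a b → PL (λ t → φ t ⊔ ψ t) a b
  PL-⊔ {φ} {ψ} p q = refine Sloped-hereditary (PL-both p q) λ _ c≤d _ → Sloped-⊔ {φ} {ψ} c≤d

  slope-right : ∀ {φ a b z} → PL φ a b → pos a ≤ pos z → pos z < pos b →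
                ∃[ u ] ∃[ s ] (pos z < pos u × Linear φ z u s)
  slope-right (nil a≈b) a≤z z<b = contradiction (≤-trans (≈⇒≥ a≈b) a≤z) (<⇒≱ z<b)
  slope-right {z = z} (cons m a≤m (s , lin) r) a≤z z<b with pos m ≤? pos z
  ... | yes m≤z = slope-right r m≤z z<b
  ... | no  m≰z = m , s , ≰⇒> m≰z , Linear-restrict a≤z ≤-refl lin

  slope-left : ∀ {φ a b z} → PL φ a b → pos a < pos z → pos z ≤ pos b →
               ∃[ u ] ∃[ s ] (pos u < pos z × Linear φ u z (ℤ.- s))
  slope-left (nil a≈b) a<z z≤b = contradiction (≤-trans z≤b (≈⇒≥ a≈b)) (<⇒≱ a<z)
  slope-left {φ} {a} {z = z} (cons m a≤m (s , lin) r) a<z z≤b with pos z ≤? pos m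
  ... | yes z≤m = a , ℤ.- s , a<z ,
    ≡.subst (Linear φ a z) (≡.sym (ℤ.neg-involutive s)) (Linear-restrict ≤-refl z≤m lin)
  ... | no  z≰m = slope-left r (≰⇒> z≰m) z≤b

  -- Functions of equal slope differ by a constant, so agreement at one point spreads over the whole
  -- piece.
  Linear-difference : ∀ {φ ψ a b s} → Linear φ a b s → Linear ψ a b s →
                      ∀ t u → pos a ≤ pos t → pos t ≤ pos b → pos a ≤ pos u → pos u ≤ pos b →
                      φ t ≈ ψ t → φ u ≈ ψ u
  Linear-difference linφ linψ t u p q p′ q′ eq =
    trans (linφ t u p q p′ q′) (trans (+-congʳ eq) (sym (linψ t u p q p′ q′)))

  module _ {φ ψ : T → Carrier} (φ-cong : Congruent φ) (ψ-cong : Congruent ψ) where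

    -- The endpoint of the maximal interval to the left (right) of x on which φ and ψ agree.
    BranchLeft : T → T → Set
    BranchLeft a x = ∃[ c ] (pos a ≤ pos c × pos c ≤ pos x × φ c ≈ ψ c ×
      (pos a ≈ pos c ⊎
       ∃[ u ] ∃[ r ] ∃[ s ] (pos u < pos c × Linear φ u c r × Linear ψ u c s × r ≢ s)))

    BranchRight : T → T → Set
    BranchRight x b = ∃[ c ] (pos x ≤ pos c × pos c ≤ pos b × φ c ≈ ψ c ×
      (pos c ≈ pos b ⊎
       ∃[ u ] ∃[ r ] ∃[ s ] (pos c < pos u × Linear φ c u r × Linear ψ c u s × r ≢ s)))

    BranchLeft-mono : ∀ {a x y} → pos x ≤ pos y → BranchLeft a x → BranchLeft a y
    BranchLeft-mono x≤y (c , a≤c , c≤x , rest) = c , a≤c , ≤-trans c≤x x≤y , rest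

    BranchRight-mono : ∀ {x y b} → pos y ≤ pos x → BranchRight x b → BranchRight y b
    BranchRight-mono y≤x (c , x≤c , rest) = c , ≤-trans y≤x x≤c , rest

    private
      -- The search runs leftwards from `x`, but a subdivision is read from its left end. So the
      -- answer for everything left of `m` is carried along as a function, to be called only if the
      -- agreement turns out to reach back to `m`.
      extendLeft : ∀ {a m x} → pos a ≤ pos m → (φ m ≈ ψ m → BranchLeft a m) →
                   Subdivision (BothSloped φ ψ) m x → φ x ≈ ψ x → BranchLeft a x
      extendLeft a≤m left (nil m≈x) eq = BranchLeft-mono (≤-reflexive m≈x)
        (left (trans (φ-cong m≈x) (trans eq (ψ-cong (sym m≈x)))))
      extendLeft {a} {m} a≤m left (cons n m≤n ((r , linφ) , (s , linψ)) rest) =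
        extendLeft (≤-trans a≤m m≤n) left′ rest
        where
        left′ : φ n ≈ ψ n → BranchLeft a n
        left′ eq with ≤⇒<⊎≈ m≤n | r ℤ.≟ s
        -- On a one-point piece the slopes are arbitrary and say nothing about where the functions
        -- separate, so the piece is skipped.
        ... | inj₂ m≈n | _ = BranchLeft-mono (≤-reflexive m≈n)
          (left (trans (φ-cong m≈n) (trans eq (ψ-cong (sym m≈n)))))
        ... | inj₁ m<n | yes ≡.refl = BranchLeft-mono m≤n
          (left (Linear-difference linφ linψ n m m≤n ≤-refl ≤-refl m≤n eq))
        ... | inj₁ m<n | no  r≢s =
          n , ≤-trans a≤m m≤n , ≤-refl , eq , inj₂ (m , r , s , m<n , linφ , linψ , r≢s)

    branchLeft : ∀ {a x} → Subdivision (BothSloped φ ψ) a x → φ x ≈ ψ x → BranchLeft a x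
    branchLeft = extendLeft ≤-refl λ eq → _ , ≤-refl , ≤-refl , eq , inj₁ refl

    branchRight : ∀ {x b} → Subdivision (BothSloped φ ψ) x b → φ x ≈ ψ x → BranchRight x b
    branchRight (nil x≈b) eq = _ , ≤-refl , ≤-reflexive x≈b , eq , inj₁ x≈b
    branchRight (cons m x≤m ((r , linφ) , (s , linψ)) rest) eq with ≤⇒<⊎≈ x≤m | r ℤ.≟ s
    ... | inj₂ x≈m | _ = BranchRight-mono x≤m
      (branchRight rest (trans (φ-cong (sym x≈m)) (trans eq (ψ-cong x≈m))))
    ... | inj₁ x<m | yes ≡.refl = BranchRight-mono x≤m
      (branchRight rest (Linear-difference linφ linψ _ m ≤-refl x≤m x≤m ≤-refl eq))
    ... | inj₁ x<m | no  r≢s =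
      _ , ≤-refl , ≤-trans x≤m (subdivision-≤ rest) , eq , inj₂ (m , r , s , x<m , linφ , linψ , r≢s)

  -- The divisor of a piecewise linear function

  chip : T → T → ℤ → ℤ
  chip t z s with pos t ≈? pos z
  ... | yes _ = s
  ... | no  _ = 0ℤ

  chip-here : ∀ {t z s} → pos t ≈ pos z → chip t z s ≡ s
  chip-here {t} {z} t≈z with pos t ≈? pos z
  ... | yes _   = ≡.refl
  ... | no  t≉z = contradiction t≈z t≉z

  chip-there : ∀ {t z s} → ¬ (pos t ≈ pos z) → chip t z s ≡ 0ℤ
  chip-there {t} {z} t≉z with pos t ≈? pos z
  ... | yes t≈z = contradiction t≈z t≉z
  ... | no  _   = ≡.refl

  -- The divisor of a piecewise linear function on [a, b], slopes outside [a, b] being taken to be 0: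
  -- a piece of slope s contributes s chips at its left end and − s at its right end.
  divisor : ∀ {φ a b} → PL φ a b → T → ℤ
  divisor (nil _) z = 0ℤ
  divisor (cons {a} m _ (s , _) r) z = chip a z s ℤ.+ (chip m z (ℤ.- s) ℤ.+ divisor r z)

  PL-resp : ∀ {φ ψ : T → Carrier} {a b} → (∀ t → φ t ≈ ψ t) → PL φ a b → PL ψ a b
  PL-resp eq (nil a≈b)                = nil a≈b
  PL-resp eq (cons m a≤m (s , lin) r) = cons m a≤m (s , Linear-resp (λ t _ _ → eq t) lin) (PL-resp eq r)

  divisor-resp : ∀ {φ ψ : T → Carrier} {a b} (eq : ∀ t → φ t ≈ ψ t) (p : PL φ a b) z → divisor (PL-resp eq p) z ≡ divisor p z
  divisor-resp eq (nil _) z = ≡.refl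
  divisor-resp eq (cons {a} m _ (s , _) r) z =
    ≡.cong (λ i → chip a z s ℤ.+ (chip m z (ℤ.- s) ℤ.+ i)) (divisor-resp eq r z)

  cons-there : ∀ {a m z s d} → ¬ (pos a ≈ pos z) → ¬ (pos m ≈ pos z) →
               chip a z s ℤ.+ (chip m z (ℤ.- s) ℤ.+ d) ≡ d
  cons-there {a} {m} {z} {s} {d} a≉z m≉z =
    ≡.trans (≡.cong₂ (λ i j → i ℤ.+ (j ℤ.+ d)) (chip-there {a} a≉z) (chip-there {m} m≉z))
      (≡.trans (ℤ.+-identityˡ _) (ℤ.+-identityˡ d))

  divisor-before : ∀ {φ a b z} (p : PL φ a b) → pos z < pos a → divisor p z ≡ 0ℤ
  divisor-before (nil _) z<a = ≡.refl
  divisor-before {a = a} (cons m a≤m _ r) z<a =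
    ≡.trans (cons-there {a} {m} (λ a≈z → <-irrefl (sym a≈z) z<a) (λ m≈z → <-irrefl (sym m≈z) z<m))
      (divisor-before r z<m)
    where z<m = <-≤-trans z<a a≤m

  -- The first case matches the default value of `slope`: at the right end of an edge no segment of
  -- it leaves forwards, and the slope counts as 0.
  RightSlope : (T → Carrier) → T → T → ℤ → Set
  RightSlope φ z b s = (pos z ≈ pos b × s ≡ 0ℤ) ⊎
    ∃[ u ] (pos z < pos u × pos u ≤ pos b × Linear φ z u s)

  module _ {φ : T → Carrier} (φ-cong : Congruent φ) where

    right-slope-unique : ∀ {z b u r s} → RightSlope φ z b s → pos z < pos u → pos u ≤ pos b →
                         Linear φ z u r → s ≡ r
    right-slope-unique (inj₁ (z≈b , _)) z<u u≤b lin = contradiction (<-≤-trans z<u u≤b) (<-irrefl z≈b)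
    right-slope-unique (inj₂ (v , z<v , _ , lin′)) z<u u≤b lin =
      slope-unique-right refl refl z<v z<u lin′ lin

    divisor-start : ∀ {a b z s} (p : PL φ a b) → pos z ≈ pos a → RightSlope φ z b s → divisor p z ≡ s
    divisor-start (nil _) z≈a (inj₁ (_ , s≡0)) = ≡.sym s≡0
    divisor-start (nil a≈b) z≈a (inj₂ (u , z<u , u≤b , _)) =
      contradiction (<-≤-trans z<u u≤b) (<-irrefl (trans z≈a a≈b))
    divisor-start {a} {b} {z} {s} (cons m a≤m (s′ , lin) r) z≈a right with ≤⇒<⊎≈ a≤m
    -- The two chips of a one-point piece lie on the same point and cancel.
    ... | inj₂ a≈m = ≡.trans (≡.cong₂ (λ i j → i ℤ.+ (j ℤ.+ divisor r z))
        (chip-here {a} (sym z≈a)) (chip-here {m} (sym (trans z≈a a≈m))))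
      (≡.trans (≡.sym (ℤ.+-assoc s′ (ℤ.- s′) _))
        (≡.trans (≡.cong (λ i → i ℤ.+ divisor r z) (ℤ.+-inverseʳ s′))
          (≡.trans (ℤ.+-identityˡ _) (divisor-start r (trans z≈a a≈m) right))))
    ... | inj₁ a<m = ≡.trans (≡.cong₂ ℤ._+_ (chip-here {a} (sym z≈a))
        (≡.cong₂ ℤ._+_ (chip-there {m} (λ m≈z → <-irrefl (sym m≈z) z<m)) (divisor-before r z<m)))
      (≡.trans (ℤ.+-identityʳ s′) (≡.sym
        (right-slope-unique right z<m (subdivision-≤ r) (Linear-restrict (≈⇒≥ z≈a) ≤-refl lin))))
      where z<m = ≤-<-trans (≤-reflexive z≈a) a<m

    -- Strictly inside a piece the two outgoing slopes are opposite and there is no chip. At a break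
    -- point the piece on the left leaves minus its slope, which is the outgoing slope `r`, and the
    -- rest of the subdivision starts there and adds `s`.
    divisor-inside : ∀ {a b z u r s} (p : PL φ a b) → pos a < pos z → pos z ≤ pos b →
                     RightSlope φ z b s → pos u < pos z → Linear φ u z (ℤ.- r) →
                     divisor p z ≡ s ℤ.+ r
    divisor-inside (nil a≈b) a<z z≤b _ _ _ = contradiction (<-≤-trans a<z z≤b) (<-irrefl a≈b)
    divisor-inside {a} {b} {z} {u} {r} {s} (cons m a≤m (s′ , lin) rest) a<z z≤b right u<z left
      with <-cmp (pos z) (pos m)
    ... | inj₁ z<m = begin
        chip a z s′ ℤ.+ (chip m z (ℤ.- s′) ℤ.+ divisor rest z)
          ≡⟨ cons-there {a} {m} (λ a≈z → <-irrefl a≈z a<z) (λ m≈z → <-irrefl (sym m≈z) z<m) ⟩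
        divisor rest z   ≡⟨ divisor-before rest z<m ⟩
        0ℤ               ≡⟨ ℤ.+-inverseʳ s′ ⟨
        s′ ℤ.+ ℤ.- s′    ≡⟨ ≡.cong₂ ℤ._+_
          (right-slope-unique right z<m (subdivision-≤ rest) (Linear-restrict (<⇒≤ a<z) ≤-refl lin))
          (slope-unique-left refl refl u<z a<z left (≡.subst (Linear φ a z) (≡.sym (ℤ.neg-involutive s′))
            (Linear-restrict ≤-refl (<⇒≤ z<m) lin))) ⟨
        s ℤ.+ r          ∎
      where open ≡.≡-Reasoning
    ... | inj₂ (inj₂ m<z) = ≡.trans
        (cons-there {a} {m} (λ a≈z → <-irrefl a≈z a<z) (λ m≈z → <-irrefl m≈z m<z))
        (divisor-inside rest m<z z≤b right u<z left)
    ... | inj₂ (inj₁ z≈m) = begin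
        chip a z s′ ℤ.+ (chip m z (ℤ.- s′) ℤ.+ divisor rest z)
          ≡⟨ ≡.cong₂ ℤ._+_ (chip-there {a} (λ a≈z → <-irrefl a≈z a<z))
               (≡.cong₂ ℤ._+_ (chip-here {m} (sym z≈m)) (divisor-start rest z≈m right)) ⟩
        0ℤ ℤ.+ (ℤ.- s′ ℤ.+ s)   ≡⟨ ℤ.+-identityˡ _ ⟩
        ℤ.- s′ ℤ.+ s            ≡⟨ ℤ.+-comm (ℤ.- s′) s ⟩
        s ℤ.+ ℤ.- s′            ≡⟨ ≡.cong (λ i → s ℤ.+ i)
          (slope-unique-left refl refl u<z a<z left (≡.subst (Linear φ a z) (≡.sym (ℤ.neg-involutive s′))
            (Linear-restrict ≤-refl (≤-reflexive z≈m) lin))) ⟨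
        s ℤ.+ r                 ∎
      where open ≡.≡-Reasoning

  -- Ramps and tents

  module Ramp {p q : Carrier} (p≤q : p ≤ q) where

    ramp : T → Carrier
    ramp t with pos t ≤? p | pos t ≤? q
    ... | yes _ | _     = 0#
    ... | no  _ | yes _ = pos t - p
    ... | no  _ | no  _ = q - p

    ramp-low : ∀ t → pos t ≤ p → ramp t ≈ 0#
    ramp-low t t≤p with pos t ≤? p | pos t ≤? q
    ... | yes _   | _ = refl
    ... | no  t≰p | _ = contradiction t≤p t≰p

    ramp-middle : ∀ t → p ≤ pos t → pos t ≤ q → ramp t ≈ pos t - p
    ramp-middle t p≤t t≤q with pos t ≤? p | pos t ≤? q
    ... | yes t≤p | _       = sym (trans (+-congʳ (≤-antisym t≤p p≤t)) (+-inverseʳ p))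
    ... | no  _   | yes _   = refl
    ... | no  _   | no  t≰q = contradiction t≤q t≰q

    ramp-high : ∀ t → q ≤ pos t → ramp t ≈ q - p
    ramp-high t q≤t with pos t ≤? p | pos t ≤? q
    ... | yes t≤p | _       = sym (trans (+-congʳ (≤-antisym (≤-trans q≤t t≤p) p≤q)) (+-inverseʳ p))
    ... | no  _   | yes t≤q = +-congʳ (≤-antisym t≤q q≤t)
    ... | no  _   | no  _   = refl

    ramp-cong : Congruent ramp
    ramp-cong {t} {u} t≈u = go (pos t ≤? p) (q ≤? pos t)
      where
      go : Dec (pos t ≤ p) → Dec (q ≤ pos t) → ramp t ≈ ramp u
      go (yes t≤p) _         = trans (ramp-low t t≤p) (sym (ramp-low u (≤-trans (≈⇒≥ t≈u) t≤p)))
      go (no  _)   (yes q≤t) = trans (ramp-high t q≤t) (sym (ramp-high u (≤-trans q≤t (≤-reflexive t≈u))))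
      go (no  t≰p) (no  q≰t) = trans (ramp-middle t (≰⇒≥ t≰p) (≰⇒≥ q≰t)) (trans (+-congʳ t≈u)
        (sym (ramp-middle u (≤-trans (≰⇒≥ t≰p) (≤-reflexive t≈u)) (≤-trans (≈⇒≥ t≈u) (≰⇒≥ q≰t)))))

    ramp-linear-low : ∀ {a b} → pos b ≤ p → Linear ramp a b 0ℤ
    ramp-linear-low b≤p = Linear-const 0# λ t _ t≤b → ramp-low t (≤-trans t≤b b≤p)

    ramp-linear-middle : ∀ {a b} → p ≤ pos a → pos b ≤ q → Linear ramp a b 1ℤ
    ramp-linear-middle p≤a b≤q =
      Linear-pos p λ t a≤t t≤b → ramp-middle t (≤-trans p≤a a≤t) (≤-trans t≤b b≤q)

    ramp-linear-high : ∀ {a b} → q ≤ pos a → Linear ramp a b 0ℤ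
    ramp-linear-high q≤a = Linear-const (q - p) λ t a≤t _ → ramp-high t (≤-trans q≤a a≤t)

  open Ramp

  -- The function with slope -1 on [a, p], slope 1 on [q, b] and slope 0 elsewhere.
  module Tent {lo a p q b hi : T} (lo≤a : pos lo ≤ pos a) (a≤p : pos a ≤ pos p)
    (p≤q : pos p ≤ pos q) (q≤b : pos q ≤ pos b) (b≤hi : pos b ≤ pos hi)
    (p-a≈b-q : pos p - pos a ≈ pos b - pos q) where

    tent : T → Carrier
    tent t = ramp q≤b t - ramp a≤p t

    tent-cong : Congruent tent
    tent-cong t≈u = +-cong (ramp-cong q≤b t≈u) (neg-cong (ramp-cong a≤p t≈u))

    tent-start : ∀ t → pos t ≈ pos lo → tent t ≈ 0#
    tent-start t t≈lo = trans (+-cong (ramp-low q≤b t (≤-trans t≤a (≤-trans a≤p p≤q)))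
      (neg-cong (ramp-low a≤p t t≤a))) (+-inverseʳ 0#)
      where t≤a = ≤-trans (≤-reflexive t≈lo) lo≤a

    -- By `p-a≈b-q` the descent and the ascent have the same height. As the tent also starts at 0,
    -- it can be continued by 0 beyond the edge.
    tent-end : ∀ t → pos t ≈ pos hi → tent t ≈ 0#
    tent-end t t≈hi = trans (+-cong (ramp-high q≤b t b≤t)
      (neg-cong (trans (ramp-high a≤p t (≤-trans p≤q (≤-trans q≤b b≤t))) p-a≈b-q))) (+-inverseʳ _)
      where b≤t = ≤-trans b≤hi (≈⇒≥ t≈hi)

    tent-PL : PL tent lo hi
    tent-PL =
      cons a lo≤a (0ℤ , Linear-sub {ramp a≤p} {ramp q≤b} (ramp-linear-low a≤p ≤-refl)
                          (ramp-linear-low q≤b (≤-trans a≤p p≤q))) (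
      cons p a≤p (-1ℤ , Linear-sub {ramp a≤p} {ramp q≤b} (ramp-linear-middle a≤p ≤-refl ≤-refl)
                          (ramp-linear-low q≤b p≤q)) (
      cons q p≤q (0ℤ , Linear-sub {ramp a≤p} {ramp q≤b} (ramp-linear-high a≤p ≤-refl)
                          (ramp-linear-low q≤b ≤-refl)) (
      cons b q≤b (1ℤ , Linear-sub {ramp a≤p} {ramp q≤b} (ramp-linear-high a≤p p≤q)
                          (ramp-linear-middle q≤b ≤-refl ≤-refl)) (
      single b≤hi (0ℤ , Linear-sub {ramp a≤p} {ramp q≤b} (ramp-linear-high a≤p (≤-trans p≤q q≤b))
                          (ramp-linear-high q≤b ≤-refl))))))

    chip-0 : ∀ t z → chip t z 0ℤ ≡ 0ℤ
    chip-0 t z with pos t ≈? pos z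
    ... | yes _ = ≡.refl
    ... | no  _ = ≡.refl

    divisor-tent : ∀ z → divisor tent-PL z ≡
      chip a z -1ℤ ℤ.+ (chip p z 1ℤ ℤ.+ (chip q z 1ℤ ℤ.+ chip b z -1ℤ))
    divisor-tent z
      rewrite chip-0 lo z | chip-0 a z | chip-0 p z | chip-0 q z | chip-0 b z | chip-0 hi z
            | ℤ.+-identityʳ (chip b z -1ℤ)
            | ℤ.+-identityˡ (chip q z 1ℤ ℤ.+ chip b z -1ℤ)
            | ℤ.+-identityˡ (chip q z 1ℤ ℤ.+ chip b z -1ℤ)
            | ℤ.+-identityˡ (chip a z -1ℤ ℤ.+ (chip p z 1ℤ ℤ.+ (chip q z 1ℤ ℤ.+ chip b z -1ℤ)))
            | ℤ.+-identityˡ (chip a z -1ℤ ℤ.+ (chip p z 1ℤ ℤ.+ (chip q z 1ℤ ℤ.+ chip b z -1ℤ)))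
      = ≡.refl

  -- Both points move inwards by the smaller of the distances from `x` to `a` and to `b`: the one
  -- from the nearer end arrives at `x`, and the other has not passed it.
  tent-points : ∀ {a x b} → pos a ≤ pos x → pos x ≤ pos b →
    ∃[ p ] ∃[ q ] (pos a ≤ pos p × pos p ≤ pos q × pos q ≤ pos b ×
      pos p - pos a ≈ pos b - pos q × (pos p ≈ pos x ⊎ pos q ≈ pos x))
  tent-points {a} {x} {b} a≤x x≤b with (pos x - pos a) ≤? (pos b - pos x)
  ... | yes le =
    let r   = pos b - (pos x - pos a)
        x≤r : pos x ≤ r
        x≤r = ≤-by le (solve 3 (λ a x b → b ⊕ ⊝ (x ⊕ ⊝ a) ⊕ ⊝ x ⊜ b ⊕ ⊝ x ⊕ ⊝ (x ⊕ ⊝ a)) refl (pos a) (pos x) (pos b))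
        r≤b : r ≤ pos b
        r≤b = ≤-by a≤x (solve 3 (λ a x b → b ⊕ ⊝ (b ⊕ ⊝ (x ⊕ ⊝ a)) ⊜ x ⊕ ⊝ a) refl (pos a) (pos x) (pos b))
        (q , q≈r) = between x b r x≤r r≤b
    in x , q , a≤x , ≤-trans x≤r (≈⇒≥ q≈r) , ≤-trans (≤-reflexive q≈r) r≤b ,
       trans (solve 3 (λ a x b → x ⊕ ⊝ a ⊜ b ⊕ ⊝ (b ⊕ ⊝ (x ⊕ ⊝ a))) refl (pos a) (pos x) (pos b))
             (+-congˡ (neg-cong (sym q≈r))) ,
       inj₁ refl
  ... | no  ≰ =
    let r   = pos a + (pos b - pos x)
        a≤r : pos a ≤ r
        a≤r = ≤-by x≤b (solve 3 (λ a x b → a ⊕ (b ⊕ ⊝ x) ⊕ ⊝ a ⊜ b ⊕ ⊝ x) refl (pos a) (pos x) (pos b))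
        r≤x : r ≤ pos x
        r≤x = ≤-by (≰⇒≥ ≰) (solve 3 (λ a x b → x ⊕ ⊝ (a ⊕ (b ⊕ ⊝ x)) ⊜ x ⊕ ⊝ a ⊕ ⊝ (b ⊕ ⊝ x)) refl (pos a) (pos x) (pos b))
        (p , p≈r) = between a x r a≤r r≤x
    in p , x , ≤-trans a≤r (≈⇒≥ p≈r) , ≤-trans (≤-reflexive p≈r) r≤x , x≤b ,
       trans (+-congʳ p≈r) (solve 3 (λ a x b → a ⊕ (b ⊕ ⊝ x) ⊕ ⊝ a ⊜ b ⊕ ⊝ x) refl (pos a) (pos x) (pos b)) ,
       inj₂ refl

open import Defs
open import Relation.Binary.PropositionalEquality
  using (refl; sym; trans; cong; cong₂; subst; subst₂; module ≡-Reasoning)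

-- The real numbers as a divisible ordered group

module Reals where

  half : ℚ → ℚ
  half ε = ½ ℚ.* ε

  0<half : ∀ {ε} → 0ℚ ℚ.< ε → 0ℚ ℚ.< half ε
  0<half {ε} 0<ε = subst (ℚ._< half ε) (ℚ.*-zeroʳ ½) (ℚ.*-monoʳ-<-pos ½ 0<ε)

  half+half : ∀ ε → half ε ℚ.+ half ε ≡ ε
  half+half ε = trans (sym (ℚ.*-distribʳ-+ ε ½ ½)) (ℚ.*-identityˡ ε)

  split-error : ∀ p ε → p ℚ.+ half ε ℚ.+ half ε ≡ p ℚ.+ ε
  split-error p ε = trans (ℚ.+-assoc p _ _) (cong (p ℚ.+_) (half+half ε))

  p<p+ε : ∀ p {ε} → 0ℚ ℚ.< ε → p ℚ.< p ℚ.+ ε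
  p<p+ε p {ε} 0<ε = subst (ℚ._< p ℚ.+ ε) (ℚ.+-identityʳ p) (ℚ.+-monoʳ-< p 0<ε)

  p≤∣p∣ : ∀ p → p ℚ.≤ ℚ.∣ p ∣
  p≤∣p∣ p with ℚ.≤-total 0ℚ p
  ... | inj₁ 0≤p = ℚ.≤-reflexive (sym (ℚ.0≤p⇒∣p∣≡p 0≤p))
  ... | inj₂ p≤0 = ℚ.≤-trans p≤0 (ℚ.0≤∣p∣ p)

  q+[p-q]≡p : ∀ p q → q ℚ.+ (p ℚ.- q) ≡ p
  q+[p-q]≡p = solve 2 (λ p q → q :+ (p :- q) := p) refl
    where open ℚ.+-*-Solver

  ∣p-q∣<ε⇒p<q+ε : ∀ p q {ε} → ℚ.∣ p ℚ.- q ∣ ℚ.< ε → p ℚ.< q ℚ.+ ε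
  ∣p-q∣<ε⇒p<q+ε p q {ε} close = subst (ℚ._< q ℚ.+ ε) (q+[p-q]≡p p q)
    (ℚ.+-monoʳ-< q (ℚ.≤-<-trans (p≤∣p∣ (p ℚ.- q)) close))

  p<q+ε⇒p-q<ε : ∀ p q {ε} → p ℚ.< q ℚ.+ ε → p ℚ.- q ℚ.< ε
  p<q+ε⇒p-q<ε p q {ε} lt = subst (p ℚ.- q ℚ.<_) (cancel q ε) (ℚ.+-monoˡ-< (ℚ.- q) lt)
    where
    open ℚ.+-*-Solver
    cancel : ∀ q ε → q ℚ.+ ε ℚ.- q ≡ ε
    cancel = solve 2 (λ q ε → q :+ ε :- q := ε) refl

  -[p-q]≡q-p : ∀ p q → ℚ.- (p ℚ.- q) ≡ q ℚ.- p
  -[p-q]≡q-p = solve 2 (λ p q → :- (p :- q) := q :- p) refl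
    where open ℚ.+-*-Solver

  ∣p-q∣≡∣q-p∣ : ∀ p q → ℚ.∣ p ℚ.- q ∣ ≡ ℚ.∣ q ℚ.- p ∣
  ∣p-q∣≡∣q-p∣ p q = trans (sym (ℚ.∣-p∣≡∣p∣ (p ℚ.- q))) (cong ℚ.∣_∣ (-[p-q]≡q-p p q))

  sandwich⇒∣p-q∣<ε : ∀ p q {ε} → p ℚ.< q ℚ.+ ε → q ℚ.< p ℚ.+ ε → ℚ.∣ p ℚ.- q ∣ ℚ.< ε
  sandwich⇒∣p-q∣<ε p q {ε} p<q+ε q<p+ε with ℚ.∣p∣≡p∨∣p∣≡-p (p ℚ.- q)
  ... | inj₁ eq = subst (ℚ._< ε) (sym eq) (p<q+ε⇒p-q<ε p q p<q+ε)
  ... | inj₂ eq = subst (ℚ._< ε) (trans (sym (-[p-q]≡q-p p q)) (sym eq)) (p<q+ε⇒p-q<ε q p q<p+ε)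

  Eventually : (ℕ → Set) → Set
  Eventually P = ∃[ N ] (∀ n → N ℕ.≤ n → P n)

  eventually₂ : ∀ {P Q R : ℕ → Set} → (∀ n → P n → Q n → R n) →
                Eventually P → Eventually Q → Eventually R
  eventually₂ f (M , p) (N , q) = M ℕ.⊔ N , λ n le →
    f n (p n (ℕ.m⊔n≤o⇒m≤o M N le)) (q n (ℕ.m⊔n≤o⇒n≤o M N le))

  ≤-reflexive : ∀ x y → x ≃ y → x ≤ y
  ≤-reflexive x y x≃y ε 0<ε = let (N , close) = x≃y ε 0<ε in
    N , λ n N≤n → ∣p-q∣<ε⇒p<q+ε (seq x n) (seq y n) (close n N≤n)

  ≤-antisym : ∀ x y → x ≤ y → y ≤ x → x ≃ y
  ≤-antisym x y x≤y y≤x ε 0<ε =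
    eventually₂ (λ n → sandwich⇒∣p-q∣<ε (seq x n) (seq y n)) (x≤y ε 0<ε) (y≤x ε 0<ε)

  ≃-sym : ∀ x y → x ≃ y → y ≃ x
  ≃-sym x y x≃y ε 0<ε = let (N , close) = x≃y ε 0<ε in
    N , λ n N≤n → subst (ℚ._< ε) (∣p-q∣≡∣q-p∣ (seq x n) (seq y n)) (close n N≤n)

  ≤-trans : ∀ x y z → x ≤ y → y ≤ z → x ≤ z
  ≤-trans x y z x≤y y≤z ε 0<ε = eventually₂
    (λ n p q → subst (seq x n ℚ.<_) (split-error (seq z n) ε)
      (ℚ.<-trans p (ℚ.+-monoˡ-< (half ε) q)))
    (x≤y (half ε) (0<half 0<ε)) (y≤z (half ε) (0<half 0<ε))

  ≃-trans : ∀ x y z → x ≃ y → y ≃ z → x ≃ z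
  ≃-trans x y z x≃y y≃z = ≤-antisym x z
    (≤-trans x y z (≤-reflexive x y x≃y) (≤-reflexive y z y≃z))
    (≤-trans z y x (≤-reflexive z y (≃-sym y z y≃z)) (≤-reflexive y x (≃-sym x y x≃y)))

  pointwise : ∀ x y → (∀ n → seq x n ≡ seq y n) → x ≃ y
  pointwise x y eq ε 0<ε = 0 , λ n _ →
    subst (ℚ._< ε) (cong ℚ.∣_∣ (sym (trans (cong (ℚ._- seq y n) (eq n)) (ℚ.+-inverseʳ (seq y n))))) 0<ε

  +-mono-≤ : ∀ x y u v → x ≤ y → u ≤ v → x + u ≤ y + v
  +-mono-≤ x y u v x≤y u≤v ε 0<ε = eventually₂
    (λ n p q → subst (seq x n ℚ.+ seq u n ℚ.<_) (regroup (seq y n) (seq v n)) (ℚ.+-mono-< p q))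
    (x≤y (half ε) (0<half 0<ε)) (u≤v (half ε) (0<half 0<ε))
    where
    interchange : ∀ a b c → (a ℚ.+ c) ℚ.+ (b ℚ.+ c) ≡ (a ℚ.+ b) ℚ.+ c ℚ.+ c
    interchange = solve 3 (λ a b c → (a :+ c) :+ (b :+ c) := (a :+ b) :+ c :+ c) refl
      where open ℚ.+-*-Solver
    regroup : ∀ a b → (a ℚ.+ half ε) ℚ.+ (b ℚ.+ half ε) ≡ (a ℚ.+ b) ℚ.+ ε
    regroup a b = trans (interchange a b (half ε)) (split-error (a ℚ.+ b) ε)

  neg-antimono-≤ : ∀ x y → x ≤ y → - y ≤ - x
  neg-antimono-≤ x y x≤y ε 0<ε = let (N , lt) = x≤y ε 0<ε in
    N , λ n N≤n → subst₂ ℚ._<_ (p₁ (seq x n) (seq y n)) (p₂ (seq x n) (seq y n) ε)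
      (ℚ.+-monoʳ-< (ℚ.- seq x n ℚ.- seq y n) (lt n N≤n))
    where
    open ℚ.+-*-Solver
    p₁ : ∀ a b → (ℚ.- a ℚ.- b) ℚ.+ a ≡ ℚ.- b
    p₁ = solve 2 (λ a b → (:- a :- b) :+ a := :- b) refl
    p₂ : ∀ a b e → (ℚ.- a ℚ.- b) ℚ.+ (b ℚ.+ e) ≡ ℚ.- a ℚ.+ e
    p₂ = solve 3 (λ a b e → (:- a :- b) :+ (b :+ e) := :- a :+ e) refl

  <⇒≤ : ∀ x y → x < y → x ≤ y
  <⇒≤ x y (ε , 0<ε , N , lt) δ 0<δ =
    N , λ n N≤n → ℚ.<-trans (p<p+ε (seq x n) 0<ε) (ℚ.<-trans (lt n N≤n) (p<p+ε (seq y n) 0<δ))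

  <⇒≱ : ∀ x y → x < y → ¬ (y ≤ x)
  <⇒≱ x y (ε , 0<ε , x<y) y≤x =
    let (N , lt) = eventually₂ {R = λ n → seq x n ℚ.+ ε ℚ.< seq x n ℚ.+ ε}
                     (λ n → ℚ.<-trans) x<y (y≤x ε 0<ε)
    in ℚ.<-irrefl refl (lt N ℕ.≤-refl)

  isAbelianGroup : IsAbelianGroup _≃_ _+_ 0ℝ (λ x → - x)
  isAbelianGroup = record
    { isGroup = record
      { isMonoid = record
        { isSemigroup = record
          { isMagma = record
            { isEquivalence = record
              { refl  = λ {x} → pointwise x x (λ _ → refl)
              ; sym   = λ {x y} → ≃-sym x y
              ; trans = λ {x y z} → ≃-trans x y z
              }
            ; ∙-cong = λ {x y u v} x≃y u≃v → ≤-antisym (x + u) (y + v)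
                (+-mono-≤ x y u v (≤-reflexive x y x≃y) (≤-reflexive u v u≃v))
                (+-mono-≤ y x v u (≤-reflexive y x (≃-sym x y x≃y))
                                  (≤-reflexive v u (≃-sym u v u≃v)))
            }
          ; assoc = λ x y z → pointwise ((x + y) + z) (x + (y + z))
              λ n → ℚ.+-assoc (seq x n) (seq y n) (seq z n)
          }
        ; identity = (λ x → pointwise (0ℝ + x) x λ n → ℚ.+-identityˡ (seq x n))
                   , (λ x → pointwise (x + 0ℝ) x λ n → ℚ.+-identityʳ (seq x n))
        }
      ; inverse = (λ x → pointwise (- x + x) 0ℝ λ n → ℚ.+-inverseˡ (seq x n))
                , (λ x → pointwise (x + - x) 0ℝ λ n → ℚ.+-inverseʳ (seq x n))
      ; ⁻¹-cong = λ {x y} x≃y → ≤-antisym (- x) (- y)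
          (neg-antimono-≤ y x (≤-reflexive y x (≃-sym x y x≃y)))
          (neg-antimono-≤ x y (≤-reflexive x y x≃y))
      }
    ; comm = λ x y → pointwise (x + y) (y + x) λ n → ℚ.+-comm (seq x n) (seq y n)
    }

  -- The rational number `n + 1`, as a repeated sum so that it follows the recursion of `_·_` on
  -- reals.
  ⟨1+_⟩ : ℕ → ℚ
  ⟨1+ zero ⟩  = 1ℚ
  ⟨1+ suc n ⟩ = 1ℚ ℚ.+ ⟨1+ n ⟩

  ⟨1+_⟩-pos : ∀ n → ℚ.Positive ⟨1+ n ⟩
  ⟨1+ zero ⟩-pos  = _
  ⟨1+ suc n ⟩-pos = ℚ.pos+pos⇒pos 1ℚ ⟨1+ n ⟩ {{⟨1+ n ⟩-pos}}

  scale : (r : ℚ) → ℚ.Positive r → ℝ → ℝ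
  scale r r-pos x = mkℝ (λ k → r ℚ.* seq x k) λ ε 0<ε →
    let (N , close) = cauchy x (ℚ.1/ r ℚ.* ε)
                        (subst (ℚ._< ℚ.1/ r ℚ.* ε) (ℚ.*-zeroʳ (ℚ.1/ r)) (ℚ.*-monoʳ-<-pos (ℚ.1/ r) 0<ε))
    in N , λ i j N≤i N≤j → subst₂ ℚ._<_ (distance (seq x i) (seq x j)) (cancel ε)
             (ℚ.*-monoʳ-<-pos r (close i j N≤i N≤j))
    where
    instance
      _ : ℚ.Positive r
      _ = r-pos
      r-nonzero : ℚ.NonZero r
      r-nonzero = ℚ.pos⇒nonZero r
      r⁻¹-pos : ℚ.Positive (ℚ.1/ r)
      r⁻¹-pos = ℚ.1/pos⇒pos r
    distance : ∀ p q → r ℚ.* ℚ.∣ p ℚ.- q ∣ ≡ ℚ.∣ r ℚ.* p ℚ.- r ℚ.* q ∣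
    distance p q = trans (cong (ℚ._* ℚ.∣ p ℚ.- q ∣) (sym (ℚ.0≤p⇒∣p∣≡p (ℚ.<⇒≤ (ℚ.positive⁻¹ r)))))
      (trans (sym (ℚ.∣p*q∣≡∣p∣*∣q∣ r (p ℚ.- q)))
             (cong ℚ.∣_∣ (distrib r p q)))
      where
      open ℚ.+-*-Solver
      distrib : ∀ r p q → r ℚ.* (p ℚ.- q) ≡ r ℚ.* p ℚ.- r ℚ.* q
      distrib = solve 3 (λ r p q → r :* (p :- q) := r :* p :- r :* q) refl
    cancel : ∀ ε → r ℚ.* (ℚ.1/ r ℚ.* ε) ≡ ε
    cancel ε = trans (sym (ℚ.*-assoc r (ℚ.1/ r) ε))
      (trans (cong (ℚ._* ε) (ℚ.*-inverseʳ r)) (ℚ.*-identityˡ ε))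

  seq-multiple : ∀ n x k → seq (+ suc n · x) k ≡ ⟨1+ n ⟩ ℚ.* seq x k
  seq-multiple zero    x k = trans (ℚ.+-identityʳ (seq x k)) (sym (ℚ.*-identityˡ (seq x k)))
  seq-multiple (suc n) x k = trans (cong (seq x k ℚ.+_) (seq-multiple n x k))
    (trans (cong (ℚ._+ ⟨1+ n ⟩ ℚ.* seq x k) (sym (ℚ.*-identityˡ (seq x k))))
           (sym (ℚ.*-distribʳ-+ (seq x k) 1ℚ ⟨1+ n ⟩)))

  divisible : ∀ n x → ∃[ y ] (+ suc n · y ≃ x)
  divisible n x = y , pointwise (+ suc n · y) x λ k → trans (seq-multiple n y k)
    (trans (sym (ℚ.*-assoc r (ℚ.1/ r) (seq x k)))
      (trans (cong (ℚ._* seq x k) (ℚ.*-inverseʳ r)) (ℚ.*-identityˡ (seq x k))))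
    where
    r = ⟨1+ n ⟩
    instance
      r-pos : ℚ.Positive r
      r-pos = ⟨1+ n ⟩-pos
      r-nonzero : ℚ.NonZero r
      r-nonzero = ℚ.pos⇒nonZero r
    y : ℝ
    y = scale (ℚ.1/ r) (ℚ.1/pos⇒pos r) x

-- Totality of the order

module Order (em : ExcludedMiddle 0ℓ) where
  open Reals

  ¬∀⇒∃¬ : {A : Set} {P : A → Set} → ¬ (∀ a → P a) → ∃[ a ] (¬ P a)
  ¬∀⇒∃¬ ¬all = decidable-stable em λ ¬some →
    ¬all λ a → decidable-stable em λ ¬pa → ¬some (a , ¬pa)

  ¬→⇒× : {A B : Set} → ¬ (A → B) → A × ¬ B
  ¬→⇒× ¬f = decidable-stable em (λ ¬a → ¬f (λ a → contradiction a ¬a)) , λ b → ¬f (λ _ → b)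

  -- Failure of `x ≤ y` gives an `ε` such that x exceeds y by at least `ε` at arbitrarily late
  -- indices. Beyond `N` each sequence varies by less than `ε / 4`, so from one such index `k` a gap
  -- of `ε / 2` carries over to all later indices.
  ≰⇒> : ∀ x y → ¬ (x ≤ y) → y < x
  ≰⇒> x y x≰y =
    let (ε , p)       = ¬∀⇒∃¬ x≰y
        (0<ε , never) = ¬→⇒× p
        η             = half ε
        0<η           = 0<half 0<ε
        θ             = half η
        0<θ           = 0<half 0<η
        (Nx , cx)     = cauchy x θ 0<θ
        (Ny , cy)     = cauchy y θ 0<θ
        N             = Nx ℕ.⊔ Ny
        (k , q)       = ¬∀⇒∃¬ λ all → never (N , all)
        (N≤k , r)     = ¬→⇒× q
    in η , 0<η , N , λ n N≤n → begin-strict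
         seq y n ℚ.+ η                 <⟨ ℚ.+-monoˡ-< η (∣p-q∣<ε⇒p<q+ε (seq y n) (seq y k) (cy n k (ℕ.m⊔n≤o⇒n≤o Nx Ny N≤n) (ℕ.m⊔n≤o⇒n≤o Nx Ny N≤k))) ⟩
         seq y k ℚ.+ θ ℚ.+ η           ≡⟨ regroup (seq y k) θ η ⟩
         seq y k ℚ.+ η ℚ.+ θ           ≡⟨ cancel (seq y k ℚ.+ η) θ ⟩
         seq y k ℚ.+ η ℚ.+ θ ℚ.+ θ ℚ.- θ ≡⟨ cong (ℚ._- θ) (split-error (seq y k ℚ.+ η) η) ⟩
         seq y k ℚ.+ η ℚ.+ η ℚ.- θ     ≡⟨ cong (ℚ._- θ) (split-error (seq y k) ε) ⟩
         seq y k ℚ.+ ε ℚ.- θ           ≤⟨ ℚ.+-monoˡ-≤ (ℚ.- θ) (ℚ.≮⇒≥ r) ⟩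
         seq x k ℚ.- θ                 <⟨ ℚ.+-monoˡ-< (ℚ.- θ) (∣p-q∣<ε⇒p<q+ε (seq x k) (seq x n) (cx k n (ℕ.m⊔n≤o⇒m≤o Nx Ny N≤k) (ℕ.m⊔n≤o⇒m≤o Nx Ny N≤n))) ⟩
         seq x n ℚ.+ θ ℚ.- θ           ≡⟨ cancel′ (seq x n) θ ⟩
         seq x n ∎
    where
    open ℚ.≤-Reasoning
    open ℚ.+-*-Solver
    regroup : ∀ a b c → a ℚ.+ b ℚ.+ c ≡ a ℚ.+ c ℚ.+ b
    regroup = solve 3 (λ a b c → a :+ b :+ c := a :+ c :+ b) refl
    cancel : ∀ a b → a ℚ.+ b ≡ a ℚ.+ b ℚ.+ b ℚ.- b
    cancel = solve 2 (λ a b → a :+ b := a :+ b :+ b :- b) refl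
    cancel′ : ∀ a b → a ℚ.+ b ℚ.- b ≡ a
    cancel′ = solve 2 (λ a b → a :+ b :- b := a) refl

ℝ-orderedGroup : ExcludedMiddle 0ℓ → OrderedGroup
ℝ-orderedGroup em = record
  { Carrier = ℝ
  ; _≈_ = _≃_
  ; _≤_ = _≤_
  ; _<_ = _<_
  ; _+_ = _+_
  ; 0# = 0ℝ
  ; -_ = λ x → - x
  ; _·_ = _·_
  ; isAbelianGroup = Reals.isAbelianGroup
  ; 0· = λ x → Reals.pointwise 0ℝ 0ℝ (λ _ → refl)
  ; suc· = λ n x → Reals.pointwise ((+ suc n) · x) (x + (+ n) · x) (λ _ → refl)
  ; neg· = λ n x → Reals.pointwise (-[1+ n ] · x) (- ((+ suc n) · x)) (λ _ → refl)
  ; ≤-reflexive = λ {x y} → Reals.≤-reflexive x y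
  ; ≤-trans = λ {x y z} → Reals.≤-trans x y z
  ; ≤-antisym = λ {x y} → Reals.≤-antisym x y
  ; +-mono-≤ = λ {x y u v} → Reals.+-mono-≤ x y u v
  ; _≤?_ = λ x y → em
  ; ≰⇒> = λ {x y} → Order.≰⇒> em x y
  ; <⇒≤ = λ {x y} → Reals.<⇒≤ x y
  ; <⇒≱ = λ {x y} → Reals.<⇒≱ x y
  ; divisible = Reals.divisible
  }

-- Points, slopes and divisors on the graph

module Graph (em : ExcludedMiddle 0ℓ) (Γ : MetricGraph) (loopless : Loopless Γ) where
  open MetricGraph Γ
  open Divisors em Γ
  open Sum ℤ.+-0-commutativeMonoid using (sum; sum-cong-≗; ∑-distrib-+; sum-replicate-zero)

  infix 4 _≈ᴳ_
  _≈ᴳ_ : Point Γ → Point Γ → Set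
  _≈ᴳ_ = _≈_

  -- Sealed, since the relations of ℝ are function types, from which Agda cannot infer the numbers.
  opaque
    R : OrderedGroup
    R = ℝ-orderedGroup em

  module O = OrderedGroupProperties R
  open O using
    (≤-refl; ≤-trans; ≈⇒≥; ≤-reflexive; <⇒≤; ≰⇒≥; ≤-<-trans; <-≤-trans; <-irrefl; ≤⇒<⊎≈)

  opaque
    unfolding R

    ⌜_⌝ : ℝ → O.Carrier
    ⌜ x ⌝ = x

    ⌞_⌟ : O.Carrier → ℝ
    ⌞ x ⌟ = x

    ⌜⌞_⌟⌝ : ∀ x → ⌜ ⌞ x ⌟ ⌝ ≡ x
    ⌜⌞ x ⌟⌝ = refl

    seal-≃ : ∀ x y → x ≃ y → ⌜ x ⌝ O.≈ ⌜ y ⌝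
    seal-≃ x y p = p

    seal-≤ : ∀ x y → x ≤ y → ⌜ x ⌝ O.≤ ⌜ y ⌝
    seal-≤ x y p = p

    seal-< : ∀ x y → x < y → ⌜ x ⌝ O.< ⌜ y ⌝
    seal-< x y p = p

    unseal-≤ : ∀ {x y} → ⌜ x ⌝ O.≤ ⌜ y ⌝ → x ≤ y
    unseal-≤ p = p

  Edge : Fin size → Set
  Edge e = Interval (length e)

  opaque
    unfolding ⌜_⌝

    at : ∀ {e} → Edge e → O.Carrier
    at t = ⌜ pos t ⌝

    at-≡ : ∀ {e} (t : Edge e) → at t ≡ ⌜ pos t ⌝
    at-≡ t = refl

    seal-at-≃ : ∀ {e} (t u : Edge e) → pos t ≃ pos u → at t O.≈ at u
    seal-at-≃ t u p = p

    seal-at-≤ : ∀ {e} (t u : Edge e) → pos t ≤ pos u → at t O.≤ at u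
    seal-at-≤ t u p = p

    seal-at-< : ∀ {e} (t u : Edge e) → pos t < pos u → at t O.< at u
    seal-at-< t u p = p

    unseal-at-≃ : ∀ {e} {t u : Edge e} → at t O.≈ at u → pos t ≃ pos u
    unseal-at-≃ p = p

    unseal-at-< : ∀ {e} {t u : Edge e} → at t O.< at u → pos t < pos u
    unseal-at-< p = p

  0≤length : ∀ e → 0ℝ ≤ length e
  0≤length e = unseal-≤ {0ℝ} {length e} (<⇒≤ (seal-< 0ℝ (length e) (length-pos e)))

  lo hi : ∀ e → Edge e
  lo e = interval 0ℝ (unseal-≤ {0ℝ} {0ℝ} ≤-refl) (0≤length e)
  hi e = interval (length e) (0≤length e) (unseal-≤ {length e} {length e} ≤-refl)

  lo≤ : ∀ {e} (t : Edge e) → at (lo e) O.≤ at t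
  lo≤ {e} t = seal-at-≤ (lo e) t (Interval.0≤pos t)

  ≤hi : ∀ {e} (t : Edge e) → at t O.≤ at (hi e)
  ≤hi {e} t = seal-at-≤ t (hi e) (Interval.pos≤ℓ t)

  lo<hi : ∀ e → at (lo e) O.< at (hi e)
  lo<hi e = seal-at-< (lo e) (hi e) (length-pos e)

  between : ∀ {e} (a b : Edge e) r → at a O.≤ r → r O.≤ at b → ∃[ t ] at {e} t O.≈ r
  between {e} a b r a≤r r≤b = t , O.reflexive (trans (at-≡ t) ⌜⌞ r ⌟⌝)
    where
    t : Edge e
    t = interval ⌞ r ⌟
      (unseal-≤ {0ℝ} (subst₂ O._≤_ (at-≡ (lo e)) (sym ⌜⌞ r ⌟⌝) (≤-trans (lo≤ a) a≤r)))
      (unseal-≤ {y = length e} (subst₂ O._≤_ (sym ⌜⌞ r ⌟⌝) (at-≡ (hi e)) (≤-trans r≤b (≤hi b))))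

  module E {e : Fin size} = PiecewiseLinear R (Edge e) at between
  open E

  opaque
    unfolding at

    seal-slope : ∀ (f : Point Γ → ℝ) {e} (a b : Edge e) {s} → HasSlope Γ f e (pos a) (pos b) s →
                 Linear (λ t → ⌜ f (on e t) ⌝) a b s
    seal-slope f a b lin = lin

    unseal-slope : ∀ (V : Point Γ → O.Carrier) {e} (a b : Edge e) {s} → Linear (λ t → V (on e t)) a b s →
                   HasSlope Γ (λ x → ⌞ V x ⌟) e (pos a) (pos b) s
    unseal-slope V a b lin = lin

    unseal-slope′ : ∀ (f : Point Γ → ℝ) {e} (a b : Edge e) {s} → Linear (λ t → ⌜ f (on e t) ⌝) a b s →
                    HasSlope Γ f e (pos a) (pos b) s
    unseal-slope′ V a b lin = lin

    ⌞⌟-cong : ∀ {x y} → x O.≈ y → ⌞ x ⌟ ≃ ⌞ y ⌟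
    ⌞⌟-cong p = p

  -- Points

  OnVertex : ∀ {e} → Edge e → Fin order → Set
  OnVertex {e} t v = (at t O.≈ at (lo e) × v ≡ src e) ⊎ (at t O.≈ at (hi e) × v ≡ tgt e)

  on-vertex : ∀ {x v} → IsVertex {Γ} x v → ∀ {e} {t : Edge e} → x ≡ on e t → OnVertex t v
  on-vertex (at-src {e} {t} t≃0) refl = inj₁ (seal-at-≃ t (lo e) t≃0 , refl)
  on-vertex (at-tgt {e} {t} t≃ℓ) refl = inj₂ (seal-at-≃ t (hi e) t≃ℓ , refl)

  vertex-on : ∀ {e} {t : Edge e} {v} → OnVertex t v → IsVertex {Γ} (on e t) v
  vertex-on {e} {t} (inj₁ (t≈lo , refl)) = at-src (unseal-at-≃ {t = t} {lo e} t≈lo)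
  vertex-on {e} {t} (inj₂ (t≈hi , refl)) = at-tgt (unseal-at-≃ {t = t} {hi e} t≈hi)

  lo≉hi : ∀ {e} {t : Edge e} → at t O.≈ at (lo e) → ¬ (at t O.≈ at (hi e))
  lo≉hi {e} t≈lo t≈hi = <-irrefl (O.trans (O.sym t≈lo) t≈hi) (lo<hi e)

  OnVertex-unique : ∀ {e} {t : Edge e} {v w} → OnVertex t v → OnVertex t w → v ≡ w
  OnVertex-unique (inj₁ (_ , refl)) (inj₁ (_ , refl)) = refl
  OnVertex-unique (inj₂ (_ , refl)) (inj₂ (_ , refl)) = refl
  OnVertex-unique {t = t} (inj₁ (t≈lo , _)) (inj₂ (t≈hi , _)) = contradiction t≈hi (lo≉hi {t = t} t≈lo)
  OnVertex-unique {t = t} (inj₂ (t≈hi , _)) (inj₁ (t≈lo , _)) = contradiction t≈hi (lo≉hi {t = t} t≈lo)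

  OnVertex-move : ∀ {e} {t u : Edge e} {v} → at t O.≈ at u → OnVertex t v → OnVertex u v
  OnVertex-move t≈u (inj₁ (t≈lo , eq)) = inj₁ (O.trans (O.sym t≈u) t≈lo , eq)
  OnVertex-move t≈u (inj₂ (t≈hi , eq)) = inj₂ (O.trans (O.sym t≈u) t≈hi , eq)

  vertex-injective : ∀ {x v w} → IsVertex {Γ} x v → x ≡ vertex w → v ≡ w
  vertex-injective at-vertex refl = refl

  IsVertex-unique : ∀ {x v w} → IsVertex {Γ} x v → IsVertex {Γ} x w → v ≡ w
  IsVertex-unique {vertex _} p q = trans (vertex-injective p refl) (sym (vertex-injective q refl))
  IsVertex-unique {on e t}   p q = OnVertex-unique {t = t} (on-vertex p refl) (on-vertex q refl)

  on-cong : ∀ {e} {t u : Edge e} → at t O.≈ at u → on e t ≈ᴳ on e u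
  on-cong {e} {t} {u} t≈u = same-position (unseal-at-≃ {t = t} {u} t≈u)

  IsVertex-move : ∀ {x y v} → x ≈ᴳ y → IsVertex {Γ} x v → IsVertex {Γ} y v
  IsVertex-move (same-vertex p q) r = subst (IsVertex {Γ} _) (IsVertex-unique p r) q
  IsVertex-move (same-position {e} {t} {u} t≃u) r =
    vertex-on {e} {u} (OnVertex-move {e} {t} {u} (seal-at-≃ t u t≃u) (on-vertex r refl))

  ≈-refl : ∀ {x : Point Γ} → x ≈ᴳ x
  ≈-refl {vertex v} = same-vertex at-vertex at-vertex
  ≈-refl {on e t}   = on-cong O.refl

  ≈-sym : ∀ {x y : Point Γ} → x ≈ᴳ y → y ≈ᴳ x
  ≈-sym (same-vertex p q)   = same-vertex q p
  ≈-sym (same-position {t = t} {u} t≃u) = on-cong (O.sym (seal-at-≃ t u t≃u))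

  -- A chain through a vertex stays at that vertex, because a point represents at most one vertex;
  -- the two ends of an edge are told apart by its positive length.
  ≈-trans : ∀ {x y z : Point Γ} → x ≈ᴳ y → y ≈ᴳ z → x ≈ᴳ z
  ≈-trans (same-vertex p q) y≈z = same-vertex p (IsVertex-move y≈z q)
  ≈-trans x≈y@(same-position _) (same-vertex p q) = same-vertex (IsVertex-move (≈-sym x≈y) p) q
  ≈-trans (same-position {t = t} {u} t≃u) (same-position {u = w} u≃w) =
    on-cong (O.trans (seal-at-≃ t u t≃u) (seal-at-≃ u w u≃w))

  -- The only use of looplessness: different positions on `e` could be glued only as the two ends of
  -- a loop. So a point has at most one position on each edge, and hence at most one outgoing slope
  -- for each edge and direction.
  on-injective : ∀ {x y} → x ≈ᴳ y → ∀ {e} {t u : Edge e} → x ≡ on e t → y ≡ on e u → at t O.≈ at u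
  on-injective (same-position {t = t} {u} t≃u) refl refl = seal-at-≃ t u t≃u
  on-injective (same-vertex p q) x≡ y≡ with on-vertex p x≡ | on-vertex q y≡
  ... | inj₁ (t≈lo , _)  | inj₁ (u≈lo , _)  = O.trans t≈lo (O.sym u≈lo)
  ... | inj₂ (t≈hi , _)  | inj₂ (u≈hi , _)  = O.trans t≈hi (O.sym u≈hi)
  ... | inj₁ (_ , v≡src) | inj₂ (_ , v≡tgt) = contradiction (trans (sym v≡src) v≡tgt) (loopless _)
  ... | inj₂ (_ , v≡tgt) | inj₁ (_ , v≡src) = contradiction (trans (sym v≡src) v≡tgt) (loopless _)

  same-point : ∀ {e} {t u : Edge e} {v} → on e t ≈ᴳ v → on e u ≈ᴳ v → at t O.≈ at u
  same-point p q = on-injective (≈-trans p (≈-sym q)) refl refl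

  -- Slopes

  Leaves : ∀ {e} → Direction → Edge e → Set
  Leaves {e} forward  t = at t O.< at (hi e)
  Leaves {e} backward t = at (lo e) O.< at t

  Germ : ∀ {e} → (Edge e → O.Carrier) → Direction → Edge e → ℤ → Set
  Germ φ forward  t s = ∃[ u ] (at t O.< at u × Linear φ t u s)
  Germ φ backward t s = ∃[ u ] (at u O.< at t × Linear φ u t (ℤ.- s))

  germ : ∀ {e φ} d {t : Edge e} → PL φ (lo e) (hi e) → Leaves d t → ∃[ s ] Germ φ d t s
  germ forward  {t} p leaves = let (u , s , t<u , lin) = slope-right p (lo≤ t) leaves in s , u , t<u , lin
  germ backward {t} p leaves = let (u , s , u<t , lin) = slope-left p leaves (≤hi t) in s , u , u<t , lin

  Germ-resp : ∀ {e} {φ ψ : Edge e → O.Carrier} d {t s} → (∀ u → φ u O.≈ ψ u) → Germ φ d t s → Germ ψ d t s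
  Germ-resp forward  eq (u , t<u , lin) = u , t<u , Linear-resp (λ w _ _ → eq w) lin
  Germ-resp backward eq (u , u<t , lin) = u , u<t , Linear-resp (λ w _ _ → eq w) lin

  Germ-+ : ∀ {e} {φ ψ : Edge e → O.Carrier} d {t r s} → Germ φ d t r → Germ ψ d t s →
           Germ (λ u → φ u O.+ ψ u) d t (r ℤ.+ s)
  Germ-+ forward (u , t<u , linφ) (v , t<v , linψ) with at u O.≤? at v
  ... | yes u≤v = u , t<u , Linear-+ linφ (Linear-restrict ≤-refl u≤v linψ)
  ... | no  u≰v = v , t<v , Linear-+ (Linear-restrict ≤-refl (≰⇒≥ u≰v) linφ) linψ
  Germ-+ {φ = φ} {ψ} backward {t} {r} {s} (u , u<t , linφ) (v , v<t , linψ) with at v O.≤? at u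
  ... | yes v≤u = u , u<t , subst (Linear (λ w → φ w O.+ ψ w) u t) (sym (ℤ.neg-distrib-+ r s))
    (Linear-+ linφ (Linear-restrict v≤u ≤-refl linψ))
  ... | no  v≰u = v , v<t , subst (Linear (λ w → φ w O.+ ψ w) v t) (sym (ℤ.neg-distrib-+ r s))
    (Linear-+ (Linear-restrict (≰⇒≥ v≰u) ≤-refl linφ) linψ)

  Germ-≤ : ∀ {e} {φ ψ : Edge e → O.Carrier} d {z z′ r s} → (∀ t → φ t O.≤ ψ t) → at z O.≈ at z′ →
           φ z O.≈ ψ z′ → Germ φ d z r → Germ ψ d z′ s → r ℤ.≤ s
  Germ-≤ forward  φ≤ψ z≈ eq (_ , lt , lin) (_ , lt′ , lin′) = slope-≤-right φ≤ψ z≈ eq lt lt′ lin lin′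
  Germ-≤ backward φ≤ψ z≈ eq (_ , lt , lin) (_ , lt′ , lin′) = slope-≤-left φ≤ψ z≈ eq lt lt′ lin lin′

  Germ-unique : ∀ {e} {φ : Edge e → O.Carrier} d {z z′ r s} → at z O.≈ at z′ → φ z O.≈ φ z′ →
                Germ φ d z r → Germ φ d z′ s → r ≡ s
  Germ-unique d z≈ eq p q = ℤ.≤-antisym (Germ-≤ d (λ _ → ≤-refl) z≈ eq p q)
                                        (Germ-≤ d (λ _ → ≤-refl) (O.sym z≈) (O.sym eq) q p)

  val : RationalFunction Γ → Point Γ → O.Carrier
  val f x = ⌜ value f x ⌝

  val-cong : ∀ f {x y} → x ≈ᴳ y → val f x O.≈ val f y
  val-cong f {x} {y} x≈y = seal-≃ (value f x) (value f y) (value-cong f x≈y)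

  infix 9 _↾_
  _↾_ : RationalFunction Γ → ∀ e → Edge e → O.Carrier
  (f ↾ e) t = val f (on e t)

  ↾-cong : ∀ f e → Congruent (f ↾ e)
  ↾-cong f e t≈u = val-cong f (on-cong t≈u)

  ↾-PL : ∀ f e → PL (f ↾ e) (lo e) (hi e)
  ↾-PL f e = go (lo e) (pieces f e)
    where
    go : ∀ t → Pieces Γ (value f) e (pos t) → PL (f ↾ e) t (hi e)
    go t (last s lin) = single (≤hi t) (s , seal-slope (value f) t (hi e) lin)
    go t (step b s t<b b<ℓ lin rest) =
      cons m (<⇒≤ (seal-at-< t m t<b)) (s , seal-slope (value f) t m lin) (go m rest)
      where
      m : Edge e
      m = interval b
        (unseal-≤ {0ℝ} {b} (≤-trans (seal-≤ 0ℝ (pos t) (Interval.0≤pos t)) (<⇒≤ (seal-< (pos t) b t<b))))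
        (unseal-≤ {b} {length e} (<⇒≤ (seal-< b (length e) b<ℓ)))

  outgoing-germ : ∀ f {v e} d {s} → OutgoingSlope f v e d s →
                  ∃[ t ] (on e t ≈ᴳ v × Leaves d t × Germ (f ↾ e) d t s)
  outgoing-germ f forward (t , u , t≈v , t<u , lin) =
    t , t≈v , <-≤-trans t<u′ (≤hi u) , u , t<u′ , seal-slope (value f) t u lin
    where t<u′ = seal-at-< t u t<u
  outgoing-germ f backward (t , u , t≈v , u<t , lin) =
    t , t≈v , ≤-<-trans (lo≤ u) u<t′ , u , u<t′ , seal-slope (value f) u t lin
    where u<t′ = seal-at-< u t u<t

  germ-outgoing : ∀ f {v e} d {t s} → on e t ≈ᴳ v → Germ (f ↾ e) d t s → OutgoingSlope f v e d s
  germ-outgoing f forward  {t} t≈v (u , t<u , lin) =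
    t , u , t≈v , unseal-at-< {t = t} {u} t<u , unseal-slope′ (value f) t u lin
  germ-outgoing f backward {t} t≈v (u , u<t , lin) =
    t , u , t≈v , unseal-at-< {t = u} {t} u<t , unseal-slope′ (value f) u t lin

  -- `slope` returns whichever slope excluded middle provides, possibly at another representative of
  -- `v`. By `same-point` that one has the same position as `t`, and the slope of a germ is unique,
  -- so any germ computes it.
  slope-germ : ∀ f {v e} d {t s} → on e t ≈ᴳ v → Germ (f ↾ e) d t s → slope f v e d ≡ s
  slope-germ f {v} {e} d {t} {s} t≈v g with em {∃[ s ] OutgoingSlope f v e d s}
  ... | no  none     = contradiction (s , germ-outgoing f d t≈v g) none
  ... | yes (s′ , o) = let (t′ , t′≈v , _ , g′) = outgoing-germ f d o
                           t′≈t = same-point t′≈v t≈v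
                       in Germ-unique d t′≈t (↾-cong f e t′≈t) g′ g

  slope-none : ∀ f {v e} d → (∀ t → on e t ≈ᴳ v → ¬ Leaves d t) → slope f v e d ≡ 0ℤ
  slope-none f {v} {e} d stuck with em {∃[ s ] OutgoingSlope f v e d s}
  ... | no  _       = refl
  ... | yes (_ , o) = let (t , t≈v , leaves , _) = outgoing-germ f d o in contradiction leaves (stuck t t≈v)

  -- The case distinction behind the lemmas on slopes: either a segment leaves, and then every
  -- rational function has a germ along it, or none does, and then all slopes have the default value
  -- 0.
  leaves? : ∀ v e d → (∃[ t ] (on e t ≈ᴳ v × Leaves d t)) ⊎ (∀ t → on e t ≈ᴳ v → ¬ Leaves d t)
  leaves? v e d with em {∃[ t ] (on e t ≈ᴳ v × Leaves d t)}
  ... | yes some = inj₁ some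
  ... | no  none = inj₂ λ t t≈v leaves → none (t , t≈v , leaves)

  slope-mono : ∀ f g {v} → (∀ x → val f x O.≤ val g x) → val f v O.≈ val g v →
               ∀ e d → slope f v e d ℤ.≤ slope g v e d
  slope-mono f g {v} f≤g eq e d with leaves? v e d
  ... | inj₂ stuck = ℤ.≤-reflexive (trans (slope-none f d stuck) (sym (slope-none g d stuck)))
  ... | inj₁ (t , t≈v , leaves) =
    let (r , gf) = germ d (↾-PL f e) leaves
        (s , gg) = germ d (↾-PL g e) leaves
    in subst₂ ℤ._≤_ (sym (slope-germ f d t≈v gf)) (sym (slope-germ g d t≈v gg))
         (Germ-≤ d (λ u → f≤g (on e u)) O.refl
           (O.trans (val-cong f t≈v) (O.trans eq (val-cong g (≈-sym t≈v)))) gf gg)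

  slope-+ : ∀ f g h {v} → (∀ x → val h x O.≈ val f x O.+ val g x) →
            ∀ e d → slope h v e d ≡ slope f v e d ℤ.+ slope g v e d
  slope-+ f g h {v} eq e d with leaves? v e d
  ... | inj₂ stuck = trans (slope-none h d stuck)
    (sym (cong₂ ℤ._+_ (slope-none f d stuck) (slope-none g d stuck)))
  ... | inj₁ (t , t≈v , leaves) =
    let (r , gf) = germ d (↾-PL f e) leaves
        (s , gg) = germ d (↾-PL g e) leaves
    in trans (slope-germ h d t≈v (Germ-resp d (λ u → O.sym (eq (on e u))) (Germ-+ d gf gg)))
         (sym (cong₂ ℤ._+_ (slope-germ f d t≈v gf) (slope-germ g d t≈v gg)))

  slope-constant : ∀ f {v e} c → (∀ t → (f ↾ e) t O.≈ c) → ∀ d → slope f v e d ≡ 0ℤ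
  slope-constant f {v} {e} c const d with leaves? v e d
  ... | inj₂ stuck = slope-none f d stuck
  ... | inj₁ (t , t≈v , leaves) = slope-germ f d t≈v (constant-germ d leaves)
    where
    constant-germ : ∀ d → Leaves d t → Germ (f ↾ e) d t 0ℤ
    constant-germ forward  t<hi = hi e , t<hi , Linear-const c (λ u _ _ → const u)
    constant-germ backward lo<t = lo e , lo<t , Linear-const c (λ u _ _ → const u)

  -- Divisors

  coeff-here : ∀ {n w D v} → w ≈ᴳ v → coeff ((n , w) ∷ D) v ≡ n ℤ.+ coeff D v
  coeff-here {w = w} {v = v} w≈v with em {w ≈ᴳ v}
  ... | yes _   = refl
  ... | no  w≉v = contradiction w≈v w≉v

  coeff-there : ∀ {n w D v} → ¬ (w ≈ᴳ v) → coeff ((n , w) ∷ D) v ≡ coeff D v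
  coeff-there {w = w} {v = v} w≉v with em {w ≈ᴳ v}
  ... | yes w≈v = contradiction w≈v w≉v
  ... | no  _   = refl

  coeff-∷-cong : ∀ {n w D D′ v} → coeff D v ≡ coeff D′ v → coeff ((n , w) ∷ D) v ≡ coeff ((n , w) ∷ D′) v
  coeff-∷-cong {n} {w} {v = v} eq with em {w ≈ᴳ v}
  ... | yes _ = cong (λ i → n ℤ.+ i) eq
  ... | no  _ = eq

  coeff-++ : ∀ D D′ v → coeff (D ++ D′) v ≡ coeff D v ℤ.+ coeff D′ v
  coeff-++ []            D′ v = sym (ℤ.+-identityˡ _)
  coeff-++ ((n , w) ∷ D) D′ v with em {w ≈ᴳ v}
  ... | yes _ = trans (cong (λ i → n ℤ.+ i) (coeff-++ D D′ v)) (sym (ℤ.+-assoc n _ _))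
  ... | no  _ = coeff-++ D D′ v

  negate : Divisor → Divisor
  negate = List.map (map₁ (λ n → ℤ.- n))

  coeff-negate : ∀ D v → coeff (negate D) v ≡ ℤ.- coeff D v
  coeff-negate []            v = refl
  coeff-negate ((n , w) ∷ D) v with em {w ≈ᴳ v}
  ... | yes _ = trans (cong (λ i → ℤ.- n ℤ.+ i) (coeff-negate D v)) (sym (ℤ.neg-distrib-+ n _))
  ... | no  _ = coeff-negate D v

  coeff-⊖ : ∀ D E v → coeff (D ⊖ E) v ≡ coeff D v ℤ.- coeff E v
  coeff-⊖ D E v = trans (coeff-++ D (negate E) v) (cong (λ i → coeff D v ℤ.+ i) (coeff-negate E v))

  deg-++ : ∀ D D′ → deg (D ++ D′) ≡ deg D ℤ.+ deg D′
  deg-++ []            D′ = sym (ℤ.+-identityˡ _)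
  deg-++ ((n , w) ∷ D) D′ = trans (cong (λ i → n ℤ.+ i) (deg-++ D D′)) (sym (ℤ.+-assoc n _ _))

  deg-negate : ∀ D → deg (negate D) ≡ ℤ.- deg D
  deg-negate []            = refl
  deg-negate ((n , w) ∷ D) = trans (cong (λ i → ℤ.- n ℤ.+ i) (deg-negate D)) (sym (ℤ.neg-distrib-+ n _))

  -- A divisor may list `w` several times, under several representatives and with opposite signs.
  -- Once these entries are merged, `multiplicity` is the coefficient at `w`; `rest-≤` serves the
  -- induction in `effective-ones`.
  record Collected (w : Point Γ) (D : Divisor) : Set where
    field
      multiplicity : ℤ
      rest         : Divisor
      rest-≤       : List.length rest ℕ.≤ List.length D
      rest-here    : ∀ v → w ≈ᴳ v → coeff rest v ≡ 0ℤ
      coeff-same   : ∀ v → coeff D v ≡ coeff ((multiplicity , w) ∷ rest) v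
      deg-same     : deg D ≡ multiplicity ℤ.+ deg rest

  prepend : ∀ {w D} n → Collected w D → Collected w ((n , w) ∷ D)
  prepend {w} {D} n c = record
    { multiplicity = n ℤ.+ multiplicity ; rest = rest ; rest-≤ = ℕ.m≤n⇒m≤1+n rest-≤
    ; rest-here = rest-here ; coeff-same = same
    ; deg-same = trans (cong (λ i → n ℤ.+ i) deg-same) (sym (ℤ.+-assoc n _ _)) }
    where
    open Collected c
    same : ∀ v → coeff ((n , w) ∷ D) v ≡ coeff ((n ℤ.+ multiplicity , w) ∷ rest) v
    same v with em {w ≈ᴳ v} | coeff-same v
    ... | yes _ | eq = trans (cong (λ i → n ℤ.+ i) eq) (sym (ℤ.+-assoc n _ _))
    ... | no  _ | eq = eq

  coeff-≈ : ∀ {n x w D} → x ≈ᴳ w → ∀ v → coeff ((n , x) ∷ D) v ≡ coeff ((n , w) ∷ D) v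
  coeff-≈ {x = x} {w} x≈w v with em {x ≈ᴳ v} | em {w ≈ᴳ v}
  ... | yes _   | yes _   = refl
  ... | no  _   | no  _   = refl
  ... | yes x≈v | no  w≉v = contradiction (≈-trans (≈-sym x≈w) x≈v) w≉v
  ... | no  x≉v | yes w≈v = contradiction (≈-trans x≈w w≈v) x≉v

  collect : ∀ w D → Collected w D
  collect w [] = record
    { multiplicity = 0ℤ ; rest = [] ; rest-≤ = ℕ.z≤n ; rest-here = λ _ _ → refl
    ; coeff-same = nothing ; deg-same = refl }
    where
    nothing : ∀ v → 0ℤ ≡ coeff ((0ℤ , w) ∷ []) v
    nothing v with em {w ≈ᴳ v}
    ... | yes _ = refl
    ... | no  _ = refl
  collect w ((n , x) ∷ D) with em {x ≈ᴳ w}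
  ... | yes x≈w = record
    { multiplicity = multiplicity ; rest = rest ; rest-≤ = rest-≤ ; rest-here = rest-here
    ; coeff-same = λ v → trans (coeff-≈ {D = D} x≈w v) (coeff-same v) ; deg-same = deg-same }
    where open Collected (prepend n (collect w D))
  ... | no  x≉w = record
    { multiplicity = multiplicity ; rest = (n , x) ∷ rest ; rest-≤ = ℕ.s≤s rest-≤
    ; rest-here = λ v w≈v → trans (coeff-there {D = rest} λ x≈v → x≉w (≈-trans x≈v (≈-sym w≈v))) (rest-here v w≈v)
    ; coeff-same = same
    ; deg-same = trans (cong (λ i → n ℤ.+ i) deg-same) (swap n multiplicity (deg rest)) }
    where
    open Collected (collect w D)
    swap : ∀ a b c → a ℤ.+ (b ℤ.+ c) ≡ b ℤ.+ (a ℤ.+ c)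
    swap a b c = trans (sym (ℤ.+-assoc a b c)) (trans (cong (λ i → i ℤ.+ c) (ℤ.+-comm a b)) (ℤ.+-assoc b a c))
    same : ∀ v → coeff ((n , x) ∷ D) v ≡ coeff ((multiplicity , w) ∷ (n , x) ∷ rest) v
    same v = begin
      coeff ((n , x) ∷ D) v                                  ≡⟨ coeff-++ cn D v ⟩
      coeff cn v ℤ.+ coeff D v                               ≡⟨ cong (λ i → coeff cn v ℤ.+ i)
        (trans (coeff-same v) (coeff-++ cw rest v)) ⟩
      coeff cn v ℤ.+ (coeff cw v ℤ.+ coeff rest v)           ≡⟨ swap (coeff cn v) (coeff cw v) (coeff rest v) ⟩
      coeff cw v ℤ.+ (coeff cn v ℤ.+ coeff rest v)           ≡⟨ cong (λ i → coeff cw v ℤ.+ i) (coeff-++ cn rest v) ⟨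
      coeff cw v ℤ.+ coeff ((n , x) ∷ rest) v                ≡⟨ coeff-++ cw ((n , x) ∷ rest) v ⟨
      coeff ((multiplicity , w) ∷ (n , x) ∷ rest) v          ∎
      where
      open ≡-Reasoning
      cn = (n , x) ∷ []
      cw = (multiplicity , w) ∷ []

  ones : List (Point Γ) → Divisor
  ones = List.map (1ℤ ,_)

  deg-ones : ∀ xs → deg (ones xs) ≡ + List.length xs
  deg-ones []       = refl
  deg-ones (x ∷ xs) = cong (λ i → 1ℤ ℤ.+ i) (deg-ones xs)

  coeff-ones-replicate : ∀ n w xs v →
    coeff (ones (List.replicate n w ++ xs)) v ≡ coeff ((+ n , w) ∷ ones xs) v
  coeff-ones-replicate zero w xs v with em {w ≈ᴳ v}
  ... | yes _ = sym (ℤ.+-identityˡ _)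
  ... | no  _ = refl
  coeff-ones-replicate (suc n) w xs v with em {w ≈ᴳ v} | coeff-ones-replicate n w xs v
  ... | yes _ | eq = trans (cong (λ i → 1ℤ ℤ.+ i) eq) (sym (ℤ.+-assoc 1ℤ (+ n) (coeff (ones xs) v)))
  ... | no  _ | eq = eq

  -- Effectiveness bounds the coefficients, not the entries of the list, which may be negative.
  -- Merging all entries at one point turns them into a non-negative coefficient, which is then
  -- written as that many copies of the point.
  effective-ones : ∀ D → Effective D → ∃[ xs ] ((∀ v → coeff D v ≡ coeff (ones xs) v) × deg D ≡ + List.length xs)
  effective-ones D = go (List.length D) D ℕ.≤-refl
    where
    go : ∀ k D → List.length D ℕ.≤ k → Effective D →
         ∃[ xs ] ((∀ v → coeff D v ≡ coeff (ones xs) v) × deg D ≡ + List.length xs)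
    go k [] _ _ = [] , (λ _ → refl) , refl
    go (suc k) D₀@((n , w) ∷ D) (ℕ.s≤s D≤k) eff = split multiplicity refl
      where
      c = collect w D
      -- Collecting within the tail and adding the head afterwards keeps `rest` no longer than the
      -- tail, hence shorter than `D₀`.
      open Collected (prepend n c)
      at-w : coeff D₀ w ≡ multiplicity
      at-w = trans (coeff-same w) (trans (coeff-here {D = rest} ≈-refl)
        (trans (cong (λ i → multiplicity ℤ.+ i) (rest-here w ≈-refl)) (ℤ.+-identityʳ _)))
      rest-effective : Effective rest
      rest-effective v = go′ (em {w ≈ᴳ v})
        where
        go′ : Dec (w ≈ᴳ v) → 0ℤ ℤ.≤ coeff rest v
        go′ (yes w≈v) = ℤ.≤-reflexive (sym (rest-here v w≈v))
        go′ (no  w≉v) = subst (0ℤ ℤ.≤_) (trans (coeff-same v) (coeff-there {D = rest} w≉v)) (eff v)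
      split : ∀ m → multiplicity ≡ m →
              ∃[ xs ] ((∀ v → coeff D₀ v ≡ coeff (ones xs) v) × deg D₀ ≡ + List.length xs)
      split -[1+ _ ] eq = contradiction (subst (0ℤ ℤ.≤_) (trans at-w eq) (eff w)) λ ()
      split (+ m)    eq =
        let (xs , same , deg≡) = go k rest (ℕ.≤-trans (Collected.rest-≤ c) D≤k) rest-effective
        in List.replicate m w ++ xs ,
           (λ v → trans (coeff-same v) (trans (coeff-∷-cong {D = rest} {ones xs} (same v))
             (trans (cong (λ i → coeff ((i , w) ∷ ones xs) v) eq) (sym (coeff-ones-replicate m w xs v))))) ,
           trans deg-same (trans (cong₂ ℤ._+_ eq deg≡) (cong +_ (sym
             (trans (List.length-++ (List.replicate m w)) (cong (ℕ._+ List.length xs) (List.length-replicate m))))))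

  effective-deg : ∀ D → Effective D → 0ℤ ℤ.≤ deg D
  effective-deg D eff = let (xs , _ , eq) = effective-ones D eff in subst (0ℤ ℤ.≤_) (sym eq) (ℤ.+≤+ ℕ.z≤n)

  -- Divisors of rational functions

  coeff-chip : ∀ {e} (a z : Edge e) {n D v} → on e z ≈ᴳ v →
               coeff ((n , on e a) ∷ D) v ≡ chip a z n ℤ.+ coeff D v
  coeff-chip {e} a z {n} {D} {v} z≈v with at a O.≈? at z
  ... | yes a≈z = coeff-here {D = D} (≈-trans (on-cong a≈z) z≈v)
  ... | no  a≉z = trans (coeff-there {D = D} λ a≈v → a≉z (same-point a≈v z≈v)) (sym (ℤ.+-identityˡ _))

  -- The same chips as in `divisor`, now as a formal sum of points of the graph, which has a degree.
  chips : ∀ {e} {φ : Edge e → O.Carrier} {a b} → PL φ a b → Divisor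
  chips (nil _)                    = []
  chips {e} (cons {a} m _ (s , _) r) = (s , on e a) ∷ (ℤ.- s , on e m) ∷ chips r

  deg-chips : ∀ {e} {φ : Edge e → O.Carrier} {a b} (p : PL φ a b) → deg (chips p) ≡ 0ℤ
  deg-chips (nil _)              = refl
  deg-chips (cons m _ (s , _) r) = trans (cong (λ i → s ℤ.+ (ℤ.- s ℤ.+ i)) (deg-chips r))
    (trans (cong (λ i → s ℤ.+ i) (ℤ.+-identityʳ _)) (ℤ.+-inverseʳ s))

  coeff-chips-on : ∀ {e} {φ : Edge e → O.Carrier} {a b z v} (p : PL φ a b) → on e z ≈ᴳ v →
                   coeff (chips p) v ≡ divisor p z
  coeff-chips-on (nil _) z≈v = refl
  coeff-chips-on {e} {z = z} {v} (cons {a} m _ (s , _) r) z≈v =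
    trans (coeff-chip a z {D = (ℤ.- s , on e m) ∷ chips r} z≈v) (cong (λ i → chip a z s ℤ.+ i)
      (trans (coeff-chip m z {D = chips r} z≈v) (cong (λ i → chip m z (ℤ.- s) ℤ.+ i) (coeff-chips-on r z≈v))))

  coeff-chips-off : ∀ {e} {φ : Edge e → O.Carrier} {a b v} (p : PL φ a b) → (∀ z → ¬ (on e z ≈ᴳ v)) →
                    coeff (chips p) v ≡ 0ℤ
  coeff-chips-off (nil _) off = refl
  coeff-chips-off {e} (cons {a} m _ (s , _) r) off = trans (coeff-there {D = (ℤ.- s , on e m) ∷ chips r} (off a))
    (trans (coeff-there {D = chips r} (off m)) (coeff-chips-off r off))

  -- Past the start of the edge this is `divisor-inside`, where the forward slope may be the default
  -- 0 of the far end; at the start it is `divisor-start`, with backward slope 0; off the edge both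
  -- slopes are 0. The subdivision `p` is arbitrary.
  coeff-chips : ∀ f {e} v (p : PL (f ↾ e) (lo e) (hi e)) →
                coeff (chips p) v ≡ slope f v e forward ℤ.+ slope f v e backward
  coeff-chips f {e} v p = decide em
    where
    right : ∀ {z} → on e z ≈ᴳ v → at z O.< at (hi e) ⊎ at z O.≈ at (hi e) →
            RightSlope (f ↾ e) z (hi e) (slope f v e forward)
    right z≈v (inj₂ z≈hi) = inj₁ (z≈hi , slope-none f forward λ t t≈v t<hi →
      <-irrefl (O.trans (same-point t≈v z≈v) z≈hi) t<hi)
    right {z} z≈v (inj₁ z<hi) = let (s , g@(u , z<u , lin)) = germ forward p z<hi in
      inj₂ (u , z<u , ≤hi u , subst (Linear (f ↾ e) z u) (sym (slope-germ f forward z≈v g)) lin)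
    on-e : ∀ {z} → on e z ≈ᴳ v → at (lo e) O.< at z ⊎ at (lo e) O.≈ at z →
           divisor p z ≡ slope f v e forward ℤ.+ slope f v e backward
    on-e {z} z≈v (inj₁ lo<z) = let (s , g@(u , u<z , lin)) = germ backward p lo<z in
      trans (divisor-inside (↾-cong f e) p lo<z (≤hi z) (right z≈v (≤⇒<⊎≈ (≤hi z))) u<z lin)
            (cong (λ i → slope f v e forward ℤ.+ i) (sym (slope-germ f backward z≈v g)))
    on-e {z} z≈v (inj₂ lo≈z) = trans (divisor-start (↾-cong f e) p (O.sym lo≈z) (right z≈v (≤⇒<⊎≈ (≤hi z))))
      (trans (sym (ℤ.+-identityʳ _)) (cong (λ i → slope f v e forward ℤ.+ i) (sym
        (slope-none f backward λ t t≈v lo<t → <-irrefl (O.trans lo≈z (same-point z≈v t≈v)) lo<t))))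
    decide : Dec (∃[ z ] on e z ≈ᴳ v) → coeff (chips p) v ≡ slope f v e forward ℤ.+ slope f v e backward
    decide (no  off) = trans (coeff-chips-off p λ z z≈v → off (z , z≈v))
      (sym (cong₂ ℤ._+_ (slope-none f {v} {e} forward λ z z≈v → contradiction (z , z≈v) off)
                        (slope-none f {v} {e} backward λ z z≈v → contradiction (z , z≈v) off)))
    decide (yes (z , z≈v)) = trans (coeff-chips-on p z≈v) (on-e z≈v (≤⇒<⊎≈ (lo≤ z)))

  coeff-concat : ∀ n (D : Fin n → Divisor) v →
                 coeff (List.concat (List.tabulate D)) v ≡ sum (λ i → coeff (D i) v)
  coeff-concat zero    D v = refl
  coeff-concat (suc n) D v = trans (coeff-++ (D zero) _ v)
    (cong (λ i → coeff (D zero) v ℤ.+ i) (coeff-concat n (λ i → D (suc i)) v))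

  deg-concat : ∀ n (D : Fin n → Divisor) → (∀ i → deg (D i) ≡ 0ℤ) → deg (List.concat (List.tabulate D)) ≡ 0ℤ
  deg-concat zero    D eq = refl
  deg-concat (suc n) D eq = trans (deg-++ (D zero) _)
    (cong₂ ℤ._+_ (eq zero) (deg-concat n (λ i → D (suc i)) (λ i → eq (suc i))))

  -- `ord` is merely a function on points. A member of a linear system has to be a finite sum, and
  -- this one has the values of `ord` as coefficients.
  div : RationalFunction Γ → Divisor
  div f = List.concat (List.tabulate λ e → chips (↾-PL f e))

  coeff-div : ∀ f v → coeff (div f) v ≡ ord v f
  coeff-div f v = trans (coeff-concat size (λ e → chips (↾-PL f e)) v)
    (sum-cong-≗ λ e → coeff-chips f v (↾-PL f e))

  deg-div : ∀ f → deg (div f) ≡ 0ℤ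
  deg-div f = deg-concat size (λ e → chips (↾-PL f e)) (λ e → deg-chips (↾-PL f e))

  -- Construction of rational functions

  module Build (V : Point Γ → O.Carrier) (V-cong : ∀ {x y} → x ≈ᴳ y → V x O.≈ V y)
    (V-PL : ∀ e → PL (λ t → V (on e t)) (lo e) (hi e)) where

    -- `Pieces` admits no one-point pieces, `Subdivision` does. They are skipped by letting `u` move
    -- on at the same position while `t` remains the recorded start; a piece that reaches the end of
    -- the edge becomes `last`.
    toPieces : ∀ {e} (t u : Edge e) → at t O.≈ at u → at t O.< at (hi e) → PL (λ t → V (on e t)) u (hi e) →
               Pieces Γ (λ x → ⌞ V x ⌟) e (pos t)
    toPieces t u t≈u t<hi (nil u≈hi) = contradiction t<hi (<-irrefl (O.trans t≈u u≈hi))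
    toPieces {e} t u t≈u t<hi (cons m u≤m (s , lin) rest) with ≤⇒<⊎≈ u≤m | ≤⇒<⊎≈ (≤hi m)
    ... | inj₂ u≈m | _ = toPieces t m (O.trans t≈u u≈m) t<hi rest
    ... | inj₁ u<m | inj₁ m<hi = step (pos m) s
      (unseal-at-< {t = t} {m} (≤-<-trans (≤-reflexive t≈u) u<m)) (unseal-at-< {t = m} {hi e} m<hi)
      (unseal-slope V t m (Linear-restrict (≈⇒≥ t≈u) ≤-refl lin)) (toPieces m m O.refl m<hi rest)
    ... | inj₁ u<m | inj₂ m≈hi =
      last s (unseal-slope V t (hi e) (Linear-restrict (≈⇒≥ t≈u) (≈⇒≥ m≈hi) lin))

    function : RationalFunction Γ
    function = record
      { value      = λ x → ⌞ V x ⌟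
      ; value-cong = λ x≈y → ⌞⌟-cong (V-cong x≈y)
      ; pieces     = λ e → toPieces (lo e) (lo e) O.refl (lo<hi e) (V-PL e)
      }

  open Build using (function)

  PL-constant : ∀ {e} (a b : Edge e) {φ : Edge e → O.Carrier} c → at a O.≤ at b → (∀ t → φ t O.≈ c) → PL φ a b
  PL-constant a b c a≤b eq = single a≤b (0ℤ , Linear-const c λ t _ _ → eq t)

  constant : O.Carrier → RationalFunction Γ
  constant c = function (λ _ → c) (λ _ → O.refl) λ e → PL-constant (lo e) (hi e) c (lo≤ (hi e)) λ _ → O.refl

  infixl 6 _⊞_
  _⊞_ : RationalFunction Γ → RationalFunction Γ → RationalFunction Γ
  f ⊞ g = function (λ x → val f x O.+ val g x) (λ x≈y → O.+-cong (val-cong f x≈y) (val-cong g x≈y))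
                   (λ e → PL-+ (↾-PL f e) (↾-PL g e))

  _⋎_ : RationalFunction Γ → RationalFunction Γ → RationalFunction Γ
  f ⋎ g = function (λ x → val f x O.⊔ val g x) (λ x≈y → O.⊔-cong (val-cong f x≈y) (val-cong g x≈y))
                   (λ e → PL-⊔ (↾-PL f e) (↾-PL g e))

  val-⋎ : ∀ f g x → val (f ⋎ g) x O.≈ val f x O.⊔ val g x
  val-⋎ f g x = O.reflexive ⌜⌞ _ ⌟⌝

  ord-⊞ : ∀ f g v → ord v (f ⊞ g) ≡ ord v f ℤ.+ ord v g
  ord-⊞ f g v = trans (sum-cong-≗ λ e → trans
      (cong₂ ℤ._+_ (slope-+ f g (f ⊞ g) {v} (λ x → O.reflexive ⌜⌞ _ ⌟⌝) e forward)
                   (slope-+ f g (f ⊞ g) {v} (λ x → O.reflexive ⌜⌞ _ ⌟⌝) e backward))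
      (interchange (slope f v e forward) _ _ _))
    (∑-distrib-+ (λ e → slope f v e forward ℤ.+ slope f v e backward) _)
    where
    open Semigroup (CommutativeMonoid.commutativeSemigroup ℤ.+-0-commutativeMonoid) using (interchange)

  ord-constant : ∀ c v → ord v (constant c) ≡ 0ℤ
  ord-constant c v = trans (sum-cong-≗ λ e → cong₂ ℤ._+_
      (slope-constant (constant c) {v} {e} c (λ t → O.reflexive ⌜⌞ c ⌟⌝) forward)
      (slope-constant (constant c) {v} {e} c (λ t → O.reflexive ⌜⌞ c ⌟⌝) backward))
    (sum-replicate-zero size)

  sum-single : ∀ {n} (g : Fin n → ℤ) i → (∀ j → j ≢ i → g j ≡ 0ℤ) → sum g ≡ g i
  sum-single {suc n} g zero    others = trans (cong (λ k → g zero ℤ.+ k)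
      (trans (sum-cong-≗ λ j → others (suc j) λ ()) (sum-replicate-zero n)))
    (ℤ.+-identityʳ _)
  sum-single {suc n} g (suc i) others = trans (cong₂ ℤ._+_ (others zero λ ())
      (sum-single (λ j → g (suc j)) i λ j j≢i → others (suc j) λ eq → j≢i (Fin.suc-injective eq)))
    (ℤ.+-identityˡ _)

  -- The tent on one edge, extended by zero

  module TentFunction {e : Fin size} {a p q b : Edge e} (a≤p : at a O.≤ at p) (p≤q : at p O.≤ at q)
    (q≤b : at q O.≤ at b) (p-a≈b-q : at p O.- at a O.≈ at b O.- at q) where

    open Tent (lo≤ a) a≤p p≤q q≤b (≤hi b) p-a≈b-q

    -- The decision is an argument, so that each property of the extension can be proved by cases on
    -- it.
    on-edge : ∀ e′ → Dec (e′ ≡ e) → Edge e′ → O.Carrier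
    on-edge e′ (yes refl) t = tent t
    on-edge e′ (no  _)    t = O.0#

    V : Point Γ → O.Carrier
    V (vertex _) = O.0#
    V (on e′ t)  = on-edge e′ (e′ Fin.≟ e) t

    on-edge-vertex : ∀ {e′ v} (d : Dec (e′ ≡ e)) (t : Edge e′) → OnVertex t v → on-edge e′ d t O.≈ O.0#
    on-edge-vertex (yes refl) t (inj₁ (t≈lo , _)) = tent-start t t≈lo
    on-edge-vertex (yes refl) t (inj₂ (t≈hi , _)) = tent-end t t≈hi
    on-edge-vertex (no  _)    t _                 = O.refl

    V-vertex : ∀ {x v} → IsVertex {Γ} x v → V x O.≈ O.0#
    V-vertex {vertex _} _ = O.refl
    V-vertex {on e′ t}  p = on-edge-vertex (e′ Fin.≟ e) t (on-vertex p refl)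

    on-edge-cong : ∀ {e′} (d : Dec (e′ ≡ e)) (t u : Edge e′) → at t O.≈ at u → on-edge e′ d t O.≈ on-edge e′ d u
    on-edge-cong (yes refl) t u t≈u = tent-cong t≈u
    on-edge-cong (no  _)    t u t≈u = O.refl

    V-cong : ∀ {x y} → x ≈ᴳ y → V x O.≈ V y
    V-cong (same-vertex p q) = O.trans (V-vertex p) (O.sym (V-vertex q))
    V-cong (same-position {e′} {t} {u} t≃u) = on-edge-cong (e′ Fin.≟ e) t u (seal-at-≃ t u t≃u)

    on-edge-PL : ∀ e′ (d : Dec (e′ ≡ e)) → PL (on-edge e′ d) (lo e′) (hi e′)
    on-edge-PL e′ (yes refl) = tent-PL
    on-edge-PL e′ (no  _)    = PL-constant (lo e′) (hi e′) O.0# (lo≤ (hi e′)) λ _ → O.refl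

    tentᶠ : RationalFunction Γ
    tentᶠ = function V V-cong λ e′ → on-edge-PL e′ (e′ Fin.≟ e)

    tent-chips : Divisor
    tent-chips = (-1ℤ , on e a) ∷ (1ℤ , on e p) ∷ (1ℤ , on e q) ∷ (-1ℤ , on e b) ∷ []

    -- Since `coeff-chips` holds for every subdivision of the function, the explicit `tent-PL` may
    -- replace the one read off from `tentᶠ`, and the chips are known from `divisor-tent`.
    tent-slopes : ∀ v → slope tentᶠ v e forward ℤ.+ slope tentᶠ v e backward ≡ coeff tent-chips v
    tent-slopes v = trans (sym (coeff-chips tentᶠ v tent-PL′)) (go em)
      where
      on-edge-e : ∀ d t → on-edge e d t ≡ tent t
      on-edge-e (yes refl) t = refl
      on-edge-e (no  e≢e)  t = contradiction refl e≢e
      eq : ∀ t → tent t O.≈ (tentᶠ ↾ e) t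
      eq t = O.reflexive (sym (trans ⌜⌞ _ ⌟⌝ (on-edge-e (e Fin.≟ e) t)))
      tent-PL′ : PL (tentᶠ ↾ e) (lo e) (hi e)
      tent-PL′ = PL-resp eq tent-PL
      go : Dec (∃[ z ] on e z ≈ᴳ v) → coeff (chips tent-PL′) v ≡ coeff tent-chips v
      go (no  off) = trans (coeff-chips-off tent-PL′ λ z z≈v → off (z , z≈v)) (sym (
        trans (coeff-there {D = (1ℤ , on e p) ∷ (1ℤ , on e q) ∷ (-1ℤ , on e b) ∷ []} λ z → off (_ , z)) (
        trans (coeff-there {D = (1ℤ , on e q) ∷ (-1ℤ , on e b) ∷ []} λ z → off (_ , z)) (
        trans (coeff-there {D = (-1ℤ , on e b) ∷ []} λ z → off (_ , z)) (
        coeff-there {D = []} λ z → off (_ , z))))))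
      go (yes (z , z≈v)) = trans (coeff-chips-on tent-PL′ z≈v) (trans (divisor-resp eq tent-PL z)
        (trans (divisor-tent z) (sym (
        trans (coeff-chip a z {D = (1ℤ , on e p) ∷ (1ℤ , on e q) ∷ (-1ℤ , on e b) ∷ []} z≈v) (cong (λ i → chip a z -1ℤ ℤ.+ i) (
        trans (coeff-chip p z {D = (1ℤ , on e q) ∷ (-1ℤ , on e b) ∷ []} z≈v) (cong (λ i → chip p z 1ℤ ℤ.+ i) (
        trans (coeff-chip q z {D = (-1ℤ , on e b) ∷ []} z≈v) (cong (λ i → chip q z 1ℤ ℤ.+ i) (
        trans (coeff-chip b z {D = []} z≈v) (ℤ.+-identityʳ _)))))))))))

    ord-tent : ∀ v → ord v tentᶠ ≡ coeff tent-chips v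
    ord-tent v = trans (sum-single (λ e′ → slope tentᶠ v e′ forward ℤ.+ slope tentᶠ v e′ backward) e λ e′ e′≢e →
        cong₂ ℤ._+_ (slope-constant tentᶠ {v} {e′} O.0# (zero-off e′≢e) forward)
                    (slope-constant tentᶠ {v} {e′} O.0# (zero-off e′≢e) backward))
      (tent-slopes v)
      where
      zero-off : ∀ {e′} → e′ ≢ e → ∀ t → (tentᶠ ↾ e′) t O.≈ O.0#
      zero-off {e′} e′≢e t = O.reflexive (trans ⌜⌞ _ ⌟⌝ (off (e′ Fin.≟ e)))
        where
        off : ∀ d → on-edge e′ d t ≡ O.0#
        off (yes e′≡e) = contradiction e′≡e e′≢e
        off (no  _)    = refl

  -- Ranks

  sum-mono-≤ : ∀ {n} {g h : Fin n → ℤ} → (∀ i → g i ℤ.≤ h i) → sum g ℤ.≤ sum h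
  sum-mono-≤ {zero}  g≤h = ℤ.≤-refl
  sum-mono-≤ {suc n} g≤h = ℤ.+-mono-≤ (g≤h zero) (sum-mono-≤ λ i → g≤h (suc i))

  sum-mono-< : ∀ {n} {g h : Fin n → ℤ} → (∀ i → g i ℤ.≤ h i) → ∀ i → g i ℤ.< h i → sum g ℤ.< sum h
  sum-mono-< g≤h zero    lt = ℤ.+-mono-<-≤ lt (sum-mono-≤ λ i → g≤h (suc i))
  sum-mono-< g≤h (suc i) lt = ℤ.+-mono-≤-< (g≤h zero) (sum-mono-< (λ i → g≤h (suc i)) i lt)

  infix 4 _⊑_
  record _⊑_ (f g : RationalFunction Γ) : Set where
    constructor below
    field val-≤ : ∀ x → val f x O.≤ val g x
  open _⊑_

  ord-mono-≤ : ∀ f g {v} → f ⊑ g → val f v O.≈ val g v → ord v f ℤ.≤ ord v g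
  ord-mono-≤ f g f⊑g eq = sum-mono-≤ λ e →
    ℤ.+-mono-≤ (slope-mono f g (val-≤ f⊑g) eq e forward) (slope-mono f g (val-≤ f⊑g) eq e backward)

  ord-mono-< : ∀ f g {v} → f ⊑ g → val f v O.≈ val g v → ∀ e d → slope f v e d ≢ slope g v e d →
               ord v f ℤ.< ord v g
  ord-mono-< f g {v} f⊑g eq e d ne = sum-mono-<
    (λ e → ℤ.+-mono-≤ (mono e forward) (mono e backward)) e (strict d ne)
    where
    mono = slope-mono f g {v} (val-≤ f⊑g) eq
    strict : ∀ d → slope f v e d ≢ slope g v e d →
             slope f v e forward ℤ.+ slope f v e backward ℤ.< slope g v e forward ℤ.+ slope g v e backward
    strict forward  ne = ℤ.+-mono-<-≤ (ℤ.≤∧≢⇒< (mono e forward) ne) (mono e backward)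
    strict backward ne = ℤ.+-mono-≤-< (mono e forward) (ℤ.≤∧≢⇒< (mono e backward) ne)

  total : Divisor → RationalFunction Γ → Point Γ → ℤ
  total D f v = coeff D v ℤ.+ ord v f

  -- The term comes from chip firing: the debts in `D` can be paid off, that is, the complete linear
  -- system of `D` is non-empty.
  record Winnable (D : Divisor) : Set where
    constructor won
    field effective-form : ∃[ F ] ∣ D ∣ F

  winnable : ∀ D f → (∀ v → 0ℤ ℤ.≤ total D f v) → Winnable D
  winnable D f eff = won (D ++ div f , (λ v → subst (0ℤ ℤ.≤_) (sym (same v)) (eff v)) , f , same)
    where
    same : ∀ v → coeff (D ++ div f) v ≡ total D f v
    same v = trans (coeff-++ D (div f) v) (cong (λ i → coeff D v ℤ.+ i) (coeff-div f v))

  winning : ∀ D → Winnable D → ∃[ f ] (∀ v → 0ℤ ℤ.≤ total D f v)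
  winning D (won (F , eff , f , same)) = f , λ v → subst (0ℤ ℤ.≤_) (same v) (eff v)

  Winnable-cong : ∀ D D′ → (∀ v → coeff D v ≡ coeff D′ v) → Winnable D → Winnable D′
  Winnable-cong D D′ eq (won (F , eff , f , same)) =
    won (F , eff , f , λ v → trans (same v) (cong (λ i → i ℤ.+ ord v f) (eq v)))

  Winnable⇒0≤deg : ∀ D → Winnable D → 0ℤ ℤ.≤ deg D
  Winnable⇒0≤deg D w = let (f , eff) = winning D w in
    subst (0ℤ ℤ.≤_) (trans (deg-++ D (div f)) (trans (cong (λ i → deg D ℤ.+ i) (deg-div f)) (ℤ.+-identityʳ _)))
      (effective-deg (D ++ div f) λ v → subst (0ℤ ℤ.≤_)
        (sym (trans (coeff-++ D (div f) v) (cong (λ i → coeff D v ℤ.+ i) (coeff-div f v)))) (eff v))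

  δ : Point Γ → Point Γ → ℤ
  δ w = coeff (ones (w ∷ []))

  δ-here : ∀ {w v} → w ≈ᴳ v → δ w v ≡ 1ℤ
  δ-here w≈v = coeff-here {D = []} w≈v

  δ-there : ∀ {w v} → ¬ (w ≈ᴳ v) → δ w v ≡ 0ℤ
  δ-there w≉v = coeff-there {D = []} w≉v

  0≤δ : ∀ w v → 0ℤ ℤ.≤ δ w v
  0≤δ w v with em {w ≈ᴳ v}
  ... | yes _ = ℤ.+≤+ ℕ.z≤n
  ... | no  _ = ℤ.≤-refl

  coeff-minus : ∀ w D v → coeff ((-1ℤ , w) ∷ D) v ≡ coeff D v ℤ.- δ w v
  coeff-minus w D v with em {w ≈ᴳ v}
  ... | yes _ = ℤ.+-comm -1ℤ (coeff D v)
  ... | no  _ = sym (ℤ.+-identityʳ _)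

  total-minus : ∀ D w f v → total (D ⊖ ones (w ∷ [])) f v ≡ total D f v ℤ.- δ w v
  total-minus D w f v = trans (cong (λ i → i ℤ.+ ord v f) (coeff-⊖ D (ones (w ∷ [])) v))
    (solve 3 (λ a b c → a :- b :+ c := a :+ c :- b) refl (coeff D v) (δ w v) (ord v f))
    where open +-*-Solver

  winnable-minus : ∀ D w f → (∀ v → δ w v ℤ.≤ total D f v) → Winnable (D ⊖ ones (w ∷ []))
  winnable-minus D w f le = winnable (D ⊖ ones (w ∷ [])) f λ v →
    subst (0ℤ ℤ.≤_) (sym (total-minus D w f v)) (ℤ.i≤j⇒0≤j-i (le v))

  winning-minus : ∀ D w → Winnable (D ⊖ ones (w ∷ [])) → ∃[ f ] (∀ v → δ w v ℤ.≤ total D f v)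
  winning-minus D w win = let (f , eff) = winning (D ⊖ ones (w ∷ [])) win in
    f , λ v → ℤ.0≤i-j⇒j≤i (subst (0ℤ ℤ.≤_) (total-minus D w f v) (eff v))

  -- The maximum of two functions

  module Join (D : Divisor) (f g : RationalFunction Γ)
    (f-eff : ∀ v → 0ℤ ℤ.≤ total D f v) (g-eff : ∀ v → 0ℤ ℤ.≤ total D g v) where

    h : RationalFunction Γ
    h = f ⋎ g

    f⊑h : f ⊑ h
    f⊑h = below λ x → ≤-trans (O.x≤x⊔y (val f x) (val g x)) (≈⇒≥ (val-⋎ f g x))

    g⊑h : g ⊑ h
    g⊑h = below λ x → ≤-trans (O.y≤x⊔y (val f x) (val g x)) (≈⇒≥ (val-⋎ f g x))

    above-f : ∀ {v} → val f v O.≈ val h v → total D f v ℤ.≤ total D h v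
    above-f {v} eq = ℤ.+-monoʳ-≤ (coeff D v) (ord-mono-≤ f h f⊑h eq)

    above-g : ∀ {v} → val g v O.≈ val h v → total D g v ℤ.≤ total D h v
    above-g {v} eq = ℤ.+-monoʳ-≤ (coeff D v) (ord-mono-≤ g h g⊑h eq)

    h-eff : ∀ v → 0ℤ ℤ.≤ total D h v
    h-eff v = go (O.⊔-sel (val f v) (val g v))
      where
      go : _ → 0ℤ ℤ.≤ total D h v
      go (inj₁ eq) = ℤ.≤-trans (f-eff v) (above-f (O.sym (O.trans (val-⋎ f g v) eq)))
      go (inj₂ eq) = ℤ.≤-trans (g-eff v) (above-g (O.sym (O.trans (val-⋎ f g v) eq)))

    module _ {v : Point Γ} (f≈g : val f v O.≈ val g v) where

      f≈h : val f v O.≈ val h v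
      f≈h = O.sym (O.trans (val-⋎ f g v) (O.y≤x⇒x⊔y≈x (≈⇒≥ f≈g)))

      g≈h : val g v O.≈ val h v
      g≈h = O.sym (O.trans (val-⋎ f g v) (O.x≤y⇒x⊔y≈y (≤-reflexive f≈g)))

      -- The slope of `h` cannot equal both of two different slopes. For the function from which it
      -- differs, the inequality between the orders is strict, and the total of that function is
      -- already non-negative.
      slopes-differ : ∀ e d → slope f v e d ≢ slope g v e d → 1ℤ ℤ.≤ total D h v
      slopes-differ e d f≢g = go (slope f v e d ℤ.≟ slope h v e d)
        where
        go : Dec (slope f v e d ≡ slope h v e d) → 1ℤ ℤ.≤ total D h v
        go (no  f≢h) = ℤ.i<j⇒suc[i]≤j (ℤ.≤-<-trans (f-eff v)
          (ℤ.+-monoʳ-< (coeff D v) (ord-mono-< f h f⊑h f≈h e d f≢h)))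
        go (yes f≡h) = ℤ.i<j⇒suc[i]≤j (ℤ.≤-<-trans (g-eff v)
          (ℤ.+-monoʳ-< (coeff D v) (ord-mono-< g h g⊑h g≈h e d λ g≡h → f≢g (trans f≡h (sym g≡h)))))

  on-lo : ∀ {e} {t : Edge e} → at (lo e) O.≈ at t → vertex (src e) ≈ᴳ on e t
  on-lo {t = t} lo≈t = same-vertex at-vertex (vertex-on {t = t} (inj₁ (O.sym lo≈t , refl)))

  on-hi : ∀ {e} {t : Edge e} → at t O.≈ at (hi e) → vertex (tgt e) ≈ᴳ on e t
  on-hi {t = t} t≈hi = same-vertex at-vertex (vertex-on {t = t} (inj₂ (t≈hi , refl)))

  -- Fires the complement of [a, b], which moves a chip from either end inwards, until x is reached.
  fire : ∀ D h {e} {a x b : Edge e} → at a O.< at x → at x O.< at b → (∀ v → 0ℤ ℤ.≤ total D h v) →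
         (∀ v → on e a ≈ᴳ v → 1ℤ ℤ.≤ total D h v) → (∀ v → on e b ≈ᴳ v → 1ℤ ℤ.≤ total D h v) →
         Winnable (D ⊖ ones (on e x ∷ []))
  fire D h {e} {a} {x} {b} a<x x<b eff chip-a chip-b =
    winnable-minus D (on e x) (h ⊞ tentᶠ) λ v → ℤ.≤-trans (reaches v) (after v)
    where
    points = tent-points {a = a} {x} {b} (<⇒≤ a<x) (<⇒≤ x<b)
    p = proj₁ points
    q = proj₁ (proj₂ points)
    a≤p = proj₁ (proj₂ (proj₂ points))
    p≤q = proj₁ (proj₂ (proj₂ (proj₂ points)))
    q≤b = proj₁ (proj₂ (proj₂ (proj₂ (proj₂ points))))
    balanced = proj₁ (proj₂ (proj₂ (proj₂ (proj₂ (proj₂ points)))))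
    x≈ = proj₂ (proj₂ (proj₂ (proj₂ (proj₂ (proj₂ points)))))
    open TentFunction {e} {a} {p} {q} {b} a≤p p≤q q≤b balanced
    open +-*-Solver
    -- Each end is known to hold only one chip, so this bound requires `a` and `b` to be different
    -- points of the graph, not just different positions.
    ends : ∀ v → δ (on e a) v ℤ.+ δ (on e b) v ℤ.≤ total D h v
    ends v = go em em
      where
      go : Dec (on e a ≈ᴳ v) → Dec (on e b ≈ᴳ v) → δ (on e a) v ℤ.+ δ (on e b) v ℤ.≤ total D h v
      go (yes a≈v) (yes b≈v) = contradiction (O.<-≤-trans a<x (<⇒≤ x<b)) (<-irrefl (same-point a≈v b≈v))
      go (yes a≈v) (no  b≉v) = subst (λ i → i ℤ.≤ total D h v)
        (sym (cong₂ ℤ._+_ (δ-here a≈v) (δ-there b≉v))) (chip-a v a≈v)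
      go (no  a≉v) (yes b≈v) = subst (λ i → i ℤ.≤ total D h v)
        (sym (cong₂ ℤ._+_ (δ-there a≉v) (δ-here b≈v))) (chip-b v b≈v)
      go (no  a≉v) (no  b≉v) = subst (λ i → i ℤ.≤ total D h v)
        (sym (cong₂ ℤ._+_ (δ-there a≉v) (δ-there b≉v))) (eff v)
    reaches : ∀ v → δ (on e x) v ℤ.≤ δ (on e p) v ℤ.+ δ (on e q) v
    reaches v = go x≈
      where
      go : _ → δ (on e x) v ℤ.≤ δ (on e p) v ℤ.+ δ (on e q) v
      go (inj₁ p≈x) = subst (λ i → i ℤ.≤ δ (on e p) v ℤ.+ δ (on e q) v)
        (trans (ℤ.+-identityʳ _) (coeff-≈ {D = []} (on-cong p≈x) v)) (ℤ.+-monoʳ-≤ (δ (on e p) v) (0≤δ (on e q) v))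
      go (inj₂ q≈x) = subst (λ i → i ℤ.≤ δ (on e p) v ℤ.+ δ (on e q) v)
        (trans (ℤ.+-identityˡ _) (coeff-≈ {D = []} (on-cong q≈x) v)) (ℤ.+-monoˡ-≤ (δ (on e q) v) (0≤δ (on e p) v))
    coeff-tent : ∀ v → coeff tent-chips v ≡
      δ (on e p) v ℤ.+ δ (on e q) v ℤ.- (δ (on e a) v ℤ.+ δ (on e b) v)
    coeff-tent v = trans (coeff-minus (on e a) _ v) (trans (cong (λ i → i ℤ.- δ (on e a) v)
      (trans (coeff-++ (ones (on e p ∷ on e q ∷ [])) ((-1ℤ , on e b) ∷ []) v)
        (cong₂ ℤ._+_ (coeff-++ (ones (on e p ∷ [])) (ones (on e q ∷ [])) v) (coeff-minus (on e b) [] v))))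
      (solve 4 (λ a b p q → p :+ q :+ (con 0ℤ :- b) :- a := p :+ q :- (a :+ b)) refl
        (δ (on e a) v) (δ (on e b) v) (δ (on e p) v) (δ (on e q) v)))
    after : ∀ v → δ (on e p) v ℤ.+ δ (on e q) v ℤ.≤ total D (h ⊞ tentᶠ) v
    after v = begin
      δp ℤ.+ δq                                              ≡⟨ solve 3 (λ p q s → p :+ q := s :+ (p :+ q :- s)) refl δp δq (δa ℤ.+ δb) ⟩
      (δa ℤ.+ δb) ℤ.+ (δp ℤ.+ δq ℤ.- (δa ℤ.+ δb))            ≤⟨ ℤ.+-monoˡ-≤ _ (ends v) ⟩
      total D h v ℤ.+ (δp ℤ.+ δq ℤ.- (δa ℤ.+ δb))            ≡⟨ cong (λ i → total D h v ℤ.+ i) (trans (ord-tent v) (coeff-tent v)) ⟨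
      total D h v ℤ.+ ord v tentᶠ                            ≡⟨ ℤ.+-assoc (coeff D v) _ _ ⟩
      coeff D v ℤ.+ (ord v h ℤ.+ ord v tentᶠ)                ≡⟨ cong (λ i → coeff D v ℤ.+ i) (ord-⊞ h tentᶠ v) ⟨
      total D (h ⊞ tentᶠ) v                                  ∎
      where
      open ℤ.≤-Reasoning
      δa = δ (on e a) v
      δb = δ (on e b) v
      δp = δ (on e p) v
      δq = δ (on e q) v

  one-chip : ∀ D h w → (∀ v → 0ℤ ℤ.≤ total D h v) → (∀ v → w ≈ᴳ v → 1ℤ ℤ.≤ total D h v) →
             ∀ v → δ w v ℤ.≤ total D h v
  one-chip D h w eff chip v = go em
    where
    go : Dec (w ≈ᴳ v) → δ w v ℤ.≤ total D h v
    go (yes w≈v) = subst (λ i → i ℤ.≤ total D h v) (sym (δ-here w≈v)) (chip v w≈v)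
    go (no  w≉v) = subst (λ i → i ℤ.≤ total D h v) (sym (δ-there w≉v)) (eff v)

  winnable-on-edge : ∀ D {e} (x : Edge e) → Winnable (D ⊖ ones (vertex (src e) ∷ [])) →
                     Winnable (D ⊖ ones (vertex (tgt e) ∷ [])) → Winnable (D ⊖ ones (on e x ∷ []))
  winnable-on-edge D {e} x win-src win-tgt = go (≤⇒<⊎≈ a≤x) (≤⇒<⊎≈ x≤b)
    where
    f = proj₁ (winning-minus D (vertex (src e)) win-src)
    f-src = proj₂ (winning-minus D (vertex (src e)) win-src)
    g₀ = proj₁ (winning-minus D (vertex (tgt e)) win-tgt)
    c = val f (on e x) O.- val g₀ (on e x)
    g = g₀ ⊞ constant c

    total-g : ∀ v → total D g v ≡ total D g₀ v
    total-g v = cong (λ i → coeff D v ℤ.+ i) (trans (ord-⊞ g₀ (constant c) v)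
      (trans (cong (λ i → ord v g₀ ℤ.+ i) (ord-constant c v)) (ℤ.+-identityʳ _)))
    g-tgt : ∀ v → δ (vertex (tgt e)) v ℤ.≤ total D g v
    g-tgt v = subst (δ (vertex (tgt e)) v ℤ.≤_) (sym (total-g v)) (proj₂ (winning-minus D (vertex (tgt e)) win-tgt) v)

    open Join D f g (λ v → ℤ.≤-trans (0≤δ (vertex (src e)) v) (f-src v))
                    (λ v → ℤ.≤-trans (0≤δ (vertex (tgt e)) v) (g-tgt v))

    meet : (f ↾ e) x O.≈ (g ↾ e) x
    meet = O.sym (begin
      val g (on e x)                              ≡⟨ ⌜⌞ _ ⌟⌝ ⟩
      val g₀ (on e x) O.+ val (constant c) (on e x)  ≡⟨ cong (λ y → val g₀ (on e x) O.+ y) ⌜⌞ c ⌟⌝ ⟩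
      val g₀ (on e x) O.+ c                       ≈⟨ O.Solver.solve 2 (λ x y → y O.Solver.⊕ (x O.Solver.⊕ O.Solver.⊝ y) O.Solver.⊜ x) O.refl _ _ ⟩
      val f (on e x)                              ∎)
      where open O.≈R

    pieces-of-both : Subdivision (BothSloped (f ↾ e) (g ↾ e)) (lo e) (hi e)
    pieces-of-both = PL-both (↾-PL f e) (↾-PL g e)

    left : BranchLeft (↾-cong f e) (↾-cong g e) (lo e) x
    left = branchLeft (↾-cong f e) (↾-cong g e)
      (restrict BothSloped-hereditary pieces-of-both ≤-refl (lo≤ x) (≤hi x)) meet

    right : BranchRight (↾-cong f e) (↾-cong g e) x (hi e)
    right = branchRight (↾-cong f e) (↾-cong g e)
      (restrict BothSloped-hereditary pieces-of-both (lo≤ x) (≤hi x) ≤-refl) meet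

    a = proj₁ left
    a≤x = proj₁ (proj₂ (proj₂ left))
    b = proj₁ right
    x≤b = proj₁ (proj₂ right)

    meet-at : ∀ t → (f ↾ e) t O.≈ (g ↾ e) t → ∀ v → on e t ≈ᴳ v → val f v O.≈ val g v
    meet-at t eq v t≈v = O.trans (val-cong f (≈-sym t≈v)) (O.trans eq (val-cong g t≈v))

    chip-a : ∀ v → on e a ≈ᴳ v → 1ℤ ℤ.≤ total D h v
    chip-a v a≈v = cases (proj₂ (proj₂ (proj₂ (proj₂ left))))
      where
      eq = meet-at a (proj₁ (proj₂ (proj₂ (proj₂ left)))) v a≈v
      cases : _ → 1ℤ ℤ.≤ total D h v
      -- If the agreement reaches the source, the chip there belongs to `f`; `h` touches `f` at that
      -- point since `f` and `g` still agree. At the target the chip comes from `g` in the same way.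
      cases (inj₁ lo≈a) = ℤ.≤-trans
        (subst (λ i → i ℤ.≤ total D f v) (δ-here (≈-trans (on-lo lo≈a) a≈v)) (f-src v)) (above-f (f≈h eq))
      -- The slopes left of `a` are given along the edge, so the outgoing ones are their negatives.
      cases (inj₂ (u , r , s , u<a , linf , ling , r≢s)) = slopes-differ eq e backward λ same →
        r≢s (ℤ.neg-injective (trans (sym (outgoing f linf)) (trans same (outgoing g ling))))
        where
        outgoing : ∀ k {r} → Linear (k ↾ e) u a r → slope k v e backward ≡ ℤ.- r
        outgoing k {r} lin = slope-germ k backward a≈v
          (u , u<a , subst (Linear (k ↾ e) u a) (sym (ℤ.neg-involutive r)) lin)

    chip-b : ∀ v → on e b ≈ᴳ v → 1ℤ ℤ.≤ total D h v
    chip-b v b≈v = cases (proj₂ (proj₂ (proj₂ (proj₂ right))))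
      where
      eq = meet-at b (proj₁ (proj₂ (proj₂ (proj₂ right)))) v b≈v
      cases : _ → 1ℤ ℤ.≤ total D h v
      cases (inj₁ b≈hi) = ℤ.≤-trans
        (subst (λ i → i ℤ.≤ total D g v) (δ-here (≈-trans (on-hi b≈hi) b≈v)) (g-tgt v)) (above-g (g≈h eq))
      cases (inj₂ (u , r , s , b<u , linf , ling , r≢s)) = slopes-differ eq e forward λ same →
        r≢s (trans (sym (slope-germ f forward b≈v (u , b<u , linf)))
          (trans same (slope-germ g forward b≈v (u , b<u , ling))))

    go : at a O.< at x ⊎ at a O.≈ at x → at x O.< at b ⊎ at x O.≈ at b → Winnable (D ⊖ ones (on e x ∷ []))
    go (inj₂ a≈x) _          = winnable-minus D (on e x) h
      (one-chip D h (on e x) h-eff λ v x≈v → chip-a v (≈-trans (on-cong a≈x) x≈v))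
    go (inj₁ _)   (inj₂ x≈b) = winnable-minus D (on e x) h
      (one-chip D h (on e x) h-eff λ v x≈v → chip-b v (≈-trans (on-cong (O.sym x≈b)) x≈v))
    go (inj₁ a<x) (inj₁ x<b) = fire D h a<x x<b h-eff chip-a chip-b

  winnable-everywhere : ∀ D → (∀ v → Winnable (D ⊖ ones (vertex v ∷ []))) → ∀ x → Winnable (D ⊖ ones (x ∷ []))
  winnable-everywhere D win (vertex v) = win v
  winnable-everywhere D win (on e x)   = winnable-on-edge D x (win (src e)) (win (tgt e))

  -- Replacing points by vertices

  coeff-ones-∷ : ∀ x xs v → coeff (ones (x ∷ xs)) v ≡ δ x v ℤ.+ coeff (ones xs) v
  coeff-ones-∷ x xs v = coeff-++ (ones (x ∷ [])) (ones xs) v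

  coeff-⊖-∷ : ∀ D x xs v → coeff (D ⊖ ones (x ∷ xs)) v ≡ coeff D v ℤ.- (δ x v ℤ.+ coeff (ones xs) v)
  coeff-⊖-∷ D x xs v = trans (coeff-⊖ D (ones (x ∷ xs)) v) (cong (λ i → coeff D v ℤ.- i) (coeff-ones-∷ x xs v))

  coeff-⊖-⊖ : ∀ D E F v → coeff (D ⊖ E ⊖ F) v ≡ coeff D v ℤ.- coeff E v ℤ.- coeff F v
  coeff-⊖-⊖ D E F v = trans (coeff-⊖ (D ⊖ E) F v) (cong (λ i → i ℤ.- coeff F v) (coeff-⊖ D E v))

  head-last : ∀ D x xs v → coeff (D ⊖ ones xs ⊖ ones (x ∷ [])) v ≡ coeff (D ⊖ ones (x ∷ xs)) v
  head-last D x xs v = trans (coeff-⊖-⊖ D (ones xs) (ones (x ∷ [])) v) (trans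
    (solve 3 (λ d x y → d :- y :- x := d :- (x :+ y)) refl (coeff D v) (δ x v) (coeff (ones xs) v))
    (sym (coeff-⊖-∷ D x xs v)))
    where open +-*-Solver

  head-first : ∀ D x xs v → coeff (D ⊖ ones (x ∷ []) ⊖ ones xs) v ≡ coeff (D ⊖ ones (x ∷ xs)) v
  head-first D x xs v = trans (coeff-⊖-⊖ D (ones (x ∷ [])) (ones xs) v) (trans
    (solve 3 (λ d x y → d :- x :- y := d :- (x :+ y)) refl (coeff D v) (δ x v) (coeff (ones xs) v))
    (sym (coeff-⊖-∷ D x xs v)))
    where open +-*-Solver

  -- By contraposition of `winnable-everywhere` for `D ⊖ ones xs`, the point `x` may be exchanged
  -- for some vertex `v` with all of `xs` still subtracted. Then `v` is absorbed into `D`, and the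
  -- recursion exchanges `xs`.
  obstruct-at-vertices : ∀ xs D → ¬ Winnable (D ⊖ ones xs) →
    ∃[ vs ] (List.length vs ≡ List.length xs × ¬ Winnable (D ⊖ ones (List.map vertex vs)))
  obstruct-at-vertices []       D lose = [] , refl , lose
  obstruct-at-vertices (x ∷ xs) D lose =
    let (v , lose-v) = Order.¬∀⇒∃¬ em {P = λ v → Winnable (D ⊖ ones xs ⊖ ones (vertex v ∷ []))} λ win →
          lose (Winnable-cong (D ⊖ ones xs ⊖ ones (x ∷ [])) (D ⊖ ones (x ∷ xs)) (head-last D x xs)
            (winnable-everywhere (D ⊖ ones xs) win x))
        (vs , len , lose-vs) = obstruct-at-vertices xs (D ⊖ ones (vertex v ∷ [])) λ win →
          lose-v (Winnable-cong (D ⊖ ones (vertex v ∷ []) ⊖ ones xs) (D ⊖ ones xs ⊖ ones (vertex v ∷ []))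
            (λ y → trans (head-first D (vertex v) xs y) (sym (head-last D (vertex v) xs y))) win)
    in v ∷ vs , cong suc len , λ win → lose-vs
         (Winnable-cong (D ⊖ ones (vertex v ∷ List.map vertex vs))
           (D ⊖ ones (vertex v ∷ []) ⊖ ones (List.map vertex vs))
           (λ y → sym (head-first D (vertex v) (List.map vertex vs) y)) win)

  ones-effective : ∀ xs → Effective (ones xs)
  ones-effective []       v = ℤ.≤-refl
  ones-effective (x ∷ xs) v = subst (0ℤ ℤ.≤_) (sym (coeff-ones-∷ x xs v))
    (ℤ.+-mono-≤ (0≤δ x v) (ones-effective xs v))

  vertices-branching : ∀ vs → Div BranchingPoint (ones (List.map vertex vs))
  vertices-branching []       y ≢0 = contradiction refl ≢0
  vertices-branching (v ∷ vs) y ≢0 = go em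
    where
    go : Dec (vertex v ≈ᴳ y) → BranchingPoint y
    go (yes v≈y) = v , ≈-sym v≈y
    go (no  v≉y) = vertices-branching vs y λ ≡0 →
      ≢0 (trans (coeff-there {D = ones (List.map vertex vs)} v≉y) ≡0)

  obstructed-at-vertices : ∀ D vs → ¬ Winnable (D ⊖ ones (List.map vertex vs)) →
                           ObstructedDegree BranchingPoint D (+ List.length vs)
  obstructed-at-vertices D vs lose = ones (List.map vertex vs) , vertices-branching vs ,
    ones-effective (List.map vertex vs) , (λ form → lose (won form)) ,
    trans (deg-ones (List.map vertex vs)) (cong +_ (List.length-map vertex vs))

  obstructed-U⇒B : ∀ D k → ObstructedDegree U D k → ObstructedDegree BranchingPoint D k
  obstructed-U⇒B D k (E , _ , eff , lose , deg≡k) =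
    let (xs , same , deg≡) = effective-ones E eff
        (vs , len , lose-vs) = obstruct-at-vertices xs D λ win → lose (Winnable.effective-form
          (Winnable-cong (D ⊖ ones xs) (D ⊖ E) (λ v → trans (coeff-⊖ D (ones xs) v)
            (trans (cong (λ i → coeff D v ℤ.- i) (sym (same v))) (sym (coeff-⊖ D E v)))) win))
    in subst (ObstructedDegree BranchingPoint D) (trans (cong +_ len) (trans (sym deg≡) deg≡k))
         (obstructed-at-vertices D vs lose-vs)

  obstructed-B⇒U : ∀ D k → ObstructedDegree BranchingPoint D k → ObstructedDegree U D k
  obstructed-B⇒U D k (E , _ , rest) = E , (λ _ _ → tt) , rest

  -- Existence of the ranks

  some-vertex : Fin order
  some-vertex = go order nonEmpty
    where
    go : ∀ n → ℕ.NonZero n → Fin n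
    go (suc n) _ = zero

  obstructed : ∀ D → ∃[ k ] ObstructedDegree BranchingPoint D k
  obstructed D = _ , obstructed-at-vertices D vs λ win → ℤ.<⇒≱ negative (Winnable⇒0≤deg (D ⊖ E) win)
    where
    -- One chip more than the absolute value of the degree, so that `D ⊖ E` has negative degree
    -- whatever the sign of `deg D`.
    n = suc ℤ.∣ deg D ∣
    vs = List.replicate n some-vertex
    E = ones (List.map vertex vs)
    deg-E : deg E ≡ + n
    deg-E = trans (deg-ones (List.map vertex vs))
      (cong +_ (trans (List.length-map vertex vs) (List.length-replicate n)))
    deg≡ : deg (D ⊖ E) ≡ deg D ℤ.- + n
    deg≡ = trans (deg-++ D (negate E)) (cong (λ i → deg D ℤ.+ i) (trans (deg-negate E) (cong ℤ.-_ deg-E)))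
    negative : deg (D ⊖ E) ℤ.< 0ℤ
    negative = subst (ℤ._< 0ℤ) (sym deg≡) (below-zero (deg D))
      where
      below-zero : ∀ i → i ℤ.- + suc ℤ.∣ i ∣ ℤ.< 0ℤ
      below-zero (+ m)    = subst (ℤ._< 0ℤ) (sym (trans (ℤ.⊖-< {m} {suc m} ℕ.≤-refl)
        (cong (λ i → ℤ.- + i) (trans (ℕ.+-∸-assoc 1 {m} {m} ℕ.≤-refl) (cong suc (ℕ.n∸n≡0 m)))))) ℤ.-<+
      below-zero -[1+ m ] = ℤ.-<+

  obstructed-nonneg : ∀ {A} D k → ObstructedDegree A D k → 0ℤ ℤ.≤ k
  obstructed-nonneg D k (E , _ , eff , _ , deg≡k) = subst (0ℤ ℤ.≤_) deg≡k (effective-deg E eff)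

  -- Excluded middle either confirms that `k` is least or yields a smaller element of `P`. Both are
  -- non-negative, so the absolute value drops, and its bound `n` makes the descent end.
  minimum : (P : Pred ℤ 0ℓ) → (∀ k → P k → 0ℤ ℤ.≤ k) → ∀ k → P k → ∃[ m ] IsMinimum P m
  minimum P nonneg k Pk = go ℤ.∣ k ∣ k (ℕ.≤-refl) Pk
    where
    go : ∀ n k → ℤ.∣ k ∣ ℕ.≤ n → P k → ∃[ m ] IsMinimum P m
    smaller : ∀ n j k → 0ℤ ℤ.≤ j → ℤ.∣ k ∣ ℕ.≤ n → j ℤ.< k → P j → ∃[ m ] IsMinimum P m
    smaller (suc n) (+ j) (+ k) _ k≤n (ℤ.+<+ j<k) Pj = go n (+ j) (ℕ.≤-pred (ℕ.≤-trans j<k k≤n)) Pj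
    smaller zero    (+ j) (+ k) _ k≤0 (ℤ.+<+ j<k) Pj = contradiction (ℕ.≤-trans j<k k≤0) λ ()
    go n k k≤n Pk with em {∃[ j ] (P j × j ℤ.< k)}
    ... | no  none           = k , Pk , λ j Pj → ℤ.≮⇒≥ λ j<k → none (j , Pj , j<k)
    ... | yes (j , Pj , j<k) = smaller n j k (nonneg j Pj) k≤n j<k Pj

  -- The same degrees are obstructed for both sets of points, so the minimum found for the branching
  -- points is also the minimum for all points.
  rank-determining : RankDetermining BranchingPoint
  rank-determining D =
    let (k , obs)       = obstructed D
        (m , Pm , least) = minimum (ObstructedDegree BranchingPoint D) (obstructed-nonneg D) k obs
    in m ℤ.- 1ℤ ,
       (m , (obstructed-B⇒U D m Pm , λ j obs-j → least j (obstructed-U⇒B D j obs-j)) , refl) ,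
       (m , (Pm , least) , refl)

theorem1p7 : (em : ExcludedMiddle 0ℓ) (Γ : MetricGraph) → Loopless Γ →
    Divisors.RankDetermining em Γ BranchingPoint
theorem1p7 em Γ loopless = Graph.rank-determining em Γ loopless
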